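{- Let $F$ be a 3-resonant fullerene graph different from the dodecahedron $F_{20}$, and let $B$ be a maximal pentagonal fragment of $F$. Then $B$ is either a single pentagon or a turtle.
   Context: A fullerene graph is a 3-connected plane cubic graph with exactly 12 pentagonal faces and all other faces hexagonal. A fragment of $F$ is a subgraph consisting of a cycle of $F$ together with its interior (one side of the cycle in the plane). A fragment is pentagonal if every inner face is a pentagon, and a pentagonal fragment $B$ is maximal if all faces of $F$ not in $B$ sharing an edge with $B$ are hexagons. A turtle is a pentagonal fragment whose inner faces are six pentagons $f_0,\dots,f_5$ where the pairs sharing an edge are exactly $\{f_0,f_1\},\{f_1,f_2\},\{f_1,f_3\},\{f_2,f_3\},\{f_2,f_4\},\{f_3,f_4\},\{f_4,f_5\}$. A set $\mathcal H$ of pairwise vertex-disjoint hexagonal faces is a resonant pattern if $F$ has a perfect matching $M$ such that every hexagon in $\mathcal H$ is $M$-alternating (edges alternately in and off $M$). $F$ is $k$-resonant if every set of $i$ pairwise disjoint hexagons, for each $0\le i\le k$, is a resonant pattern. -}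

module Defs where

open import Data.Nat using (ℕ; zero; suc; _+_; _*_; _≤_; _<_; _%_)
open import Data.Fin using (Fin; zero; suc; toℕ)
open import Data.Product using (Σ; ∃; _×_; _,_; proj₁; proj₂)
open import Data.Sum using (_⊎_)
open import Data.Unit using (⊤)
open import Data.Empty using (⊥)
open import Data.List using (List; []; _∷_; length)
open import Data.List.Relation.Unary.All using (All)
open import Data.List.Relation.Unary.Any using (Any)
open import Data.List.Relation.Unary.AllPairs using (AllPairs)
open import Relation.Nullary using (¬_)
open import Relation.Binary.PropositionalEquality using (_≡_; _≢_)
open import Function.Bundles using (_⇔_; _↔_; Inverse)

iter : {A : Set} → (A → A) → ℕ → A → A
iter f zero    x = x
iter f (suc k) x = f (iter f k x)

rot3 : Fin 3 → Fin 3
rot3 zero             = suc zero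
rot3 (suc zero)       = suc (suc zero)
rot3 (suc (suc zero)) = zero

Injective : {A B : Set} → (A → B) → Set
Injective f = ∀ x y → f x ≡ f y → x ≡ y

PairIn : List (ℕ × ℕ) → ℕ → ℕ → Set
PairIn es x y = Any (λ e → (e ≡ (x , y)) ⊎ (e ≡ (y , x))) es

-- Plane cubic graphs, given by a rotation system.
-- Vertices are Fin n; vertex v has the three distinct neighbours
-- nb v 0, nb v 1, nb v 2, listed in the cyclic (clockwise) order of the
-- embedding.  A dart (v , i) is the edge v — nb v i directed away from v.

Dart : ℕ → Set
Dart n = Fin n × Fin 3

alpha : ∀ {n} → (Fin n → Fin 3 → Fin n) → (Fin n → Fin 3 → Fin 3) → Dart n → Dart n
alpha nb rev (v , i) = (nb v i , rev v i)

-- face traversal: walk along the dart, then turn to the next edge in the rotation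
phi : ∀ {n} → (Fin n → Fin 3 → Fin n) → (Fin n → Fin 3 → Fin 3) → Dart n → Dart n
phi nb rev (v , i) = (nb v i , rot3 (rev v i))

-- paths using only vertices satisfying ok (except possibly the start)
data Reach {n : ℕ} (nb : Fin n → Fin 3 → Fin n) (ok : Fin n → Set) : Fin n → Fin n → Set where
  here : ∀ {u} → Reach nb ok u u
  step : ∀ {u v} (i : Fin 3) → ok (nb u i) → Reach nb ok (nb u i) v → Reach nb ok u v

record PlaneCubicGraph : Set₁ where
  field
    n        : ℕ
    nb       : Fin n → Fin 3 → Fin n
    rev      : Fin n → Fin 3 → Fin 3
    nb-rev   : ∀ v i → nb (nb v i) (rev v i) ≡ v
    nb-inj   : ∀ v i j → nb v i ≡ nb v j → i ≡ j
    loopless : ∀ v i → nb v i ≢ v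
    nf        : ℕ
    face      : Dart n → Fin nf
    face-orbit : ∀ d e → (face d ≡ face e) ⇔ (∃ λ k → iter (phi nb rev) k d ≡ e)
    face-surj : ∀ f → ∃ λ d → face d ≡ f
    connected : ∀ u v → Reach nb (λ _ → ⊤) u v
    -- Euler's formula V − E + F = 2 with E = 3V/2 (genus 0, i.e. the embedding is plane)
    euler     : 2 * n + 2 * nf ≡ 4 + 3 * n

module _ (G : PlaneCubicGraph) where
  open PlaneCubicGraph G

  α : Dart n → Dart n
  α = alpha nb rev

  φ : Dart n → Dart n
  φ = phi nb rev

  Adj : Fin n → Fin n → Set
  Adj u v = ∃ λ i → nb u i ≡ v

  FaceLength : Fin nf → ℕ → Set
  FaceLength f k = ∀ d → face d ≡ f →
    (iter φ k d ≡ d) × (∀ j → 0 < j → j < k → iter φ j d ≢ d)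

  IsPentagon : Fin nf → Set
  IsPentagon f = FaceLength f 5

  IsHexagon : Fin nf → Set
  IsHexagon f = FaceLength f 6

  OnFace : Fin n → Fin nf → Set
  OnFace v f = ∃ λ i → face (v , i) ≡ f

  SharesEdge : Fin nf → Fin nf → Set
  SharesEdge f g = ∃ λ d → (face d ≡ f) × (face (α d) ≡ g)

  VertexDisjoint : Fin nf → Fin nf → Set
  VertexDisjoint f g = ∀ v → OnFace v f → OnFace v g → ⊥

  ThreeConnected : Set
  ThreeConnected = (4 ≤ n) × (∀ a b u v → u ≢ a → u ≢ b → v ≢ a → v ≢ b →
    Reach nb (λ w → (w ≢ a) × (w ≢ b)) u v)

  -- Perfect matchings: each vertex v is matched along its edge M v,
  -- consistently from both ends.
  PerfectMatching : Set
  PerfectMatching = Σ (Fin n → Fin 3) λ M → ∀ v → M (nb v (M v)) ≡ rev v (M v)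

  InM : PerfectMatching → Dart n → Set
  InM M (v , i) = proj₁ M v ≡ i

  Alternating : PerfectMatching → Fin nf → Set
  Alternating M f = ∀ d → face d ≡ f →
    (InM M d ⊎ InM M (φ d)) × ¬ (InM M d × InM M (φ d))

  ResonantPattern : List (Fin nf) → Set
  ResonantPattern H = Σ PerfectMatching λ M → All (Alternating M) H

  KResonant : ℕ → Set
  KResonant k = ∀ (H : List (Fin nf)) → length H ≤ k → All IsHexagon H →
    AllPairs VertexDisjoint H → ResonantPattern H

  -- Fragments.  A fragment is given by its set S of inner faces; it is the
  -- subgraph formed by a cycle c together with one of its sides, namely the
  -- side consisting of the faces in S.  Thus the edges of c are exactly the
  -- edges separating a face in S from a face not in S.
  IsFragment : (Fin nf → Set) → Set
  IsFragment S = ∃ λ m → Σ (Fin (3 + m) → Fin n) λ c →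
    Injective c ×
    (∀ j j' → suc (toℕ j) % (3 + m) ≡ toℕ j' → Adj (c j) (c j')) ×
    (∀ (d : Dart n) →
      (∃ λ j → ∃ λ j' → (suc (toℕ j) % (3 + m) ≡ toℕ j') ×
         (((c j ≡ proj₁ d) × (c j' ≡ nb (proj₁ d) (proj₂ d))) ⊎
          ((c j' ≡ proj₁ d) × (c j ≡ nb (proj₁ d) (proj₂ d)))))
      ⇔ ((S (face d) × ¬ S (face (α d))) ⊎ (¬ S (face d) × S (face (α d)))))

  IsPentagonalFragment : (Fin nf → Set) → Set
  IsPentagonalFragment S = IsFragment S × (∀ f → S f → IsPentagon f)

  IsMaximalPentagonalFragment : (Fin nf → Set) → Set
  IsMaximalPentagonalFragment S = IsPentagonalFragment S ×
    (∀ f g → S f → ¬ S g → SharesEdge f g → IsHexagon g)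

  SinglePentagon : (Fin nf → Set) → Set
  SinglePentagon S = ∃ λ f → IsPentagon f × (∀ g → S g ⇔ (g ≡ f))

  turtleEdges : List (ℕ × ℕ)
  turtleEdges = (0 , 1) ∷ (1 , 2) ∷ (1 , 3) ∷ (2 , 3) ∷ (2 , 4) ∷ (3 , 4) ∷ (4 , 5) ∷ []

  IsTurtle : (Fin nf → Set) → Set
  IsTurtle S = Σ (Fin 6 → Fin nf) λ t → Injective t ×
    (∀ g → S g ⇔ (∃ λ i → t i ≡ g)) × (∀ i → IsPentagon (t i)) ×
    (∀ i j → i ≢ j → SharesEdge (t i) (t j) ⇔ PairIn turtleEdges (toℕ i) (toℕ j))

-- The dodecahedron graph F20 on Fin 20: outer 5-cycle a_i = i, spokes to
-- b_i = 5+i, 10-cycle b0 c0 b1 c1 … b4 c4 with c_i = 10+i, spokes c_i — d_i,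
-- inner 5-cycle d_i = 15+i.
dodecahedronEdges : List (ℕ × ℕ)
dodecahedronEdges =
  (0 , 1) ∷ (1 , 2) ∷ (2 , 3) ∷ (3 , 4) ∷ (4 , 0) ∷
  (0 , 5) ∷ (1 , 6) ∷ (2 , 7) ∷ (3 , 8) ∷ (4 , 9) ∷
  (5 , 10) ∷ (6 , 11) ∷ (7 , 12) ∷ (8 , 13) ∷ (9 , 14) ∷
  (10 , 6) ∷ (11 , 7) ∷ (12 , 8) ∷ (13 , 9) ∷ (14 , 5) ∷
  (10 , 15) ∷ (11 , 16) ∷ (12 , 17) ∷ (13 , 18) ∷ (14 , 19) ∷
  (15 , 16) ∷ (16 , 17) ∷ (17 , 18) ∷ (18 , 19) ∷ (19 , 15) ∷ []

DodAdj : Fin 20 → Fin 20 → Set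
DodAdj x y = PairIn dodecahedronEdges (toℕ x) (toℕ y)

IsoToDodecahedron : PlaneCubicGraph → Set
IsoToDodecahedron G = Σ (Fin n ↔ Fin 20) λ iso →
  ∀ u v → Adj G u v ⇔ DodAdj (Inverse.to iso u) (Inverse.to iso v)
  where open PlaneCubicGraph G

record Fullerene : Set₁ where
  field
    graph        : PlaneCubicGraph
    threeConn    : ThreeConnected graph
    pentOrHex    : ∀ f → IsPentagon graph f ⊎ IsHexagon graph f
    pentagons    : Fin 12 → Fin (PlaneCubicGraph.nf graph)
    pentagons-inj : Injective pentagons
    pentagons-pent : ∀ i → IsPentagon graph (pentagons i)
    pentagons-all  : ∀ f → IsPentagon graph f → ∃ λ i → pentagons i ≡ f

module Submission where

-- In a 3-resonant fullerene, removing at most three disjoint hexagons always leaves a perfect matching.  The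
-- simplest forbidden pattern: if the three faces opposite to a vertex v at its neighbours are hexagons, they
-- isolate v.  Disjointness is automatic, because two faces share at most one edge and the faces across two
-- nonadjacent edges of a third face are disjoint.  Otherwise a short dual cycle would cut the graph, and then
-- either some face is too short, or hexagons surround the cycle ring by ring in a tube, and all faces are
-- hexagons.
--
-- Take a boundary pentagon of the region which has, in cyclic order, a hexagon followed by a pentagon next to
-- it, and explore the surrounding faces one by one, distinguishing pentagons from hexagons.  The exploration is
-- finite: every branch ends in a forbidden pattern, in a turtle, or with a second boundary component of the
-- region.  The explored patch need not be embedded: all conclusions are drawn from its image in the graph.

open import Defs
open import Relation.Binary.PropositionalEquality
import Data.Nat.Properties as ℕₚ
import Data.List.Relation.Unary.Any as Any
open import Data.Nat using (ℕ; zero; suc; _+_; _∸_; _≤_; _<_; s≤s; z<s; s<s; _≡ᵇ_; _<ᵇ_; _/_; _%_)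
open import Data.Nat.Properties
  using (m≤n⇒m<n∨m≡n; ≤-refl; ≡ᵇ⇒≡; ≡⇒≡ᵇ; <ᵇ⇒<; <⇒≢; ≤-trans; n≤1+n; <-≤-trans; ≤-reflexive; m<n⇒m<1+n;
    +-suc; +-identityʳ; ≤-pred)
open import Data.Fin using (Fin; zero; suc; toℕ; fromℕ<)
open import Data.Product using (Σ; ∃; ∃-syntax; _×_; _,_; proj₁; proj₂)
open import Data.Sum as Sum using (_⊎_; inj₁; inj₂)
open import Data.Empty using (⊥; ⊥-elim)
open import Relation.Nullary using (¬_; Dec; yes; no; does)
open import Function.Bundles using (Equivalence; mk⇔)
open import Data.Bool using (Bool; true; false; _∧_; _∨_; if_then_else_; not)
open import Data.List using (List; []; _∷_; length; _∷ʳ_; foldr; foldl; map)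
open import Data.Maybe using (Maybe; just; nothing)
open import Data.Bool.Properties using (T-≡)
open import Data.List.Relation.Unary.All using (All; []; _∷_)
open import Data.Maybe.Properties using (just-injective)
open import Data.Unit using (⊤; tt)
open import Data.Product.Properties using (≡-dec)
open import Relation.Nullary.Decidable using (_⊎-dec_; decidable-stable; _×-dec_)
open import Data.List.Properties using (length-map)
open import Data.List.Relation.Unary.AllPairs using (AllPairs; []; _∷_)
open import Data.Nat.DivMod using (m%n<n; m%n%n≡m%n; [m+n]%n≡m%n; m<n⇒m%n≡m; %-distribˡ-+)
open import Data.Fin.Properties using (toℕ-injective; toℕ<n; toℕ-fromℕ<; any?; _≟_)
open import Data.Fin.Patterns using (0F; 1F; 2F; 3F; 4F; 5F)

-- The case distinctions are data; only their checker is proved correct. A patch is a `Table` with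
-- an assignment of darts of `G` that may identify its vertices. So wherever two darts must differ
-- there is a certificate: suppose that they agree, follow one path from both, and meet a visible
-- contradiction. The coincidences that arise when a face closes up on vertices already present are
-- refuted in the same way.
--
-- These refutations use the disjointness facts, which are therefore obtained in stages: dual cycles
-- of length two with no fact at all, then those of length three with the result for length two. The
-- growth of a tube is not an induction over rings: its pattern is shown to recur at all three
-- neighbours of its root vertex, and connectedness does the rest.
--
-- The region enters through its bounding cycle: the edges between the region and the hexagons
-- around it form a single orbit of a boundary walk. This excludes a second boundary component, and
-- it also shows that the pentagons found are all of `S`, although `S` is an arbitrary predicate
-- that need not be decidable.

data Len : Set where
  pent hex : Len

length5or6 : Len → ℕ
length5or6 pent = 5
length5or6 hex  = 6

iter-suc : ∀ {A : Set} (f : A → A) k x → iter f (suc k) x ≡ iter f k (f x)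
iter-suc f zero    x = refl
iter-suc f (suc k) x = cong f (iter-suc f k x)

-- Darts, rotations and face lengths

module Darts (G : PlaneCubicGraph) where
  open PlaneCubicGraph G

  D : Set
  D = Dart n

  flip turn : D → D
  flip = α G
  turn (v , i) = v , rot3 i

  next : D → D
  next = φ G

  turn³ : ∀ d → turn (turn (turn d)) ≡ d
  turn³ (v , zero)           = refl
  turn³ (v , suc zero)       = refl
  turn³ (v , suc (suc zero)) = refl

  flip² : ∀ d → flip (flip d) ≡ d
  flip² (v , i) = cong₂ _,_ (nb-rev v i) (nb-inj v _ i back)
    where
    w = nb v i
    j = rev v i
    back : nb v (rev w j) ≡ nb v i
    back = trans (cong (λ u → nb u (rev w j)) (sym (nb-rev v i))) (nb-rev w j)

  turn-injective : ∀ {d e} → turn d ≡ turn e → d ≡ e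
  turn-injective {d} {e} p = trans (sym (turn³ d)) (trans (cong (λ x → turn (turn x)) p) (turn³ e))

  flip≢ : ∀ d → proj₁ (flip d) ≢ proj₁ d
  flip≢ (v , i) = loopless v i

  turn≢ : ∀ d → turn d ≢ d
  turn≢ (v , zero) ()
  turn≢ (v , suc zero) ()
  turn≢ (v , suc (suc zero)) ()

  same-ends : ∀ d e → proj₁ d ≡ proj₁ e → proj₁ (flip d) ≡ proj₁ (flip e) → d ≡ e
  same-ends (v , i) (.v , j) refl q = cong (v ,_) (nb-inj v i j q)

  face-next : ∀ d → face (next d) ≡ face d
  face-next d = sym (Equivalence.from (face-orbit d (next d)) (1 , refl))

  face-iter : ∀ k d → face (iter next k d) ≡ face d
  face-iter zero    d = refl
  face-iter (suc k) d = trans (face-next _) (face-iter k d)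

  -- `next` sends `flip d` to `turn d`, so the face beyond an edge can be read at the tail of that
  -- edge.
  face-flip : ∀ d → face (flip d) ≡ face (turn d)
  face-flip d = trans (sym (face-next (flip d))) (cong (λ e → face (turn e)) (flip² d))

  -- A record instead of an alias: `FaceLength` unfolds to a function type, from which unification
  -- would not recover `L` and `d`.
  record HasLen (L : Len) (d : D) : Set where
    constructor hasLen
    field lengthOf : FaceLength G (face d) (length5or6 L)
  open HasLen public

  HasLen-face : ∀ {L d e} → face d ≡ face e → HasLen L d → HasLen L e
  HasLen-face {L} p (hasLen h) = hasLen (subst (λ f → FaceLength G f (length5or6 L)) p h)

  period : ∀ {L d} → HasLen L d → iter next (length5or6 L) d ≡ d
  period {d = d} (hasLen h) = proj₁ (h d refl)

  minimal : ∀ {L d} → HasLen L d → ∀ j → 0 < j → j < length5or6 L → iter next j d ≢ d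
  minimal {d = d} (hasLen h) = proj₂ (h d refl)

  pent≢hex : ∀ {d} → HasLen pent d → HasLen hex d → ⊥
  pent≢hex {d} p h = minimal h 5 z<s (s<s (s<s (s<s (s<s (s<s z<s))))) (period p)

  HasLen-unique : ∀ {L K d} → HasLen L d → HasLen K d → L ≡ K
  HasLen-unique {pent} {pent} p q = refl
  HasLen-unique {pent} {hex}  p q = ⊥-elim (pent≢hex p q)
  HasLen-unique {hex}  {pent} p q = ⊥-elim (pent≢hex q p)
  HasLen-unique {hex}  {hex}  p q = refl

  private
    wrap : ∀ {L d} → HasLen L d → ∀ k → ∃[ p ] p < length5or6 L × iter next p d ≡ iter next k d
    wrap {pent} h zero = 0 , z<s , refl
    wrap {hex}  h zero = 0 , z<s , refl
    wrap {L} h (suc k) with wrap {L} h k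
    ... | p , p<L , eq with m≤n⇒m<n∨m≡n p<L
    ... | inj₁ sp<L = suc p , sp<L , cong next eq
    wrap {pent} h (suc k) | p , p<L , eq | inj₂ refl = 0 , z<s , trans (sym (period h)) (cong next eq)
    wrap {hex}  h (suc k) | p , p<L , eq | inj₂ refl = 0 , z<s , trans (sym (period h)) (cong next eq)

  on-face : ∀ {L d e} → HasLen L d → face d ≡ face e → ∃[ p ] p < length5or6 L × iter next p d ≡ e
  on-face {d = d} {e} h q with Equivalence.to (face-orbit d e) q
  ... | k , eq with wrap h k
  ... | p , p<L , eq′ = p , p<L , trans eq′ eq

  -- The last dart of the face is sent to `d` by `next`, which is a `flip` and one `turn`; since
  -- `turn` has order three, undoing it means two more turns. This is the equation by which
  -- `addFace` closes a face.
  previous : ∀ {L d} → HasLen L d → flip (iter next (length5or6 L ∸ 1) d) ≡ turn (turn d)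
  previous {pent} {d} h = turn-injective (trans (period h) (sym (turn³ d)))
  previous {hex}  {d} h = turn-injective (trans (period h) (sym (turn³ d)))

  spin : Fin 3 → D → D
  spin zero             d = d
  spin (suc zero)       d = turn d
  spin (suc (suc zero)) d = turn (turn d)

  spin-vertex : ∀ i d → proj₁ (spin i d) ≡ proj₁ d
  spin-vertex zero             d = refl
  spin-vertex (suc zero)       d = refl
  spin-vertex (suc (suc zero)) d = refl

  spin-covers : ∀ d e → proj₁ d ≡ proj₁ e → ∃[ i ] spin i d ≡ e
  spin-covers (v , zero) (.v , zero) refl = zero , refl
  spin-covers (v , zero) (.v , suc zero) refl = suc zero , refl
  spin-covers (v , zero) (.v , suc (suc zero)) refl = suc (suc zero) , refl
  spin-covers (v , suc zero) (.v , zero) refl = suc (suc zero) , refl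
  spin-covers (v , suc zero) (.v , suc zero) refl = zero , refl
  spin-covers (v , suc zero) (.v , suc (suc zero)) refl = suc zero , refl
  spin-covers (v , suc (suc zero)) (.v , zero) refl = suc zero , refl
  spin-covers (v , suc (suc zero)) (.v , suc zero) refl = suc (suc zero) , refl
  spin-covers (v , suc (suc zero)) (.v , suc (suc zero)) refl = zero , refl

  spin-injective : ∀ i j d → spin i d ≡ spin j d → i ≡ j
  spin-injective zero zero d p = refl
  spin-injective zero (suc zero) d p = ⊥-elim (turn≢ d (sym p))
  spin-injective zero (suc (suc zero)) d p = ⊥-elim (turn≢ d (trans (cong turn p) (turn³ d)))
  spin-injective (suc zero) zero d p = ⊥-elim (turn≢ d p)
  spin-injective (suc zero) (suc zero) d p = refl
  spin-injective (suc zero) (suc (suc zero)) d p = ⊥-elim (turn≢ (turn d) (sym p))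
  spin-injective (suc (suc zero)) zero d p = ⊥-elim (turn≢ d (trans (cong turn (sym p)) (turn³ d)))
  spin-injective (suc (suc zero)) (suc zero) d p = ⊥-elim (turn≢ (turn d) p)
  spin-injective (suc (suc zero)) (suc (suc zero)) d p = refl

-- Partial maps and their exploration

-- A table describes part of a plane cubic graph whose vertices 0, 1, … stand for vertices of G,
-- not necessarily distinct ones.  The slot (v , i) is the i-th dart at v, link is its reverse, and
-- size is the length of the face to which it belongs.
Slot : Set
Slot = ℕ × Fin 3

record Cell : Set where
  constructor cell
  field
    link : Maybe Slot
    size : Maybe Len
open Cell public

data Row : Set where
  row : Cell → Cell → Cell → Row

Table : Set
Table = List Row

blank : Cell
blank = cell nothing nothing

blankRow : Row
blankRow = row blank blank blank

entry : Row → Fin 3 → Cell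
entry (row a b c) zero             = a
entry (row a b c) (suc zero)       = b
entry (row a b c) (suc (suc zero)) = c

lookup : Table → Slot → Cell
lookup []      x           = blank
lookup (r ∷ t) (zero , i)  = entry r i
lookup (r ∷ t) (suc v , i) = lookup t (v , i)

adjust : (Cell → Cell) → Fin 3 → Row → Row
adjust f zero             (row a b c) = row (f a) b c
adjust f (suc zero)       (row a b c) = row a (f b) c
adjust f (suc (suc zero)) (row a b c) = row a b (f c)

modify : (Cell → Cell) → Slot → Table → Table
modify f x           []      = []
modify f (zero , i)  (r ∷ t) = adjust f i r ∷ t
modify f (suc v , i) (r ∷ t) = r ∷ modify f (v , i) t

setLink : Slot → Cell → Cell
setLink y (cell _ s) = cell (just y) s

setSize : Len → Cell → Cell
setSize L (cell y _) = cell y (just L)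

_==F_ : Fin 3 → Fin 3 → Bool
zero           ==F zero           = true
suc zero       ==F suc zero       = true
suc (suc zero) ==F suc (suc zero) = true
_              ==F _              = false

_==_ : Slot → Slot → Bool
(v , i) == (w , j) = (v ≡ᵇ w) ∧ (i ==F j)

_==L_ : Len → Len → Bool
pent ==L pent = true
hex  ==L hex  = true
_    ==L _    = false

rotate : Slot → Slot
rotate (v , i) = v , rot3 i

unrotate : Slot → Slot
unrotate x = rotate (rotate x)

spinS : Fin 3 → Slot → Slot
spinS zero             x = x
spinS (suc zero)       x = rotate x
spinS (suc (suc zero)) x = unrotate x

-- In certificates the slot (v , i) is written 3 v + i.
slot : ℕ → Slot
slot x = x / 3 , third (x % 3)
  where
  third : ℕ → Fin 3
  third 0 = zero
  third 1 = suc zero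
  third _ = suc (suc zero)

-- A path is written as a binary numeral with a leading 1, read from the low end: 1 crosses a link, and 0 turns
-- to the next slot, in loops to the next slot of the face.
bits : ℕ → List Bool
bits w = digits w w
  where
  digits : ℕ → ℕ → List Bool
  digits zero    w = []
  digits (suc k) w = if w ≡ᵇ 1 then [] else not (w % 2 ≡ᵇ 0) ∷ digits k (w / 2)

onLink : Table → Slot → (Slot → Bool) → Bool
onLink t x p with link (lookup t x)
... | just y  = p y
... | nothing = false

hasSize : Table → Len → Slot → Bool
hasSize t L x with size (lookup t x)
... | just K  = L ==L K
... | nothing = false

along : Table → ℕ → Slot → (Slot → Bool) → Bool
along t zero    x p = false
along t (suc k) x p = p x ∨ onLink t x (λ y → along t k (rotate y) p)

onFace : Table → Slot → Slot → Bool
onFace t x y = along t 6 x (_== y)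

steps : Table → ℕ → Slot → (Slot → Bool) → Bool
steps t zero    x p = p x
steps t (suc k) x p = onLink t x (λ y → steps t k (rotate y) p)

join : Slot → Slot → Table → Table
join x y t = modify (setLink y) x (modify (setLink x) y t)

-- Crossing an unlinked slot creates a vertex and calls the slot that leads back `zero`. Since a
-- model assigns a dart, not a vertex, to each index, this naming loses no generality.
follow : Slot → Table → Slot × Table
follow x t with link (lookup t x)
... | just y  = y , t
... | nothing = (length t , zero) , join x (length t , zero) (t ∷ʳ blankRow)

mark : Maybe Len → Slot → Table → Table
mark nothing  x t = t
mark (just L) x t = modify (setSize L) x t

trail : Maybe Len → ℕ → Slot → Table → Slot × Table
trail m zero    x t = x , mark m x t
trail m (suc k) x t with follow x (mark m x t)
... | y , t′ = trail m k (rotate y) t′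

-- Gluing to a slot that already has a link shows instead that two slots stand for the same dart of G.
data Result : Set where
  stuck    : Result
  coincide : Slot → Slot → Table → Result
  grown    : Table → Result

glue : Slot → Slot → Table → Result
glue a b t with link (lookup t a) | link (lookup t b)
... | just a′ | _       = coincide a′ b t
... | nothing | just b′ = coincide b′ a t
... | nothing | nothing = grown (join a b t)

-- One step less than the length leads to the last dart `e` of the face, and its reverse has to be
-- `unrotate x`. If the face was partly present, closing it may equate slots that are different in
-- the table.
addFace : Len → Slot → Table → Result
addFace L x t with trail (just L) (length5or6 L ∸ 1) x t
... | e , t′ = glue e (unrotate x) t′

-- With d the root dart and φ the face traversal, hyp i j (just k) says α φⁱ α d = φᵏ α φʲ d,
-- and hyp i j nothing says φⁱ⁺¹ α d = α φʲ d.
record Hyp : Set where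
  constructor hyp
  field
    left mid : ℕ
    right    : Maybe ℕ

glueAfter : Maybe ℕ → Slot → Slot → Table → Result
glueAfter nothing  e z t = glue e (unrotate z) t
glueAfter (just k) e z t with trail nothing k z t
... | b , t′ = glue e b t′

applyHyp : Hyp → Table → Result
applyHyp (hyp i j k) t with link (lookup t (0 , zero))
... | nothing = stuck
... | just y with trail nothing i y t
... | e , t₁ with trail nothing j (0 , zero) t₁
... | c , t₂ with link (lookup t₂ c)
... | nothing = stuck
... | just z  = glueAfter k e z t₂

suppose : Maybe Hyp → Table → Result
suppose nothing  t = stuck
suppose (just h) t = applyHyp h t

-- Whether edgeUnique and apartFaces below may be used, and tables that describe no part of G.
record Facts : Set where
  constructor facts
  field
    edgeUnique apartFaces : Bool
    dead                  : List Table

module Clash (F : Facts) (t : Table) where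
  open Facts F

  anyRotation : (Slot → Bool) → Slot → Bool
  anyRotation p x = p x ∨ (p (rotate x) ∨ p (unrotate x))

  sameVertex : Slot → Slot → Bool
  sameVertex (v , _) (w , _) = v ≡ᵇ w

  splitVertex sizeClash loopClash multiClash faceClash edgeClash apartClash clash₀ : Slot → Slot → Bool
  splitVertex (v , i) (w , j) = (v ≡ᵇ w) ∧ not (i ==F j)

  sizeClash a b with size (lookup t a) | size (lookup t b)
  ... | just L | just K = not (L ==L K)
  ... | _      | _      = false

  loopClash a b = anyRotation (λ x → onLink t x (sameVertex b)) a

  meet twoLinks : Slot → Slot → Bool
  meet x y = onLink t x (λ x′ → onLink t y (sameVertex x′))
  twoLinks x y = meet x (rotate y) ∨ meet x (unrotate y)

  multiClash a b = twoLinks a b ∨ (twoLinks (rotate a) (rotate b) ∨ twoLinks (unrotate a) (unrotate b))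

  faceClash a b with size (lookup t a)
  ... | just L  = steps t 1 a (λ a′ → along t (length5or6 L ∸ 1) a′ (_== b))
  ... | nothing = false

  edgeClash a b with size (lookup t a)
  ... | just L  = edgeUnique ∧ onLink t b (λ b′ → steps t 1 a (λ a′ → along t (length5or6 L ∸ 1) a′ (λ x →
                    onLink t x (λ y → onFace t y b′))))
  ... | nothing = false

  reach from : Slot → Slot → Bool
  reach b y = onLink t y (λ z → along t 6 z (sameVertex b))
  from b a = along t 6 a (λ c → onLink t c (λ x → steps t 2 x (reach b) ∨ steps t 3 x (reach b)))

  apartClash a b = apartFaces ∧ anyRotation (from b) a

  clash₀ a b = splitVertex a b ∨ (sizeClash a b ∨ (loopClash a b ∨ (multiClash a b ∨
    (faceClash a b ∨ (edgeClash a b ∨ apartClash a b)))))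

  clash : List Bool → Slot → Slot → Bool
  clash []          a b = clash₀ a b
  clash (false ∷ w) a b = clash w (rotate a) (rotate b)
  clash (true ∷ w)  a b = onLink t a (λ a′ → onLink t b (λ b′ → clash w a′ b′))

-- `f u` is the slot of `t` that receives slot `zero` of vertex `u` of the pattern; the rotation
-- determines its other two slots. Injectivity is not checked, because a pattern also describes its
-- degenerate images.
module Embedding (t : Table) (f : ℕ → Slot) (N : ℕ) where
  linkOK : Slot → Maybe Slot → Bool
  linkOK x nothing        = true
  linkOK x (just (w , j)) = (w <ᵇ N) ∧ onLink t x (_== spinS j (f w))

  sizeOK : Slot → Maybe Len → Bool
  sizeOK x nothing  = true
  sizeOK x (just L) = hasSize t L x

  cellOK : Slot → Cell → Bool
  cellOK x (cell l s) = linkOK x l ∧ sizeOK x s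

  rowsOK : ℕ → Table → Bool
  rowsOK u []                = true
  rowsOK u (row a b c ∷ T) = cellOK (f u) a ∧ (cellOK (rotate (f u)) b ∧ (cellOK (unrotate (f u)) c ∧ rowsOK (suc u) T))

nth : List ℕ → ℕ → Slot
nth []       u       = slot 0
nth (x ∷ xs) zero    = slot x
nth (x ∷ xs) (suc u) = nth xs u

embeds : Table → Table → List ℕ → Bool
embeds t T xs = Embedding.rowsOK t (nth xs) (length T) 0 T

anyDead : Table → List Table → List ℕ → Bool
anyDead t []       xs = false
anyDead t (T ∷ Ts) xs = embeds t T xs ∨ anyDead t Ts xs

-- split x c c′ distinguishes the two lengths of the face at x; apart w refutes a coincidence by following
-- the path w from both slots to a visible contradiction; contra x does so for x and itself; assume glues
-- according to the hypothesis; tube embeds an impossible table.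
data Cert (A : Set) : Set where
  split  : ℕ → Cert A → Cert A → Cert A
  apart  : ℕ → Cert A
  contra : ℕ → Cert A
  assume : Cert A → Cert A
  tube   : List ℕ → Cert A
  leaf   : A → Cert A
  none   : Cert A

-- A length recorded at one slot holds for the whole face, so a mark is sought along the face until
-- a link is missing; six steps go round any face.
scanSize : ℕ → Table → Slot → Maybe Len
scanSize zero    t x = nothing
scanSize (suc k) t x with size (lookup t x) | link (lookup t x)
... | just L  | _       = just L
... | nothing | just y  = scanSize k t (rotate y)
... | nothing | nothing = nothing

separates : ∀ {A} → Cert A → (ℕ → Bool) → Bool
separates (apart w) p = p w
separates _         p = false

branch : Bool → Maybe Len → Bool → Bool → Bool
branch false _           _ _ = false
branch true  (just pent) p q = p
branch true  (just hex)  p q = q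
branch true  nothing     p q = p ∧ q

module Check {A : Set} (F : Facts) (h : Maybe Hyp) (leafOK : A → Table → Bool) where
  open Facts F

  check : Cert A → Result → Bool
  run   : Cert A → Table → Bool

  check c stuck            = false
  check c (grown t)        = run c t
  -- The second alternative is a face that was already closed: both slots are then literally the
  -- same, and the exploration goes on.
  check c (coincide a b t) = separates c (λ w → Clash.clash F t (bits w) a b) ∨ ((a == b) ∧ run c t)

  run (split n c d) t = branch (proj₁ (slot n) <ᵇ length t) (scanSize 6 t (slot n))
                          (check c (addFace pent (slot n) t)) (check d (addFace hex (slot n) t))
  run (contra n) t = Clash.clash₀ F t (slot n) (slot n)
  run (assume c) t = check c (suppose h t)
  run (tube xs)  t = anyDead t dead xs
  run (leaf a)   t = leafOK a t
  run (apart w)  t = false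
  run none       t = false

attach : List (Maybe Len) → Slot → Table → Table
attach []       x t = t
attach (m ∷ ms) x t with follow x t
... | y , t′ = attach ms (rotate y) (mark m y t′)

-- A face of length L together with the start of the faces across its first edges, of the given lengths.
path : Len → List (Maybe Len) → Table
path L ms = attach ms (0 , zero) (mark (just L) (0 , zero) (blankRow ∷ []))

-- The faces at xs have known lengths, so that only one of the two branches is ever taken.
patch : ∀ {A} → List ℕ → ℕ → Cert A
patch xs w = foldr (λ x c → split x c c) (assume (apart w)) xs

-- The hypothesis closes a dual path of hexagons around the tube, and the listed slots complete
-- hexagons until the root vertex sees no other face, as `hexRoot` tests. The result is only a
-- candidate pattern that `Tube` refutes, so coincidences met while building it may be dropped.
tubeTable : List (Maybe Len) → Hyp → List ℕ → Table
tubeTable ms h = foldl (λ t x → table (addFace hex (slot x) t)) (table (applyHyp h (table (addFace hex (0 , zero) (path hex ms)))))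
  where
  table : Result → Table
  table stuck            = []
  table (coincide _ _ t) = t
  table (grown t)        = t

-- Soundness of the exploration

both : ∀ {x y} → x ∧ y ≡ true → x ≡ true × y ≡ true
both {true} {true} _ = refl , refl

either : ∀ {x y} → x ∨ y ≡ true → x ≡ true ⊎ y ≡ true
either {true}  _ = inj₁ refl
either {false} e = inj₂ e

not-true : ∀ {x} → not x ≡ true → x ≢ true
not-true {false} _ ()

≡ᵇ-sound : ∀ {m n} → (m ≡ᵇ n) ≡ true → m ≡ n
≡ᵇ-sound {m} {n} e = ≡ᵇ⇒≡ m n (Equivalence.from T-≡ e)

≡ᵇ-refl : ∀ m → (m ≡ᵇ m) ≡ true
≡ᵇ-refl m = Equivalence.to T-≡ (≡⇒≡ᵇ m m refl)

<ᵇ-sound : ∀ {m n} → (m <ᵇ n) ≡ true → m < n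
<ᵇ-sound {m} {n} e = <ᵇ⇒< m n (Equivalence.from T-≡ e)

==F-sound : ∀ i j → (i ==F j) ≡ true → i ≡ j
==F-sound zero zero _ = refl
==F-sound (suc zero) (suc zero) _ = refl
==F-sound (suc (suc zero)) (suc (suc zero)) _ = refl
==F-sound zero (suc j) ()
==F-sound (suc zero) zero ()
==F-sound (suc zero) (suc (suc zero)) ()
==F-sound (suc (suc zero)) zero ()
==F-sound (suc (suc zero)) (suc zero) ()

==F-refl : ∀ i → (i ==F i) ≡ true
==F-refl zero             = refl
==F-refl (suc zero)       = refl
==F-refl (suc (suc zero)) = refl

==-sound : ∀ x y → (x == y) ≡ true → x ≡ y
==-sound (v , i) (w , j) e with both e
... | p , q = cong₂ _,_ (≡ᵇ-sound p) (==F-sound i j q)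

==L-sound : ∀ L K → (L ==L K) ≡ true → L ≡ K
==L-sound pent pent _ = refl
==L-sound hex hex _ = refl
==L-sound pent hex ()
==L-sound hex pent ()

==L-refl : ∀ L → (L ==L L) ≡ true
==L-refl pent = refl
==L-refl hex  = refl

onLink-sound : ∀ t x {p} → onLink t x p ≡ true → ∃[ y ] link (lookup t x) ≡ just y × p y ≡ true
onLink-sound t x e with link (lookup t x)
... | just y = y , refl , e

hasSize-sound : ∀ t L x → hasSize t L x ≡ true → size (lookup t x) ≡ just L
hasSize-sound t L x e with size (lookup t x)
... | just K = cong just (sym (==L-sound L K e))

lookup-∷ʳ : ∀ t x → lookup (t ∷ʳ blankRow) x ≡ lookup t x
lookup-∷ʳ []      (zero , zero)             = refl
lookup-∷ʳ []      (zero , suc zero)         = refl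
lookup-∷ʳ []      (zero , suc (suc zero))   = refl
lookup-∷ʳ []      (suc v , i)               = refl
lookup-∷ʳ (r ∷ t) (zero , i)                = refl
lookup-∷ʳ (r ∷ t) (suc v , i)               = lookup-∷ʳ t (v , i)

length-∷ʳ : ∀ (t : Table) r → length (t ∷ʳ r) ≡ suc (length t)
length-∷ʳ []      r = refl
length-∷ʳ (_ ∷ t) r = cong suc (length-∷ʳ t r)

length-modify : ∀ f x t → length (modify f x t) ≡ length t
length-modify f x           []      = refl
length-modify f (zero , i)  (r ∷ t) = refl
length-modify f (suc v , i) (r ∷ t) = cong suc (length-modify f (v , i) t)

lookup-modify : ∀ f x t z → lookup (modify f x t) z ≡ lookup t z ⊎ (z ≡ x × lookup (modify f x t) z ≡ f (lookup t z))
lookup-modify f x [] z = inj₁ refl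
lookup-modify f (zero , i) (r ∷ t) (suc w , j) = inj₁ refl
lookup-modify f (suc v , i) (r ∷ t) (zero , j) = inj₁ refl
lookup-modify f (suc v , i) (r ∷ t) (suc w , j) with lookup-modify f (v , i) t (w , j)
... | inj₁ e          = inj₁ e
... | inj₂ (refl , e) = inj₂ (refl , e)
lookup-modify f (zero , zero) (row a b c ∷ t) (zero , zero) = inj₂ (refl , refl)
lookup-modify f (zero , zero) (row a b c ∷ t) (zero , suc zero) = inj₁ refl
lookup-modify f (zero , zero) (row a b c ∷ t) (zero , suc (suc zero)) = inj₁ refl
lookup-modify f (zero , suc zero) (row a b c ∷ t) (zero , zero) = inj₁ refl
lookup-modify f (zero , suc zero) (row a b c ∷ t) (zero , suc zero) = inj₂ (refl , refl)
lookup-modify f (zero , suc zero) (row a b c ∷ t) (zero , suc (suc zero)) = inj₁ refl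
lookup-modify f (zero , suc (suc zero)) (row a b c ∷ t) (zero , zero) = inj₁ refl
lookup-modify f (zero , suc (suc zero)) (row a b c ∷ t) (zero , suc zero) = inj₁ refl
lookup-modify f (zero , suc (suc zero)) (row a b c ∷ t) (zero , suc (suc zero)) = inj₂ (refl , refl)

link-setLink : ∀ y x t z {w} → link (lookup (modify (setLink y) x t) z) ≡ just w →
  link (lookup t z) ≡ just w ⊎ (z ≡ x × w ≡ y)
link-setLink y x t z e with lookup-modify (setLink y) x t z
... | inj₁ p       = inj₁ (trans (cong link (sym p)) e)
... | inj₂ (q , p) = inj₂ (q , just-injective (trans (sym e) (cong link p)))

size-setLink : ∀ y x t z → size (lookup (modify (setLink y) x t) z) ≡ size (lookup t z)
size-setLink y x t z with lookup-modify (setLink y) x t z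
... | inj₁ p       = cong size p
... | inj₂ (q , p) = cong size p

link-setSize : ∀ L x t z → link (lookup (modify (setSize L) x t) z) ≡ link (lookup t z)
link-setSize L x t z with lookup-modify (setSize L) x t z
... | inj₁ p       = cong link p
... | inj₂ (q , p) = cong link p

size-setSize : ∀ L x t z {K} → size (lookup (modify (setSize L) x t) z) ≡ just K →
  size (lookup t z) ≡ just K ⊎ (z ≡ x × K ≡ L)
size-setSize L x t z e with lookup-modify (setSize L) x t z
... | inj₁ p       = inj₁ (trans (cong size (sym p)) e)
... | inj₂ (q , p) = inj₂ (q , just-injective (trans (sym e) (cong size p)))

inhabited⇒< : ∀ t x → lookup t x ≡ blank ⊎ proj₁ x < length t
inhabited⇒< []      x           = inj₁ refl
inhabited⇒< (r ∷ t) (zero , i)  = inj₂ z<s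
inhabited⇒< (r ∷ t) (suc v , i) with inhabited⇒< t (v , i)
... | inj₁ e = inj₁ e
... | inj₂ l = inj₂ (s<s l)

link⇒< : ∀ t x {y} → link (lookup t x) ≡ just y → proj₁ x < length t
link⇒< t x e with inhabited⇒< t x
... | inj₂ l = l
... | inj₁ b with trans (sym (cong link b)) e
... | ()

size⇒< : ∀ t x {L} → size (lookup t x) ≡ just L → proj₁ x < length t
size⇒< t x e with inhabited⇒< t x
... | inj₂ l = l
... | inj₁ b with trans (sym (cong size b)) e
... | ()

module Models (G : PlaneCubicGraph) where
  open PlaneCubicGraph G using (face)
  open Darts G

  at : (ℕ → D) → Slot → D
  at β (v , i) = spin i (β v)

  at-rotate : ∀ β x → at β (rotate x) ≡ turn (at β x)
  at-rotate β (v , zero)           = refl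
  at-rotate β (v , suc zero)       = refl
  at-rotate β (v , suc (suc zero)) = sym (turn³ (β v))

  at-unrotate : ∀ β x → at β (unrotate x) ≡ turn (turn (at β x))
  at-unrotate β x = trans (at-rotate β (rotate x)) (cong turn (at-rotate β x))

  at-spin : ∀ β i x → at β (spinS i x) ≡ spin i (at β x)
  at-spin β zero             x = refl
  at-spin β (suc zero)       x = at-rotate β x
  at-spin β (suc (suc zero)) x = at-unrotate β x

  -- `β v` is the dart at slot `(v , zero)`, and the other slots of `v` follow by rotation. Nothing
  -- forces `β` to be injective. `bound` keeps links away from vertices yet to be created, whose
  -- darts `extend` still has to choose.
  record _⊨_ (β : ℕ → D) (t : Table) : Set where
    field
      links : ∀ x {y} → link (lookup t x) ≡ just y → flip (at β x) ≡ at β y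
      sizes : ∀ x {L} → size (lookup t x) ≡ just L → HasLen L (at β x)
      bound : ∀ x {y} → link (lookup t x) ≡ just y → proj₁ y < length t
  open _⊨_ public

  links-next : ∀ {β t} → β ⊨ t → ∀ x {y} → link (lookup t x) ≡ just y → at β (rotate y) ≡ next (at β x)
  links-next {β} m x {y} e = trans (at-rotate β y) (cong turn (sym (links m x e)))

  join-sound : ∀ {β t} x y → β ⊨ t → proj₁ x < length t → proj₁ y < length t →
    flip (at β x) ≡ at β y → β ⊨ join x y t
  join-sound {β} {t} x y m x< y< e = record { links = links′ ; sizes = sizes′ ; bound = bound′ }
    where
    t₁ = modify (setLink x) y t
    cases : ∀ z {w} → link (lookup (join x y t) z) ≡ just w →
      link (lookup t z) ≡ just w ⊎ ((z ≡ y × w ≡ x) ⊎ (z ≡ x × w ≡ y))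
    cases z p with link-setLink y x t₁ z p
    ... | inj₂ q = inj₂ (inj₂ q)
    ... | inj₁ q with link-setLink x y t z q
    ... | inj₁ r = inj₁ r
    ... | inj₂ r = inj₂ (inj₁ r)
    len : length (join x y t) ≡ length t
    len = trans (length-modify (setLink y) x t₁) (length-modify (setLink x) y t)
    links′ : ∀ z {w} → link (lookup (join x y t) z) ≡ just w → flip (at β z) ≡ at β w
    links′ z p with cases z p
    ... | inj₁ q                    = links m z q
    ... | inj₂ (inj₁ (refl , refl)) = trans (cong flip (sym e)) (flip² _)
    ... | inj₂ (inj₂ (refl , refl)) = e
    sizes′ : ∀ z {L} → size (lookup (join x y t) z) ≡ just L → HasLen L (at β z)
    sizes′ z p = sizes m z (trans (sym (trans (size-setLink y x t₁ z) (size-setLink x y t z))) p)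
    bound′ : ∀ z {w} → link (lookup (join x y t) z) ≡ just w → proj₁ w < length (join x y t)
    bound′ z p with cases z p
    ... | inj₁ q                    = subst (_ <_) (sym len) (bound m z q)
    ... | inj₂ (inj₁ (refl , refl)) = subst (_ <_) (sym len) x<
    ... | inj₂ (inj₂ (refl , refl)) = subst (_ <_) (sym len) y<

  record Grows (t : Table) (β : ℕ → D) (t′ : Table) : Set where
    constructor grows
    field
      β′     : ℕ → D
      models : β′ ⊨ t′
      agree  : ∀ {v} → v < length t → β′ v ≡ β v
      longer : length t ≤ length t′

  agree-at : ∀ {t β t′} (g : Grows t β t′) x → proj₁ x < length t → at (Grows.β′ g) x ≡ at β x
  agree-at g (v , i) l = cong (spin i) (Grows.agree g l)

  grows-trans : ∀ {t β t′ t″} (g : Grows t β t′) → Grows t′ (Grows.β′ g) t″ → Grows t β t″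
  grows-trans (grows β′ m a l) (grows β″ m′ a′ l′) =
    grows β″ m′ (λ p → trans (a′ (<-≤-trans p l)) (a p)) (≤-trans l l′)

  mark-sound : ∀ {β t} m x → β ⊨ t → (∀ {L} → m ≡ just L → HasLen L (at β x)) → β ⊨ mark m x t
  mark-sound nothing  x M h = M
  mark-sound {β} {t} (just L) x M h = record
    { links = λ z p → links M z (trans (sym (link-setSize L x t z)) p)
    ; sizes = sizes′
    ; bound = λ z p → subst (_ <_) (sym (length-modify (setSize L) x t)) (bound M z (trans (sym (link-setSize L x t z)) p))
    }
    where
    sizes′ : ∀ z {K} → size (lookup (modify (setSize L) x t) z) ≡ just K → HasLen K (at β z)
    sizes′ z p with size-setSize L x t z p
    ... | inj₁ q             = sizes M z q
    ... | inj₂ (refl , refl) = h refl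

  length-mark : ∀ m x t → length (mark m x t) ≡ length t
  length-mark nothing  x t = refl
  length-mark (just L) x t = length-modify (setSize L) x t

  extend : (ℕ → D) → ℕ → D → ℕ → D
  extend β k d v = if v ≡ᵇ k then d else β v

  extend-new : ∀ β k d → extend β k d k ≡ d
  extend-new β k d rewrite ≡ᵇ-refl k = refl

  extend-old : ∀ β k d {v} → v < k → extend β k d v ≡ β v
  extend-old β k d {v} l with v ≡ᵇ k in e
  ... | false = refl
  ... | true  = ⊥-elim (<⇒≢ l (≡ᵇ-sound e))

  follow-sound : ∀ x {t β} → β ⊨ t → proj₁ x < length t →
    Σ (Grows t β (proj₂ (follow x t))) λ g →
      proj₁ (proj₁ (follow x t)) < length (proj₂ (follow x t)) ×
      at (Grows.β′ g) (proj₁ (follow x t)) ≡ flip (at β x)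
  follow-sound x {t} {β} m x< with link (lookup t x) in e
  ... | just y  = grows β m (λ _ → refl) ≤-refl , bound m x e , sym (links m x e)
  ... | nothing = grows β₁ joined (extend-old β k d) (≤-trans (n≤1+n k) (≤-reflexive (sym len))) ,
                  ≤-reflexive (sym len) , extend-new β k d
    where
    k  = length t
    d  = flip (at β x)
    β₁ = extend β k d
    t₁ = t ∷ʳ blankRow
    old : ∀ z → proj₁ z < k → at β₁ z ≡ at β z
    old (v , i) l = cong (spin i) (extend-old β k d l)
    len₁ : length t₁ ≡ suc k
    len₁ = length-∷ʳ t blankRow
    len : length (join x (k , zero) t₁) ≡ suc k
    len = trans (length-modify (setLink (k , zero)) x (modify (setLink x) (k , zero) t₁))
         (trans (length-modify (setLink x) (k , zero) t₁) len₁)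
    models₁ : β₁ ⊨ t₁
    models₁ = record
      { links = λ z p → let q = trans (cong link (sym (lookup-∷ʳ t z))) p in
                  trans (cong flip (old z (link⇒< t z q))) (trans (links m z q) (sym (old _ (bound m z q))))
      ; sizes = λ z p → let q = trans (cong size (sym (lookup-∷ʳ t z))) p in
                  subst (HasLen _) (sym (old z (size⇒< t z q))) (sizes m z q)
      ; bound = λ z p → let q = trans (cong link (sym (lookup-∷ʳ t z))) p in
                  subst (_ <_) (sym len₁) (m<n⇒m<1+n (bound m z q))
      }
    joined : β₁ ⊨ join x (k , zero) t₁
    joined = join-sound x (k , zero) models₁ (subst (_ <_) (sym len₁) (m<n⇒m<1+n x<)) (≤-reflexive (sym len₁))
      (trans (cong flip (old x x<)) (sym (extend-new β k d)))

  trail-sound : ∀ m k x {t β} → β ⊨ t → proj₁ x < length t → (∀ {L} → m ≡ just L → HasLen L (at β x)) →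
    Σ (Grows t β (proj₂ (trail m k x t))) λ g →
      proj₁ (proj₁ (trail m k x t)) < length (proj₂ (trail m k x t)) ×
      at (Grows.β′ g) (proj₁ (trail m k x t)) ≡ iter next k (at β x)
  trail-sound m zero x {t} {β} M x< h =
    grows β (mark-sound m x M h) (λ _ → refl) (≤-reflexive (sym (length-mark m x t))) ,
    subst (_ <_) (sym (length-mark m x t)) x< , refl
  trail-sound m (suc k) x {t} {β} M x< h with follow x (mark m x t)
       | follow-sound x (mark-sound m x M h) (subst (proj₁ x <_) (sym (length-mark m x t)) x<)
  ... | y , t′ | g , y< , y≡ with trail-sound m k (rotate y) (Grows.models g) y< h′
    where
    turned : at (Grows.β′ g) (rotate y) ≡ next (at β x)
    turned = trans (at-rotate (Grows.β′ g) y) (cong turn y≡)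
    h′ : ∀ {L} → m ≡ just L → HasLen L (at (Grows.β′ g) (rotate y))
    h′ e = subst (HasLen _) (sym turned) (HasLen-face (sym (face-next _)) (h e))
  ... | g′ , z< , z≡ =
    grows-trans (grows β (mark-sound m x M h) (λ _ → refl) (≤-reflexive (sym (length-mark m x t)))) (grows-trans g g′) ,
    z< , trans z≡ (trans (cong (iter next k) (trans (at-rotate (Grows.β′ g) y) (cong turn y≡))) (sym (iter-suc next k _)))

  -- A `stuck` result promises nothing, which is harmless because `check` rejects it.
  Holds : Result → (ℕ → D) → Set
  Holds stuck            β = ⊤
  Holds (coincide a b t) β = β ⊨ t × at β a ≡ at β b
  Holds (grown t)        β = β ⊨ t

  glue-sound : ∀ a b {t β} → β ⊨ t → proj₁ a < length t → proj₁ b < length t →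
    flip (at β a) ≡ at β b → Holds (glue a b t) β
  glue-sound a b {t} m a< b< e with link (lookup t a) in p | link (lookup t b) in q
  ... | just a′ | _       = m , trans (sym (links m a p)) e
  ... | nothing | just b′ = m , trans (sym (links m b q)) (trans (cong flip (sym e)) (flip² _))
  ... | nothing | nothing = join-sound a b m a< b< e

  -- The image of vertex 0 is kept fixed through all extensions: hypotheses, boundary conditions and
  -- goals refer to this dart.
  Reaches : Result → D → Set
  Reaches r d = ∃[ β ] Holds r β × β 0 ≡ d

  private
    nonempty : ∀ {k m} → k < m → 0 < m
    nonempty (s≤s _) = z<s

  addFace-sound : ∀ L x {t β} → β ⊨ t → proj₁ x < length t → HasLen L (at β x) → Reaches (addFace L x t) (β 0)
  addFace-sound L x {t} {β} m x< h with trail (just L) (length5or6 L ∸ 1) x t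
       | trail-sound (just L) (length5or6 L ∸ 1) x m x< (λ { refl → h })
  ... | e , t′ | g , e< , e≡ = Grows.β′ g ,
      glue-sound e (unrotate x) (Grows.models g) e< (<-≤-trans x< (Grows.longer g))
        (trans (cong flip e≡) (trans (previous h) (sym (trans (at-unrotate (Grows.β′ g) x) (cong (λ d → turn (turn d)) (agree-at g x x<)))))) ,
      Grows.agree g (nonempty x<)

  Supposed : Hyp → D → Set
  Supposed (hyp i j nothing)  d = flip (iter next i (flip d)) ≡ turn (turn (flip (iter next j d)))
  Supposed (hyp i j (just k)) d = flip (iter next i (flip d)) ≡ iter next k (flip (iter next j d))

  applyHyp-sound : ∀ h {t β} → β ⊨ t → Supposed h (β 0) → Reaches (applyHyp h t) (β 0)
  applyHyp-sound (hyp i j k) {t} {β} m s with link (lookup t (0 , zero)) in e₀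
  ... | nothing = β , tt , refl
  ... | just y with trail nothing i y t | trail-sound nothing i y m (bound m (0 , zero) e₀) (λ ())
  ... | e , t₁ | g₁ , e< , e≡ with trail nothing j (0 , zero) t₁
        | trail-sound nothing j (0 , zero) (Grows.models g₁) (<-≤-trans (link⇒< t (0 , zero) e₀) (Grows.longer g₁)) (λ ())
  ... | c , t₂ | g₂ , c< , c≡ with link (lookup t₂ c) in e₂
  ... | nothing = β , tt , refl
  ... | just z = finish k s
    where
    root : 0 < length t
    root = link⇒< t (0 , zero) e₀
    g₁₂ = grows-trans g₁ g₂
    β₂ = Grows.β′ g₂
    left : at β₂ e ≡ iter next i (flip (β 0))
    left = trans (agree-at g₂ e e<) (trans e≡ (cong (iter next i) (sym (links m (0 , zero) e₀))))
    mid : at β₂ z ≡ flip (iter next j (β 0))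
    mid = trans (sym (links (Grows.models g₂) c e₂)) (cong flip (trans c≡ (cong (iter next j) (Grows.agree g₁ root))))
    e<₂ = <-≤-trans e< (Grows.longer g₂)
    z<₂ = bound (Grows.models g₂) c e₂
    finish : ∀ k → Supposed (hyp i j k) (β 0) → Reaches (glueAfter k e z t₂) (β 0)
    finish nothing s = β₂ , glue-sound e (unrotate z) (Grows.models g₂) e<₂ z<₂
      (trans (cong flip left) (trans s (sym (trans (at-unrotate β₂ z) (cong (λ d → turn (turn d)) mid))))) ,
      Grows.agree g₁₂ root
    finish (just k) s with trail nothing k z t₂ | trail-sound nothing k z (Grows.models g₂) z<₂ (λ ())
    ... | b , t₃ | g₃ , b< , b≡ = Grows.β′ g₃ ,
      glue-sound e b (Grows.models g₃) (<-≤-trans e<₂ (Grows.longer g₃)) b<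
        (trans (cong flip (trans (agree-at g₃ e e<₂) left)) (trans s (sym (trans b≡ (cong (iter next k) mid))))) ,
      Grows.agree (grows-trans g₁₂ g₃) root

module Reading (G : PlaneCubicGraph) where
  open PlaneCubicGraph G using (face)
  open Darts G
  open Models G

  module _ {t : Table} {β : ℕ → D} (m : β ⊨ t) where

    abstract
      along-sound : ∀ k x {p} → along t k x p ≡ true →
        ∃[ j ] ∃[ y ] j < k × at β y ≡ iter next j (at β x) × p y ≡ true
      along-sound (suc k) x e with either e
      ... | inj₁ q = 0 , x , z<s , refl , q
      ... | inj₂ q with onLink-sound t x q
      ... | y , l , r with along-sound k (rotate y) r
      ... | j , z , j<k , z≡ , pz = suc j , z , s<s j<k ,
        trans z≡ (trans (cong (iter next j) (links-next m x l)) (sym (iter-suc next j _))) , pz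

      steps-sound : ∀ k x {p} → steps t k x p ≡ true → ∃[ y ] at β y ≡ iter next k (at β x) × p y ≡ true
      steps-sound zero    x e = x , refl , e
      steps-sound (suc k) x e with onLink-sound t x e
      ... | y , l , q with steps-sound k (rotate y) q
      ... | z , z≡ , pz = z , trans z≡ (trans (cong (iter next k) (links-next m x l)) (sym (iter-suc next k _))) , pz

      along-face : ∀ k x {p} → along t k x p ≡ true → ∃[ y ] face (at β y) ≡ face (at β x) × p y ≡ true
      along-face k x e with along-sound k x e
      ... | j , y , _ , y≡ , q = y , trans (cong face y≡) (face-iter j _) , q

      onFace-sound : ∀ x y → onFace t x y ≡ true → face (at β y) ≡ face (at β x)
      onFace-sound x y e with along-face 6 x e
      ... | z , z≡ , q with ==-sound z y q
      ... | refl = z≡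

      size-sound : ∀ L x → hasSize t L x ≡ true → HasLen L (at β x)
      size-sound L x e = sizes m x (hasSize-sound t L x e)

      at-vertex : ∀ {v i w j} → (v ≡ᵇ w) ≡ true → proj₁ (at β (v , i)) ≡ proj₁ (at β (w , j))
      at-vertex {v} {i} {w} {j} e with ≡ᵇ-sound {v} {w} e
      ... | refl = trans (spin-vertex i _) (sym (spin-vertex j _))

  EdgeUnique : Set
  EdgeUnique = ∀ x y → face x ≡ face y → face (flip x) ≡ face (flip y) → x ≡ y

  -- The darts `d` and `e` leave a common vertex, so this says that the two faces are
  -- vertex-disjoint. On a pentagon or a hexagon, two and three steps cover all pairs of nonadjacent
  -- edges, up to their order.
  ApartFaces : Set
  ApartFaces = ∀ x j → j ≡ 2 ⊎ j ≡ 3 → ∀ d e → proj₁ d ≡ proj₁ e →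
    face d ≡ face (flip x) → face e ≡ face (flip (iter next j x)) → ⊥

  record FactsHold (F : Facts) : Set where
    field
      edgeHolds  : Facts.edgeUnique F ≡ true → EdgeUnique
      apartHolds : Facts.apartFaces F ≡ true → ApartFaces
      deadHolds  : All (λ T → ∀ β → ¬ β ⊨ T) (Facts.dead F)

  module Clashes (F : Facts) (known : FactsHold F) {t : Table} {β : ℕ → D} (m : β ⊨ t) where
    open Facts F
    open Clash F t

    sameVertex-sound : ∀ x y → sameVertex x y ≡ true → proj₁ (at β x) ≡ proj₁ (at β y)
    sameVertex-sound (v , i) (w , j) e = at-vertex m {v} {i} {w} {j} e

    splitVertex-sound : ∀ a b → splitVertex a b ≡ true → at β a ≢ at β b
    splitVertex-sound (v , i) (w , j) e eq with both e
    ... | p , q with ≡ᵇ-sound {v} {w} p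
    ... | refl with spin-injective i j (β v) eq
    ... | refl = not-true q (==F-refl i)

    sizeClash-sound : ∀ a b → sizeClash a b ≡ true → at β a ≢ at β b
    sizeClash-sound a b e eq with size (lookup t a) in p | size (lookup t b) in q
    ... | just L | just K with HasLen-unique (sizes m a p) (subst (HasLen K) (sym eq) (sizes m b q))
    ... | refl = not-true e (==L-refl L)

    rotation-sound : ∀ {p} x → anyRotation p x ≡ true → ∃[ y ] proj₁ (at β y) ≡ proj₁ (at β x) × p y ≡ true
    rotation-sound x e with either e
    ... | inj₁ q = x , refl , q
    ... | inj₂ q with either q
    ... | inj₁ r = rotate x , cong proj₁ (at-rotate β x) , r
    ... | inj₂ r = unrotate x , cong proj₁ (at-unrotate β x) , r

    loopClash-sound : ∀ a b → loopClash a b ≡ true → at β a ≢ at β b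
    loopClash-sound a b e eq with rotation-sound a e
    ... | x , v , p with onLink-sound t x p
    ... | y , l , q = flip≢ (at β x) (trans (cong proj₁ (links m x l))
      (trans (sym (sameVertex-sound b y q)) (trans (sym (cong proj₁ eq)) (sym v))))

    meet-sound : ∀ x y → meet x y ≡ true → proj₁ (at β x) ≡ proj₁ (at β y) → at β x ≡ at β y
    meet-sound x y e v with onLink-sound t x e
    ... | x′ , l , p with onLink-sound t y p
    ... | y′ , k , q = same-ends _ _ v (trans (cong proj₁ (links m x l))
      (trans (sameVertex-sound x′ y′ q) (sym (cong proj₁ (links m y k)))))

    -- If the darts agreed, `a` and another dart at the vertex of `b` would have both ends in
    -- common. The graph is simple, so they would be one dart, which `turn≢` forbids.
    twoLinks-sound : ∀ a b → twoLinks a b ≡ true → at β a ≢ at β b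
    twoLinks-sound a b e eq with either e
    ... | inj₁ p = turn≢ (at β b) (sym (trans (sym eq)
      (trans (meet-sound a (rotate b) p (trans (cong proj₁ eq) (sym (cong proj₁ (at-rotate β b))))) (at-rotate β b))))
    ... | inj₂ p = turn≢ (at β b) (trans (cong turn (trans (sym eq)
      (trans (meet-sound a (unrotate b) p (trans (cong proj₁ eq) (sym (cong proj₁ (at-unrotate β b))))) (at-unrotate β b))))
      (turn³ (at β b)))

    rotate-cong : ∀ a b → at β a ≡ at β b → at β (rotate a) ≡ at β (rotate b)
    rotate-cong a b eq = trans (at-rotate β a) (trans (cong turn eq) (sym (at-rotate β b)))

    multiClash-sound : ∀ a b → multiClash a b ≡ true → at β a ≢ at β b
    multiClash-sound a b e eq with either e
    ... | inj₁ p = twoLinks-sound a b p eq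
    ... | inj₂ p with either p
    ... | inj₁ q = twoLinks-sound (rotate a) (rotate b) q (rotate-cong a b eq)
    ... | inj₂ q = twoLinks-sound (unrotate a) (unrotate b) q (rotate-cong (rotate a) (rotate b) (rotate-cong a b eq))

    private
      later : ∀ {L p} a → size (lookup t a) ≡ just L →
        steps t 1 a (λ a′ → along t (length5or6 L ∸ 1) a′ p) ≡ true →
        ∃[ x ] at β x ≢ at β a × face (at β x) ≡ face (at β a) × p x ≡ true
      later {L} a s e with steps-sound m 1 a e
      ... | a′ , a′≡ , q with along-sound m (length5or6 L ∸ 1) a′ q
      ... | j , x , j< , x≡ , r = x , (λ eq → minimal (sizes m a s) (suc j) z<s (bounded L j<) (trans (sym after) eq)) ,
        trans (cong face after) (face-iter (suc j) _) , r
        where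
        after : at β x ≡ iter next (suc j) (at β a)
        after = trans x≡ (trans (cong (iter next j) a′≡) (sym (iter-suc next j _)))
        bounded : ∀ L {j} → j < length5or6 L ∸ 1 → suc j < length5or6 L
        bounded pent l = s<s l
        bounded hex  l = s<s l

    faceClash-sound : ∀ a b → faceClash a b ≡ true → at β a ≢ at β b
    faceClash-sound a b e eq with size (lookup t a) in s
    ... | just L with later a s e
    ... | x , x≢ , _ , p with ==-sound x b p
    ... | refl = x≢ (sym eq)

    -- If the darts agreed, the face of `a` would have a second edge, at `x`, with the same face
    -- beyond it as beyond `b`, contrary to `edgeUnique`.
    edgeClash-sound : ∀ a b → edgeClash a b ≡ true → at β a ≢ at β b
    edgeClash-sound a b e eq with size (lookup t a) in s
    ... | just L with both e
    ... | unique , e₁ with onLink-sound t b e₁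
    ... | b′ , lb , e₂ with later a s e₂
    ... | x , x≢ , fx , e₃ with onLink-sound t x e₃
    ... | y , lx , e₄ = x≢ (FactsHold.edgeHolds known unique _ _ fx
      (trans (cong face (links m x lx)) (trans (sym (onFace-sound m y b′ e₄))
        (trans (cong face (sym (links m b lb))) (cong (λ d → face (flip d)) (sym eq))))))

    reach-sound : ∀ b y → reach b y ≡ true →
      ∃[ w ] face (at β w) ≡ face (flip (at β y)) × proj₁ (at β b) ≡ proj₁ (at β w)
    reach-sound b y e with onLink-sound t y e
    ... | z , l , p with along-face m 6 z p
    ... | w , fw , q = w , trans fw (cong face (sym (links m y l))) , sameVertex-sound b w q

    far-sound : ∀ b a x j → j ≡ 2 ⊎ j ≡ 3 → apartFaces ≡ true → proj₁ (at β a) ≡ proj₁ (at β b) →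
      face (at β a) ≡ face (flip (at β x)) → steps t j x (reach b) ≢ true
    far-sound b a x j j∈ known₃ v f p with steps-sound m j x p
    ... | y , y≡ , q with reach-sound b y q
    ... | w , fw , vw = FactsHold.apartHolds known known₃ (at β x) j j∈ (at β a) (at β w)
      (trans v vw) f (trans fw (cong (λ d → face (flip d)) y≡))

    -- The vertex of `a` is on the face across `x`, and that of `b` on the face across an edge two
    -- or three steps after `x` on a third face. Were the vertices equal, these two faces would
    -- meet.
    apartClash-sound : ∀ a b → apartClash a b ≡ true → at β a ≢ at β b
    apartClash-sound a b e eq with both e
    ... | known₃ , e₁ with rotation-sound a e₁
    ... | a₀ , va , e₂ with along-face m 6 a₀ e₂
    ... | c , fc , e₃ with onLink-sound t c e₃
    ... | x , lc , e₄ = rest (either e₄)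
      where
      v : proj₁ (at β a₀) ≡ proj₁ (at β b)
      v = trans va (cong proj₁ eq)
      f : face (at β a₀) ≡ face (flip (at β x))
      f = trans (sym fc) (cong face (trans (sym (flip² _)) (cong flip (links m c lc))))
      rest : _ → ⊥
      rest (inj₁ p) = far-sound b a₀ x 2 (inj₁ refl) known₃ v f p
      rest (inj₂ p) = far-sound b a₀ x 3 (inj₂ refl) known₃ v f p

    clash₀-sound : ∀ a b → clash₀ a b ≡ true → at β a ≢ at β b
    clash₀-sound a b e with either e
    ... | inj₁ p = splitVertex-sound a b p
    ... | inj₂ p with either p
    ... | inj₁ q = sizeClash-sound a b q
    ... | inj₂ q with either q
    ... | inj₁ r = loopClash-sound a b r
    ... | inj₂ r with either r
    ... | inj₁ s = multiClash-sound a b s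
    ... | inj₂ s with either s
    ... | inj₁ u = faceClash-sound a b u
    ... | inj₂ u with either u
    ... | inj₁ v = edgeClash-sound a b v
    ... | inj₂ v = apartClash-sound a b v

    -- Equal darts have equal turns and equal reverses, so a coincidence is carried along any common
    -- path.
    clash-sound : ∀ w a b → clash w a b ≡ true → at β a ≢ at β b
    clash-sound []          a b e eq = clash₀-sound a b e eq
    clash-sound (false ∷ w) a b e eq = clash-sound w (rotate a) (rotate b) e (rotate-cong a b eq)
    clash-sound (true ∷ w)  a b e eq with onLink-sound t a e
    ... | a′ , la , p with onLink-sound t b p
    ... | b′ , lb , q = clash-sound w a′ b′ q (trans (sym (links m a la)) (trans (cong flip eq) (links m b lb)))

  module _ {t : Table} {β : ℕ → D} (m : β ⊨ t) (f : ℕ → Slot) (N : ℕ) where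
    open Embedding t f N

    private
      γ : ℕ → D
      γ u = at β (f u)

      Fits : D → Cell → Set
      Fits d (cell l s) = (∀ {y} → l ≡ just y → flip d ≡ at γ y × proj₁ y < N) × (∀ {L} → s ≡ just L → HasLen L d)

      cellOK-sound : ∀ x c → cellOK x c ≡ true → Fits (at β x) c
      cellOK-sound x (cell l s) e with both e
      ... | p , q = fitLink l p , fitSize s q
        where
        fitLink : ∀ l {y} → linkOK x l ≡ true → l ≡ just y → flip (at β x) ≡ at γ y × proj₁ y < N
        fitLink (just (w , j)) p refl with both p
        ... | w< , r with onLink-sound t x r
        ... | z , lz , z≡ with ==-sound z (spinS j (f w)) z≡
        ... | refl = trans (links m x lz) (at-spin β j (f w)) , <ᵇ-sound w<
        fitSize : ∀ s {L} → sizeOK x s ≡ true → s ≡ just L → HasLen L (at β x)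
        fitSize (just L) q refl = size-sound m L x q

      rowsOK-sound : ∀ u T → rowsOK u T ≡ true → ∀ v i → Fits (at γ (u + v , i)) (lookup T (v , i))
      rowsOK-sound u [] e v i = (λ ()) , (λ ())
      rowsOK-sound u (row a b c ∷ T) e v i with both {cellOK (f u) a} e
      ... | p , e₁ with both {cellOK (rotate (f u)) b} e₁
      ... | q , e₂ with both {cellOK (unrotate (f u)) c} e₂
      rowsOK-sound u (row a b c ∷ T) e (suc v) i | p , e₁ | q , e₂ | r , s =
        subst (λ k → Fits (at γ (k , i)) (lookup T (v , i))) (sym (+-suc u v)) (rowsOK-sound (suc u) T s v i)
      rowsOK-sound u (row a b c ∷ T) e zero i | p , e₁ | q , e₂ | r , s =
        subst (λ k → Fits (at γ (k , i)) (entry (row a b c) i)) (sym (+-identityʳ u)) (fit i)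
        where
        fit : ∀ i → Fits (at γ (u , i)) (entry (row a b c) i)
        fit zero             = cellOK-sound (f u) a p
        fit (suc zero)       = subst (λ d → Fits d b) (at-rotate β (f u)) (cellOK-sound (rotate (f u)) b q)
        fit (suc (suc zero)) = subst (λ d → Fits d c) (at-unrotate β (f u)) (cellOK-sound (unrotate (f u)) c r)

    rows-embed : ∀ T → N ≡ length T → rowsOK 0 T ≡ true → (λ u → at β (f u)) ⊨ T
    rows-embed T refl e = record
      { links = λ { (v , i) p → proj₁ (proj₁ (rowsOK-sound 0 T e v i) p) }
      ; sizes = λ { (v , i) p → proj₂ (rowsOK-sound 0 T e v i) p }
      ; bound = λ { (v , i) p → proj₂ (proj₁ (rowsOK-sound 0 T e v i) p) }
      }

  embeds-sound : ∀ {t β} → β ⊨ t → ∀ T xs → embeds t T xs ≡ true → (λ u → at β (nth xs u)) ⊨ T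
  embeds-sound m T xs = rows-embed m (nth xs) (length T) T refl

  anyDead-sound : ∀ {t β} → β ⊨ t → ∀ Ts xs → All (λ T → ∀ β → ¬ β ⊨ T) Ts → anyDead t Ts xs ≢ true
  anyDead-sound m (T ∷ Ts) xs (dead ∷ deads) e with either e
  ... | inj₁ p = dead _ (embeds-sound m T xs p)
  ... | inj₂ p = anyDead-sound m Ts xs deads p

  scanSize-sound : ∀ {t β} → β ⊨ t → ∀ k x {L} → scanSize k t x ≡ just L → HasLen L (at β x)
  scanSize-sound {t} m (suc k) x e with size (lookup t x) in s | link (lookup t x) in l
  scanSize-sound m (suc k) x refl | just L | _ = sizes m x s
  ... | nothing | just y = HasLen-face (trans (cong face (links-next m x l)) (face-next _)) (scanSize-sound m k (rotate y) e)

module CheckSoundness (G : PlaneCubicGraph) where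
  open PlaneCubicGraph G using (face)
  open Darts G
  open Models G
  open Reading G

  -- The goal is arbitrary, so that one soundness proof serves the refutations of cuts (`⊥`), the
  -- spreading of a tube to the neighbours of a vertex, and the final classification.
  module CheckSound
    (lens : ∀ d → HasLen pent d ⊎ HasLen hex d)
    {A : Set} (F : Facts) (known : FactsHold F) (h : Maybe Hyp) (leafOK : A → Table → Bool)
    (d : D) (Goal : Set)
    (supposed : ∀ H → h ≡ just H → Supposed H d)
    (leaf-sound : ∀ a {t β} → β ⊨ t → β 0 ≡ d → leafOK a t ≡ true → Goal) where
    open Facts F
    open Check F h leafOK

    Outcomes : Maybe Len → Result → Result → Set
    Outcomes (just pent) r r′ = Reaches r d
    Outcomes (just hex)  r r′ = Reaches r′ d
    Outcomes nothing     r r′ = Reaches r d ⊎ Reaches r′ d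

    suppose-sound : ∀ h {t β} → (∀ H → h ≡ just H → Supposed H (β 0)) → β 0 ≡ d → β ⊨ t → Reaches (suppose h t) d
    suppose-sound nothing  {β = β} s root m = β , tt , root
    suppose-sound (just H) s root m = subst (Reaches _) root (applyHyp-sound H m (s H refl))

    separates-sound : ∀ (c : Cert A) {p} → separates c p ≡ true → ∃[ w ] p w ≡ true
    separates-sound (apart w) e = w , e

    outcomes : ∀ x {t β} → β ⊨ t → β 0 ≡ d → ∀ s → (∀ {L} → s ≡ just L → HasLen L (at β x)) →
      (proj₁ x <ᵇ length t) ≡ true → Outcomes s (addFace pent x t) (addFace hex x t)
    outcomes x {t} {β} m root s h x< = byCases s h
      where
      go : ∀ L → HasLen L (at β x) → Reaches (addFace L x t) d
      go L p = subst (Reaches (addFace L x t)) root (addFace-sound L x m (<ᵇ-sound x<) p)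
      byCases : ∀ s → (∀ {L} → s ≡ just L → HasLen L (at β x)) → Outcomes s (addFace pent x t) (addFace hex x t)
      byCases (just pent) h = go pent (h refl)
      byCases (just hex)  h = go hex (h refl)
      byCases nothing     h = Sum.map (go pent) (go hex) (lens (at β x))

    check-sound : ∀ c r → Reaches r d → check c r ≡ true → Goal
    run-sound   : ∀ c {t β} → β ⊨ t → β 0 ≡ d → run c t ≡ true → Goal
    branch-sound : ∀ c c′ b s r r′ → (b ≡ true → Outcomes s r r′) → branch b s (check c r) (check c′ r′) ≡ true → Goal

    check-sound c (grown t) (β , m , root) e = run-sound c m root e
    check-sound c (coincide a b t) (β , (m , a≡b) , root) e with either e
    ... | inj₂ p = run-sound c m root (proj₂ (both p))
    ... | inj₁ p with separates-sound c p
    ... | w , q = ⊥-elim (Clashes.clash-sound F known m (bits w) a b q a≡b)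

    branch-sound c c′ true (just pent) r r′ k e = check-sound c r (k refl) e
    branch-sound c c′ true (just hex)  r r′ k e = check-sound c′ r′ (k refl) e
    branch-sound c c′ true nothing     r r′ k e with k refl
    ... | inj₁ p = check-sound c r p (proj₁ (both e))
    ... | inj₂ p = check-sound c′ r′ p (proj₂ (both e))

    run-sound (split n c c′) {t} m root e =
      branch-sound c c′ (proj₁ (slot n) <ᵇ length t) (scanSize 6 t (slot n)) (addFace pent (slot n) t) (addFace hex (slot n) t)
        (outcomes (slot n) m root (scanSize 6 t (slot n)) (scanSize-sound m 6 (slot n))) e
    run-sound (contra n) m root e = ⊥-elim (Clashes.clash₀-sound F known m (slot n) (slot n) e refl)
    run-sound (assume c) {t} m root e =
      check-sound c (suppose h t) (suppose-sound h (λ H p → subst (Supposed H) (sym root) (supposed H p)) root m) e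
    run-sound (tube xs) m root e = ⊥-elim (anyDead-sound m dead xs (FactsHold.deadHolds known) e)
    run-sound (leaf a) m root e = leaf-sound a m root e

-- Tests at the leaves: matchings, turtles and boundary walks

module Match (t : Table) where

  member : Slot → List Slot → Bool
  member x []      = false
  member x (y ∷ X) = (y == x) ∨ member x X

  exclude : Slot → List Slot → List Slot
  exclude x X with link (lookup t x)
  ... | just y  = x ∷ y ∷ X
  ... | nothing = x ∷ X

  excludeOthers : Slot → List Slot → List Slot
  excludeOthers x X = exclude (rotate x) (exclude (unrotate x) X)

  choose : Slot → List Slot → List Slot
  choose x X with link (lookup t x)
  ... | just y  = excludeOthers x (excludeOthers y X)
  ... | nothing = excludeOthers x X

  -- Backtracking against a supposed perfect matching. `X` lists unmatched slots; at each given
  -- vertex all three edges must fail, either because they are in `X` or because matching them,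
  -- which excludes the other edges at both ends, fails at the remaining vertices. With no vertex
  -- left nothing is refuted.
  refute : List Slot → List ℕ → Bool
  option : List Slot → List ℕ → Slot → Bool
  refute X []       = false
  refute X (v ∷ vs) = option X vs (v , zero) ∧ (option X vs (v , suc zero) ∧ option X vs (v , suc (suc zero)))
  option X vs x     = member x X ∨ refute (choose x X) vs

  -- Of the three edges at the tail of `x`, the face uses that of `x` and that of the dart before
  -- it; `rotate x` is the edge that leaves the face.
  outward : ℕ → Slot → List Slot → List Slot
  outward zero    x X = X
  outward (suc k) x X with link (lookup t x)
  ... | just y  = exclude (rotate x) (outward k (rotate y) X)
  ... | nothing = X

  outwards : List Slot → List Slot
  outwards []       = []
  outwards (h ∷ hs) = outward 6 h (outwards hs)

  across : Slot → ℕ → Slot → Bool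
  across x k a = steps t k x (λ y → onLink t y (onFace t a))

  sepAt : ℕ → Slot → Slot → Slot → Bool
  sepAt j x a b = (across x 0 a ∧ across x j b) ∨ (across x 0 b ∧ across x j a)

  -- c stands for two edges at distance 2 + c % 2 on the face at the slot c / 2.
  sep : ℕ → Slot → Slot → Bool
  sep c a b = if c % 2 ≡ᵇ 0 then sepAt 2 (slot (c / 2)) a b else sepAt 3 (slot (c / 2)) a b

  separate : List Slot → List ℕ → Bool
  against  : Slot → List Slot → List Slot → List ℕ → Bool
  separate []       cs = true
  separate (h ∷ hs) cs = against h hs hs cs
  against h []        rest cs       = separate rest cs
  against h (h′ ∷ hs) rest []       = false
  against h (h′ ∷ hs) rest (c ∷ cs) = sep c h h′ ∧ against h hs rest cs

  hexagons : List Slot → Bool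
  hexagons []       = true
  hexagons (h ∷ hs) = hasSize t hex h ∧ hexagons hs

  matchOK : List Slot → List ℕ → List ℕ → Bool
  matchOK H vs cs = (length H <ᵇ 4) ∧ (hexagons H ∧ (separate H cs ∧ refute (outwards H) vs))

every : ∀ {k} → (Fin k → Bool) → Bool
every {zero}  p = true
every {suc k} p = p zero ∧ every (λ i → p (suc i))

some : ∀ {k} → (Fin k → Bool) → Bool
some {zero}  p = false
some {suc k} p = p zero ∨ some (λ i → p (suc i))

pairIn? : ∀ es x y → Dec (PairIn es x y)
pairIn? es x y = Any.any? (λ e → ≡-dec ℕₚ._≟_ ℕₚ._≟_ e (x , y) ⊎-dec ≡-dec ℕₚ._≟_ ℕₚ._≟_ e (y , x)) es

edges : List (ℕ × ℕ)
edges = (0 , 1) ∷ (1 , 2) ∷ (1 , 3) ∷ (2 , 3) ∷ (2 , 4) ∷ (3 , 4) ∷ (4 , 5) ∷ []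

turtleEdge : Fin 6 → Fin 6 → Bool
turtleEdge i k = does (pairIn? edges (toℕ i) (toℕ k))

-- star v: the faces opposite to v at its three neighbours are hexagons, which isolate v.
-- match H vs cs: the hexagons H admit no perfect matching, by branching at the vertices vs; cs are dual
-- paths of length two between the hexagons, which show that they are disjoint.
-- turtle xs wss: the region is a turtle with faces at xs.
-- loops w ws: the boundary walk of the region closes up without meeting the boundary dart reached by w.
data Leaf : Set where
  star   : ℕ → Leaf
  match  : List ℕ → List ℕ → List ℕ → Leaf
  turtle : List ℕ → List (List ℕ) → Leaf
  loops  : ℕ → List ℕ → Leaf

module LeafCheck (t : Table) (clash : List Bool → Slot → Slot → Bool) (edge : Fin 6 → Fin 6 → Bool) where
  open Match t

  each : ℕ → Slot → (Slot → Bool) → Bool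
  each zero    x p = true
  each (suc k) x p = p x ∧ onLink t x (λ y → each k (rotate y) p)

  -- Slots that differ in the table may be one dart of `G`, so two faces are told apart only by
  -- refuting that `x` is any of the darts on the face of `y`, with one path for each.
  distinctFrom : ℕ → Slot → Slot → List ℕ → Bool
  distinctFrom zero    x y ws       = true
  distinctFrom (suc k) x y []       = false
  distinctFrom (suc k) x y (w ∷ ws) = clash (bits w) x y ∧ onLink t y (λ y′ → distinctFrom k x (rotate y′) ws)

  spoke : Slot → (Slot → Slot → Bool) → Bool
  spoke x p = onLink t x (λ y → onLink t (unrotate y) (p (unrotate y)))

  -- Here `a`, `b`, `c` lie on the faces opposite to `v`. Any two neighbours of `v` are on a common
  -- face with `v`, and on it the edges that border their opposite faces are three steps apart. This
  -- explains `sepAt 3`, applied to the slots `x`, `y`, `z` on these common faces.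
  starOK : ℕ → Bool
  starOK v = spoke (v , zero) (λ a x → spoke (v , suc zero) (λ b y → spoke (v , suc (suc zero)) (λ c z →
    hexagons (a ∷ b ∷ c ∷ []) ∧ (sepAt 3 x a b ∧ (sepAt 3 y b c ∧ (sepAt 3 z c a ∧
    refute (outwards (a ∷ b ∷ c ∷ [])) (v ∷ [])))))))

  module Turtle (T : Fin 6 → Slot) where
    touching : Fin 6 → Slot → Bool
    touching i y = hasSize t hex y ∨ some (λ k → edge i k ∧ onFace t (T k) y)

    meets : Fin 6 → Fin 6 → Bool
    meets i k = along t 5 (T i) (λ x → onLink t x (onFace t (T k)))

    -- Each face must have an edge to a hexagon. Passing from pentagon to pentagon yields only
    -- `Inside`; such an edge lies on the bounding cycle, and there `boundary-inside` gives
    -- membership in `S` itself.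
    settled : Fin 6 → Bool
    settled i = hasSize t pent (T i) ∧ (along t 5 (T i) (λ x → onLink t x (hasSize t hex)) ∧
      (each 5 (T i) (λ x → onLink t x (touching i)) ∧ every (λ k → not (edge i k) ∨ meets i k)))

    apartFrom : ∀ {k} → Slot → (Fin k → Slot) → List (List ℕ) → (List (List ℕ) → Bool) → Bool
    apartFrom {zero}  x U wss        p = p wss
    apartFrom {suc k} x U []         p = false
    apartFrom {suc k} x U (ws ∷ wss) p = distinctFrom 5 x (U zero) ws ∧ apartFrom x (λ i → U (suc i)) wss p

    allApart : ∀ {k} → (Fin k → Slot) → List (List ℕ) → Bool
    allApart {zero}  U wss = true
    allApart {suc k} U wss = apartFrom (U zero) (λ i → U (suc i)) wss (allApart (λ i → U (suc i)))

    turtleOK : List (List ℕ) → Bool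
    turtleOK wss = every settled ∧ (allApart T wss ∧ some (λ i → onFace t (T i) (0 , zero)))

  -- Imitates `along-boundary` in the table. Each entry of the list refutes that the current dart is
  -- `y`, and the walk has to be back at the root when the list ends; then the entire orbit of the
  -- root avoids `y`.
  walk : List ℕ → Slot → Slot → Bool
  walk []       z y = z == (0 , zero)
  walk (w ∷ ws) z y = clash (bits w) z y ∧ steps t 1 z (λ p → onLink t p (λ q →
    (hasSize t hex q ∧ walk ws p y) ∨ (hasSize t pent q ∧ walk ws (rotate p) y)))

  -- A crossing is allowed only into a pentagon, so that maximality keeps the path inside the
  -- region.
  within : List Bool → Slot → (Slot → Bool) → Bool
  within []          x p = p x
  within (false ∷ w) x p = steps t 1 x (λ y → within w y p)
  within (true ∷ w)  x p = onLink t x (λ y → hasSize t pent y ∧ within w y p)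

  loopsOK : ℕ → List ℕ → Bool
  loopsOK w []        = false
  loopsOK w (w₁ ∷ ws) = within (bits w) (0 , zero) (λ y → onLink t y (hasSize t hex) ∧ walk (w₁ ∷ ws) (0 , zero) y)

  leafOK : Leaf → Bool
  leafOK (star v)         = starOK v
  leafOK (match H vs cs)  = matchOK (map slot H) vs cs
  leafOK (turtle xs wss)  = Turtle.turtleOK (λ i → nth xs (toℕ i)) wss
  leafOK (loops w ws)     = loopsOK w ws

-- Hexagonal tubes and cuts by three edges

-- The table of a tube of hexagons with circumference (a , b) in the hexagonal lattice is tubeₐᵦ.
tube₂₀ : Table
tube₂₀ = tubeTable (just hex ∷ []) (hyp 2 3 nothing) (3 ∷ 18 ∷ [])

-- In this and the following tube certificates every branch with a pentagon beside the tube is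
-- contradictory. In the remaining branch the leaf holds three embeddings of the same pattern, one
-- rooted at each neighbour of the root vertex.
tube₂₀-cert : Cert (List (List ℕ))
tube₂₀-cert = split 24 (split 27 (apart 1) (apart 1)) (split 6 (split 36 (contra 36) (split 42 (apart 1) (apart
  1))) (leaf ((3 ∷ 0 ∷ 18 ∷ 14 ∷ 10 ∷ 21 ∷ 6 ∷ 15 ∷ 36 ∷ 39 ∷ 42 ∷ []) ∷ (20 ∷ 31 ∷ 33 ∷ 26 ∷ 17 ∷ 13 ∷ 1 ∷ 27 ∷
  10 ∷ 21 ∷ 5 ∷ []) ∷ (17 ∷ 24 ∷ 27 ∷ 30 ∷ 20 ∷ 1 ∷ 13 ∷ 33 ∷ 3 ∷ 6 ∷ 9 ∷ []) ∷ [])))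

tube₁₁ : Table
tube₁₁ = tubeTable (just hex ∷ []) (hyp 1 2 nothing) (3 ∷ 12 ∷ [])

tube₁₁-cert : Cert (List (List ℕ))
tube₁₁-cert = split 18 (split 30 (apart 1) (apart 1)) (split 24 (split 36 (apart 1) (apart 1)) (leaf ((3 ∷ 0 ∷ 11
  ∷ 7 ∷ 18 ∷ 21 ∷ 12 ∷ 15 ∷ 30 ∷ 33 ∷ []) ∷ (10 ∷ 12 ∷ 15 ∷ 2 ∷ 3 ∷ 6 ∷ 24 ∷ 27 ∷ 18 ∷ 21 ∷ []) ∷ (17 ∷ 24 ∷ 27 ∷
  14 ∷ 10 ∷ 1 ∷ 36 ∷ 39 ∷ 3 ∷ 6 ∷ []) ∷ [])))

tube₃₀ : Table
tube₃₀ = tubeTable (just hex ∷ nothing ∷ nothing ∷ just hex ∷ []) (hyp 3 3 (just 3)) (3 ∷ 12 ∷ 18 ∷ [])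

tube₃₀-cert : Cert (List (List ℕ))
tube₃₀-cert = split 33 (split 45 (split 48 (split 54 (apart 52) (apart 12)) (split 54 (apart 4) (apart 12)))
  (split 36 (apart 12) (split 48 (contra 41) (contra 41)))) (split 36 (split 45 (split 51 (apart 1) (contra 41))
  (split 51 (apart 12) (contra 41))) (split 6 (split 24 (split 39 (split 60 (split 69 (apart 1) (apart 1)) (split
  69 (apart 4) (apart 12))) (split 60 (split 72 (apart 1) (apart 1)) (split 72 (apart 4) (apart 12)))) (split 60
  (split 63 (split 66 (apart 12) (apart 12)) (split 66 (apart 4) (apart 12))) (split 66 (apart 12) (split 69
  (contra 62) (contra 62))))) (leaf ((3 ∷ 0 ∷ 18 ∷ 21 ∷ 28 ∷ 30 ∷ 6 ∷ 9 ∷ 33 ∷ 14 ∷ 15 ∷ 24 ∷ 54 ∷ 57 ∷ 60 ∷ []) ∷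
  (20 ∷ 43 ∷ 45 ∷ 48 ∷ 35 ∷ 23 ∷ 1 ∷ 16 ∷ 51 ∷ 38 ∷ 39 ∷ 13 ∷ 28 ∷ 30 ∷ 5 ∷ []) ∷ (17 ∷ 36 ∷ 39 ∷ 42 ∷ 20 ∷ 1 ∷ 13
  ∷ 34 ∷ 45 ∷ 48 ∷ 51 ∷ 23 ∷ 3 ∷ 6 ∷ 9 ∷ []) ∷ []))))

tube₁₂ : Table
tube₁₂ = tubeTable (just hex ∷ nothing ∷ just hex ∷ []) (hyp 2 2 (just 3)) (3 ∷ 9 ∷ 33 ∷ [])

tube₁₂-cert : Cert (List (List ℕ))
tube₁₂-cert = split 12 (split 42 (split 45 (apart 1) (contra 38)) (split 45 (apart 12) (contra 38))) (split 21
  (split 48 (split 51 (apart 1) (contra 29)) (split 51 (apart 12) (contra 29))) (split 27 (split 54 (split 57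
  (apart 1) (contra 50)) (split 57 (apart 12) (contra 50))) (split 36 (split 60 (split 63 (apart 1) (contra 44))
  (split 63 (apart 12) (contra 44))) (leaf ((3 ∷ 0 ∷ 18 ∷ 25 ∷ 27 ∷ 30 ∷ 6 ∷ 33 ∷ 11 ∷ 12 ∷ 15 ∷ 21 ∷ 48 ∷ 51 ∷
  []) ∷ (20 ∷ 33 ∷ 11 ∷ 7 ∷ 21 ∷ 24 ∷ 1 ∷ 12 ∷ 15 ∷ 36 ∷ 39 ∷ 3 ∷ 27 ∷ 30 ∷ []) ∷ (17 ∷ 36 ∷ 39 ∷ 35 ∷ 20 ∷ 1 ∷ 13
  ∷ 42 ∷ 45 ∷ 60 ∷ 63 ∷ 10 ∷ 3 ∷ 6 ∷ []) ∷ [])))))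

tube₂₁ : Table
tube₂₁ = tubeTable (just hex ∷ nothing ∷ just hex ∷ []) (hyp 3 2 (just 4)) (3 ∷ 9 ∷ 18 ∷ [])

tube₂₁-cert : Cert (List (List ℕ))
tube₂₁-cert = split 12 (split 36 (contra 17) (contra 17)) (split 24 (split 27 (split 51 (apart 1) (contra 29))
  (split 51 (apart 12) (contra 29))) (split 36 (split 39 (split 57 (apart 1) (contra 41)) (split 57 (apart 12)
  (contra 41))) (split 54 (split 57 (split 63 (apart 1) (contra 59)) (split 63 (apart 12) (contra 59))) (leaf ((3
  ∷ 0 ∷ 18 ∷ 21 ∷ 31 ∷ 33 ∷ 6 ∷ 9 ∷ 43 ∷ 45 ∷ 14 ∷ 15 ∷ 48 ∷ 51 ∷ 26 ∷ []) ∷ (20 ∷ 43 ∷ 45 ∷ 14 ∷ 10 ∷ 23 ∷ 1 ∷ 16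
  ∷ 54 ∷ 57 ∷ 38 ∷ 39 ∷ 31 ∷ 33 ∷ 5 ∷ []) ∷ (17 ∷ 36 ∷ 39 ∷ 42 ∷ 20 ∷ 1 ∷ 13 ∷ 46 ∷ 60 ∷ 63 ∷ 56 ∷ 57 ∷ 3 ∷ 6 ∷ 9
  ∷ []) ∷ [])))))

-- Row `j`, entry `p` treats a second common edge that lies `j + 1` steps on along the face of
-- length `L` and `p + 1` steps on along the face of length `K`. A tube appears only between two
-- hexagons.
edgeCerts : Len → Len → List (List (Cert ⊥))
edgeCerts pent pent =
  ((p 1 ∷ p 26 ∷ p 6 ∷ p 6 ∷ []) ∷
   (p 12 ∷ split 0 (assume (split 3 (split 12 (apart 1) (apart 1)) none)) none ∷ p 6 ∷ p 6 ∷ []) ∷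
   (p 1 ∷ p 1 ∷ split 0 (assume (split 3 (split 6 (apart 1) (apart 1)) none)) none ∷ p 50 ∷ []) ∷
   (p 1 ∷ p 1 ∷ p 3 ∷ p 1 ∷ []) ∷ [])
  where
  p : ℕ → Cert ⊥
  p = patch (0 ∷ 3 ∷ [])
edgeCerts pent hex =
  ((p 1 ∷ p 26 ∷ p 26 ∷ p 6 ∷ p 6 ∷ []) ∷
   (p 12 ∷ split 0 (assume (split 3 none (split 12 (apart 1) (apart 1)))) none ∷ split 0 (assume (split 3 none
     (split 18 (apart 1) (apart 1)))) none ∷ p 6 ∷ p 6 ∷ []) ∷
   (p 1 ∷ p 1 ∷ split 0 (assume (split 3 none (split 15 (apart 1) (apart 1)))) none ∷ split 0 (assume (split 3
     none (split 6 (apart 1) (apart 1)))) none ∷ p 50 ∷ []) ∷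
   (p 1 ∷ p 1 ∷ p 3 ∷ p 3 ∷ p 1 ∷ []) ∷ [])
  where
  p : ℕ → Cert ⊥
  p = patch (0 ∷ 3 ∷ [])
edgeCerts hex pent =
  ((p 1 ∷ p 26 ∷ p 6 ∷ p 6 ∷ []) ∷
   (p 12 ∷ split 0 none (assume (split 3 (split 12 (split 18 (apart 1) (apart 1)) (split 18 (apart 1) (apart 1)))
     none)) ∷ p 6 ∷ p 6 ∷ []) ∷
   (p 12 ∷ split 0 none (assume (split 3 (split 15 (apart 1) (apart 1)) none)) ∷ split 0 none (assume (split 3
     (split 6 (apart 1) (apart 1)) none)) ∷ p 50 ∷ []) ∷
   (p 1 ∷ p 1 ∷ split 0 none (assume (split 3 (split 6 (split 18 (apart 1) (apart 1)) (split 18 (apart 1) (apart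
     1))) none)) ∷ p 50 ∷ []) ∷
   (p 1 ∷ p 1 ∷ p 3 ∷ p 1 ∷ []) ∷ [])
  where
  p : ℕ → Cert ⊥
  p = patch (0 ∷ 3 ∷ [])
edgeCerts hex hex =
  ((p 1 ∷ p 26 ∷ p 26 ∷ p 6 ∷ p 6 ∷ []) ∷
   (p 12 ∷ split 0 none (assume (split 3 none (split 12 (split 18 (split 24 (apart 1) (apart 1)) (tube (3 ∷ 0 ∷ 11
     ∷ 7 ∷ 18 ∷ 21 ∷ 12 ∷ 15 ∷ 27 ∷ 30 ∷ []))) (tube (0 ∷ 3 ∷ 6 ∷ 9 ∷ 12 ∷ 15 ∷ 18 ∷ 21 ∷ 24 ∷ 27 ∷ []))))) ∷
     split 0 none (assume (split 3 none (split 21 (apart 1) (apart 1)))) ∷ p 6 ∷ p 6 ∷ []) ∷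
   (p 12 ∷ split 0 none (assume (split 3 none (split 15 (apart 1) (apart 1)))) ∷ split 0 none (assume (split 3
     none (split 6 (split 24 (contra 24) (tube (10 ∷ 12 ∷ 15 ∷ 2 ∷ 3 ∷ 6 ∷ 21 ∷ 18 ∷ 28 ∷ 30 ∷ 26 ∷ []))) (tube (3
     ∷ 0 ∷ 18 ∷ 14 ∷ 10 ∷ 21 ∷ 6 ∷ 15 ∷ 24 ∷ 27 ∷ 30 ∷ []))))) ∷ split 0 none (assume (split 3 none (split 6
     (apart 1) (apart 1)))) ∷ p 50 ∷ []) ∷
   (p 1 ∷ p 1 ∷ split 0 none (assume (split 3 none (split 18 (apart 1) (apart 1)))) ∷ split 0 none (assume (split
     3 none (split 6 (split 18 (split 24 (apart 1) (apart 1)) (tube (1 ∷ 18 ∷ 21 ∷ 17 ∷ 13 ∷ 5 ∷ 27 ∷ 30 ∷ 6 ∷ 9 ∷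
     []))) (tube (4 ∷ 6 ∷ 9 ∷ 12 ∷ 15 ∷ 2 ∷ 24 ∷ 27 ∷ 18 ∷ 21 ∷ []))))) ∷ p 50 ∷ []) ∷
   (p 1 ∷ p 1 ∷ p 3 ∷ p 3 ∷ p 1 ∷ []) ∷ [])
  where
  p : ℕ → Cert ⊥
  p = patch (0 ∷ 3 ∷ [])

-- Row `p`, entry `q` treats an edge that lies `p` steps along the face across the first edge and,
-- reversed, `q` steps along the face across the edge `j` steps later. Again a tube appears only if
-- all faces of the dual triangle are hexagons.
cutCerts : Len → ℕ → Len → Len → List (List (Cert ⊥))
cutCerts pent 2 pent pent =
  ((p 1 ∷ p 1 ∷ p 53 ∷ p 13 ∷ p 13 ∷ []) ∷
   (p 13 ∷ p 2 ∷ p 13 ∷ p 13 ∷ p 3 ∷ []) ∷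
   (p 26 ∷ p 2 ∷ assume (split 9 (split 15 (split 21 (apart 1) none) (split 21 (apart 12) none)) none) ∷ assume
     (split 9 (split 11 (split 21 (apart 1) none) (split 21 (apart 12) none)) none) ∷ p 25 ∷ []) ∷
   (p 26 ∷ p 2 ∷ assume (split 3 (split 5 (apart 1) (contra 5)) none) ∷ assume (split 9 (split 0 (split 12 (split
     27 (apart 1) (contra 14)) (split 27 (apart 12) (contra 14))) none) none) ∷ p 25 ∷ []) ∷
   (p 1 ∷ p 1 ∷ p 4 ∷ p 4 ∷ p 4 ∷ []) ∷ [])
  where
  p : ℕ → Cert ⊥
  p = patch (0 ∷ 3 ∷ 9 ∷ [])
cutCerts pent 2 pent hex =
  ((p 1 ∷ p 1 ∷ p 1 ∷ p 1 ∷ p 1 ∷ p 1 ∷ []) ∷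
   (p 13 ∷ p 2 ∷ p 13 ∷ p 13 ∷ p 13 ∷ p 3 ∷ []) ∷
   (p 26 ∷ p 2 ∷ assume (split 9 none (split 15 (split 24 (apart 1) none) (split 24 (apart 12) none))) ∷ assume
     (split 9 none (split 15 (split 18 (split 24 (apart 12) none) (split 24 (apart 12) none)) (split 24 (split 27
     (contra 17) (contra 17)) none))) ∷ assume (split 9 none (split 11 (split 24 (apart 1) none) (split 24 (apart
     12) none))) ∷ p 25 ∷ []) ∷
   (p 26 ∷ p 2 ∷ assume (split 3 (split 5 (apart 1) (contra 5)) none) ∷ assume (split 9 none (split 18 (split 27
     (apart 12) none) (split 27 (apart 12) none))) ∷ assume (split 9 none (split 3 (split 18 (contra 8) (contra
     8)) none)) ∷ p 25 ∷ []) ∷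
   (p 1 ∷ p 1 ∷ p 4 ∷ p 4 ∷ p 4 ∷ p 4 ∷ []) ∷ [])
  where
  p : ℕ → Cert ⊥
  p = patch (0 ∷ 3 ∷ 9 ∷ [])
cutCerts pent 2 hex pent =
  ((p 1 ∷ p 1 ∷ p 53 ∷ p 13 ∷ p 13 ∷ []) ∷
   (p 2 ∷ p 2 ∷ p 13 ∷ p 13 ∷ p 3 ∷ []) ∷
   (p 2 ∷ p 2 ∷ assume (split 0 (split 3 none (split 21 (contra 5) (contra 5))) none) ∷ assume (split 9 (split 11
     (split 21 (apart 1) none) (split 21 (apart 12) none)) none) ∷ p 25 ∷ []) ∷
   (p 2 ∷ p 2 ∷ assume (split 9 (split 18 (split 24 none (apart 1)) (split 24 none (apart 12))) none) ∷ assume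
     (split 9 (split 0 (split 12 (split 27 (apart 1) (contra 14)) (split 27 (apart 12) (contra 14))) none) none) ∷
     p 25 ∷ []) ∷
   (p 2 ∷ p 2 ∷ assume (split 3 none (split 5 (apart 1) (contra 5))) ∷ assume (split 9 (split 11 (split 21 (split
     33 none (apart 12)) (split 33 none (apart 12))) (split 21 (split 36 none (apart 12)) (split 36 none (apart
     12)))) none) ∷ p 25 ∷ []) ∷
   (p 1 ∷ p 1 ∷ p 4 ∷ p 4 ∷ p 4 ∷ []) ∷ [])
  where
  p : ℕ → Cert ⊥
  p = patch (0 ∷ 3 ∷ 9 ∷ [])
cutCerts pent 2 hex hex =
  ((p 1 ∷ p 1 ∷ p 1 ∷ p 1 ∷ p 1 ∷ p 1 ∷ []) ∷
   (p 2 ∷ p 2 ∷ p 13 ∷ p 13 ∷ p 13 ∷ p 3 ∷ []) ∷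
   (p 2 ∷ p 2 ∷ assume (split 0 (split 3 none (split 21 (contra 5) (contra 5))) none) ∷ split 0 (assume (split 9
     none (split 12 (split 27 (apart 1) (contra 14)) (split 27 (apart 12) (contra 14))))) none ∷ assume (split 9
     none (split 11 (split 24 (apart 1) none) (split 24 (apart 12) none))) ∷ p 25 ∷ []) ∷
   (p 2 ∷ p 2 ∷ assume (split 9 none (split 18 (split 27 none (apart 1)) (split 27 none (apart 12)))) ∷ assume
     (split 3 none (split 9 none (split 24 (split 30 (apart 1) (contra 20)) (split 30 (apart 12) (contra 20))))) ∷
     assume (split 9 none (split 0 (split 12 (split 30 (apart 1) (contra 14)) (split 30 (apart 12) (contra 14)))
     none)) ∷ p 25 ∷ []) ∷
   (p 2 ∷ p 2 ∷ assume (split 3 none (split 5 (apart 1) (contra 5))) ∷ assume (split 9 none (split 21 (split 30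
     none (apart 12)) (split 30 none (apart 12)))) ∷ assume (split 3 none (split 9 none (split 21 (contra 8)
     (contra 8)))) ∷ p 25 ∷ []) ∷
   (p 1 ∷ p 1 ∷ p 4 ∷ p 4 ∷ p 4 ∷ p 4 ∷ []) ∷ [])
  where
  p : ℕ → Cert ⊥
  p = patch (0 ∷ 3 ∷ 9 ∷ [])
cutCerts hex 2 pent pent =
  ((p 1 ∷ p 1 ∷ p 1 ∷ p 1 ∷ p 1 ∷ []) ∷
   (p 2 ∷ p 2 ∷ p 13 ∷ p 13 ∷ p 9 ∷ []) ∷
   (p 2 ∷ p 2 ∷ assume (split 9 (split 15 (split 21 (apart 1) none) (split 21 (apart 12) none)) none) ∷ assume
     (split 9 (split 0 none (split 21 (contra 2) (contra 2))) none) ∷ p 25 ∷ []) ∷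
   (p 2 ∷ p 2 ∷ assume (split 3 (split 5 (apart 1) (contra 5)) none) ∷ assume (split 9 (split 11 (split 18 (split
     30 (apart 12) none) (split 30 (apart 12) none)) (split 18 (split 33 (apart 12) none) (split 33 (apart 12)
     none))) none) ∷ p 25 ∷ []) ∷
   (p 1 ∷ p 1 ∷ p 4 ∷ p 4 ∷ p 4 ∷ []) ∷ [])
  where
  p : ℕ → Cert ⊥
  p = patch (0 ∷ 3 ∷ 9 ∷ [])
cutCerts hex 2 pent hex =
  ((p 2 ∷ p 1 ∷ p 53 ∷ p 53 ∷ p 13 ∷ p 13 ∷ []) ∷
   (p 2 ∷ p 2 ∷ p 13 ∷ p 13 ∷ p 13 ∷ p 9 ∷ []) ∷
   (p 2 ∷ p 2 ∷ assume (split 9 none (split 15 (split 24 (apart 1) none) (split 24 (apart 12) none))) ∷ assume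
     (split 9 none (split 15 (split 18 (split 24 (apart 12) none) (split 24 (apart 12) none)) (split 24 (split 27
     (contra 17) (contra 17)) none))) ∷ assume (split 9 none (split 0 none (split 24 (contra 2) (contra 2)))) ∷ p
     25 ∷ []) ∷
   (p 2 ∷ p 2 ∷ assume (split 3 (split 5 (apart 1) (contra 5)) none) ∷ assume (split 9 none (split 18 (split 27
     (apart 12) none) (split 27 (apart 12) none))) ∷ assume (split 9 none (split 3 (split 18 (contra 8) (contra
     8)) none)) ∷ p 25 ∷ []) ∷
   (p 1 ∷ p 1 ∷ p 4 ∷ p 4 ∷ p 4 ∷ p 4 ∷ []) ∷ [])
  where
  p : ℕ → Cert ⊥
  p = patch (0 ∷ 3 ∷ 9 ∷ [])
cutCerts hex 2 hex pent =
  ((p 1 ∷ p 1 ∷ p 1 ∷ p 1 ∷ p 1 ∷ []) ∷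
   (p 13 ∷ p 2 ∷ p 13 ∷ p 13 ∷ p 9 ∷ []) ∷
   (p 25 ∷ p 2 ∷ assume (split 0 none (split 3 none (split 24 (contra 5) (contra 5)))) ∷ assume (split 9 (split 0
     none (split 21 (contra 2) (contra 2))) none) ∷ p 25 ∷ []) ∷
   (p 106 ∷ p 2 ∷ assume (split 9 (split 18 (split 24 none (apart 1)) (split 24 none (apart 12))) none) ∷ assume
     (split 3 none (split 24 (split 27 (apart 1) (contra 20)) (split 27 (apart 12) (contra 20)))) ∷ p 25 ∷ []) ∷
   (p 26 ∷ p 2 ∷ assume (split 3 none (split 5 (apart 1) (contra 5))) ∷ assume (split 9 (split 11 (split 21 (split
     33 none (apart 12)) (split 33 none (apart 12))) (split 21 (split 36 none (apart 12)) (split 36 none (apart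
     12)))) none) ∷ p 25 ∷ []) ∷
   (p 1 ∷ p 1 ∷ p 4 ∷ p 4 ∷ p 4 ∷ []) ∷ [])
  where
  p : ℕ → Cert ⊥
  p = patch (0 ∷ 3 ∷ 9 ∷ [])
cutCerts hex 2 hex hex =
  ((p 3 ∷ p 1 ∷ p 53 ∷ p 53 ∷ p 13 ∷ p 13 ∷ []) ∷
   (p 13 ∷ p 2 ∷ p 13 ∷ p 13 ∷ p 13 ∷ p 9 ∷ []) ∷
   (p 25 ∷ p 2 ∷ assume (split 0 none (split 3 none (split 24 (contra 5) (contra 5)))) ∷ assume (split 3 none
     (split 15 (split 27 (split 30 (apart 1) (contra 23)) (split 30 (apart 12) (contra 23))) (split 9 none (split
     0 none (tube (3 ∷ 0 ∷ 12 ∷ 19 ∷ 21 ∷ 24 ∷ 6 ∷ 33 ∷ 11 ∷ 36 ∷ 39 ∷ 15 ∷ 27 ∷ 30 ∷ [])))))) ∷ assume (split 9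
     none (split 0 none (split 24 (contra 2) (contra 2)))) ∷ p 25 ∷ []) ∷
   (p 106 ∷ p 2 ∷ assume (split 9 none (split 18 (split 27 none (apart 1)) (split 27 none (apart 12)))) ∷ assume
     (split 3 none (split 9 none (split 24 (split 30 (apart 1) (contra 20)) (split 30 (apart 12) (contra 20))))) ∷
     assume (split 9 none (split 3 none (split 0 none (split 12 (split 18 (split 21 (split 45 (apart 1) (contra
     23)) (split 45 (apart 12) (contra 23))) (split 36 (split 48 (apart 12) (tube (3 ∷ 0 ∷ 12 ∷ 15 ∷ 25 ∷ 27 ∷ 6 ∷
     9 ∷ 40 ∷ 50 ∷ 32 ∷ 33 ∷ 42 ∷ 45 ∷ 20 ∷ []))) (split 48 (apart 12) (tube (3 ∷ 0 ∷ 12 ∷ 15 ∷ 25 ∷ 27 ∷ 6 ∷ 9 ∷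
     40 ∷ 50 ∷ 32 ∷ 33 ∷ 42 ∷ 45 ∷ 20 ∷ []))))) (tube (0 ∷ 3 ∷ 6 ∷ 9 ∷ 30 ∷ 33 ∷ 12 ∷ 15 ∷ 18 ∷ 21 ∷ 24 ∷ 27 ∷ 36
     ∷ 39 ∷ 42 ∷ [])))))) ∷ p 25 ∷ []) ∷
   (p 26 ∷ p 2 ∷ assume (split 3 none (split 5 (apart 1) (contra 5))) ∷ assume (split 9 none (split 21 (split 30
     none (apart 12)) (split 30 none (apart 12)))) ∷ assume (split 3 none (split 9 none (split 21 (contra 8)
     (contra 8)))) ∷ p 25 ∷ []) ∷
   (p 1 ∷ p 1 ∷ p 4 ∷ p 4 ∷ p 4 ∷ p 4 ∷ []) ∷ [])
  where
  p : ℕ → Cert ⊥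
  p = patch (0 ∷ 3 ∷ 9 ∷ [])
cutCerts hex 3 pent pent =
  ((p 1 ∷ p 1 ∷ p 1 ∷ p 1 ∷ p 1 ∷ []) ∷
   (p 2 ∷ p 2 ∷ p 13 ∷ p 13 ∷ p 3 ∷ []) ∷
   (p 2 ∷ p 2 ∷ assume (split 0 none (split 3 (split 6 (split 27 (apart 1) (contra 8)) (split 27 (apart 12)
     (contra 8))) none)) ∷ assume (split 0 none (split 15 (split 12 (apart 12) none) (split 12 (apart 12) none)))
     ∷ p 25 ∷ []) ∷
   (p 2 ∷ p 2 ∷ assume (split 12 (split 21 (split 3 (apart 12) none) (split 3 (apart 100) none)) none) ∷ assume
     (split 0 none (split 12 (split 15 (split 30 (apart 1) (contra 17)) (split 30 (apart 12) (contra 17))) none))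
     ∷ p 25 ∷ []) ∷
   (p 2 ∷ p 1 ∷ p 4 ∷ p 4 ∷ p 4 ∷ []) ∷ [])
  where
  p : ℕ → Cert ⊥
  p = patch (0 ∷ 3 ∷ 12 ∷ [])
cutCerts hex 3 pent hex =
  ((p 1 ∷ p 2 ∷ p 100 ∷ p 53 ∷ p 53 ∷ p 13 ∷ []) ∷
   (p 2 ∷ p 2 ∷ p 13 ∷ p 13 ∷ p 13 ∷ p 3 ∷ []) ∷
   (p 2 ∷ p 2 ∷ assume (split 0 none (split 3 (split 6 (split 27 (apart 1) (contra 8)) (split 27 (apart 12)
     (contra 8))) none)) ∷ split 0 none (assume (split 12 none (split 15 (split 30 (apart 1) (contra 17)) (split
     30 (apart 12) (contra 17))))) ∷ assume (split 12 none (split 14 (split 27 none (apart 1)) (split 27 none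
     (apart 12)))) ∷ p 25 ∷ []) ∷
   (p 2 ∷ p 2 ∷ assume (split 12 none (split 21 (split 3 (apart 12) none) (split 3 (apart 100) none))) ∷ assume
     (split 3 (split 12 none (split 21 (split 30 (apart 1) (contra 8)) (split 30 (apart 12) (contra 8)))) none) ∷
     assume (split 12 none (split 0 none (split 15 (split 33 (apart 1) (contra 17)) (split 33 (apart 12) (contra
     17))))) ∷ p 25 ∷ []) ∷
   (p 2 ∷ p 1 ∷ p 4 ∷ p 4 ∷ p 4 ∷ p 4 ∷ []) ∷ [])
  where
  p : ℕ → Cert ⊥
  p = patch (0 ∷ 3 ∷ 12 ∷ [])
cutCerts hex 3 hex pent =
  ((p 1 ∷ p 1 ∷ p 1 ∷ p 1 ∷ p 1 ∷ []) ∷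
   (p 13 ∷ p 2 ∷ p 13 ∷ p 13 ∷ p 3 ∷ []) ∷
   (p 106 ∷ p 2 ∷ split 0 none (assume (split 12 (split 15 (split 27 (apart 1) (contra 17)) (split 27 (apart 12)
     (contra 17))) none)) ∷ assume (split 0 none (split 15 (split 12 (apart 12) none) (split 12 (apart 12) none)))
     ∷ p 25 ∷ []) ∷
   (p 26 ∷ p 2 ∷ assume (split 0 none (split 3 none (split 6 (split 30 (apart 1) (contra 8)) (split 30 (apart 12)
     (contra 8))))) ∷ assume (split 0 none (split 12 (split 15 (split 30 (apart 1) (contra 17)) (split 30 (apart
     12) (contra 17))) none)) ∷ p 25 ∷ []) ∷
   (p 26 ∷ p 2 ∷ assume (split 12 (split 24 (split 3 none (apart 12)) (split 3 none (apart 100))) none) ∷ assume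
     (split 3 none (split 24 (split 30 (apart 1) (contra 8)) (split 30 (apart 12) (contra 8)))) ∷ p 25 ∷ []) ∷
   (p 4 ∷ p 1 ∷ p 4 ∷ p 4 ∷ p 4 ∷ []) ∷ [])
  where
  p : ℕ → Cert ⊥
  p = patch (0 ∷ 3 ∷ 12 ∷ [])
cutCerts hex 3 hex hex =
  ((p 1 ∷ p 2 ∷ p 100 ∷ p 53 ∷ p 53 ∷ p 13 ∷ []) ∷
   (p 13 ∷ p 2 ∷ p 13 ∷ p 13 ∷ p 13 ∷ p 3 ∷ []) ∷
   (p 106 ∷ p 2 ∷ assume (split 0 none (split 3 none (split 12 none (split 6 (split 30 (split 33 (split 45 (apart
     1) (contra 35)) (split 45 (apart 12) (contra 35))) (split 36 (split 48 (apart 12) (tube (0 ∷ 3 ∷ 6 ∷ 9 ∷ 12 ∷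
     21 ∷ 15 ∷ 19 ∷ 40 ∷ 50 ∷ 26 ∷ 27 ∷ 42 ∷ 45 ∷ 32 ∷ []))) (split 48 (apart 12) (tube (0 ∷ 3 ∷ 6 ∷ 9 ∷ 12 ∷ 21 ∷
     15 ∷ 19 ∷ 40 ∷ 50 ∷ 26 ∷ 27 ∷ 42 ∷ 45 ∷ 32 ∷ []))))) (tube (3 ∷ 0 ∷ 15 ∷ 19 ∷ 24 ∷ 27 ∷ 6 ∷ 9 ∷ 30 ∷ 33 ∷ 14
     ∷ 21 ∷ 36 ∷ 39 ∷ 42 ∷ [])))))) ∷ split 0 none (assume (split 12 none (split 15 (split 30 (apart 1) (contra
     17)) (split 30 (apart 12) (contra 17))))) ∷ assume (split 12 none (split 14 (split 27 none (apart 1)) (split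
     27 none (apart 12)))) ∷ p 25 ∷ []) ∷
   (p 26 ∷ p 2 ∷ assume (split 0 none (split 3 none (split 6 (split 30 (apart 1) (contra 8)) (split 30 (apart 12)
     (contra 8))))) ∷ assume (split 0 none (split 3 none (split 12 none (split 6 (split 21 (split 36 (split 38
     (apart 1) (contra 38)) (tube (25 ∷ 19 ∷ 33 ∷ 14 ∷ 10 ∷ 21 ∷ 30 ∷ 5 ∷ 27 ∷ 2 ∷ 15 ∷ 6 ∷ 43 ∷ 45 ∷ 38 ∷ [])))
     (tube (10 ∷ 12 ∷ 27 ∷ 2 ∷ 3 ∷ 6 ∷ 21 ∷ 24 ∷ 15 ∷ 18 ∷ 33 ∷ 30 ∷ 40 ∷ 42 ∷ 45 ∷ []))) (tube (3 ∷ 0 ∷ 15 ∷ 18 ∷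
     25 ∷ 30 ∷ 6 ∷ 9 ∷ 33 ∷ 14 ∷ 27 ∷ 21 ∷ 36 ∷ 39 ∷ 42 ∷ [])))))) ∷ assume (split 12 none (split 0 none (split 15
     (split 33 (apart 1) (contra 17)) (split 33 (apart 12) (contra 17))))) ∷ p 25 ∷ []) ∷
   (p 26 ∷ p 2 ∷ assume (split 12 none (split 24 (split 3 none (apart 12)) (split 3 none (apart 100)))) ∷ assume
     (split 3 none (split 12 none (split 24 (split 33 (apart 1) (contra 8)) (split 33 (apart 12) (contra 8))))) ∷
     assume (split 3 none (split 6 (split 33 (split 36 (apart 1) (contra 26)) (split 36 (apart 12) (contra 26)))
     (split 12 none (split 0 none (tube (4 ∷ 6 ∷ 9 ∷ 12 ∷ 39 ∷ 2 ∷ 32 ∷ 24 ∷ 27 ∷ 33 ∷ 36 ∷ 22 ∷ 15 ∷ 18 ∷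
     [])))))) ∷ p 25 ∷ []) ∷
   (p 4 ∷ p 1 ∷ p 4 ∷ p 4 ∷ p 4 ∷ p 4 ∷ []) ∷ [])
  where
  p : ℕ → Cert ⊥
  p = patch (0 ∷ 3 ∷ 12 ∷ [])
cutCerts _ _ _ _ = []

-- Only the vertex of the root is compared with the neighbour: the pattern may appear there in a
-- rotated position.
embedsAt : Table → Table → Fin 3 → List ℕ → Bool
embedsAt T t k xs = onLink t (zero , k) (λ y → proj₁ y ≡ᵇ proj₁ (nth xs 0)) ∧ embeds t T xs

neighbours : Table → List (List ℕ) → Table → Bool
neighbours T (xs ∷ ys ∷ zs ∷ []) t =
  embedsAt T t zero xs ∧ (embedsAt T t (suc zero) ys ∧ embedsAt T t (suc (suc zero)) zs)
neighbours T _ t = false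

hexRoot : Table → Bool
hexRoot T = hasSize T hex (0 , zero) ∧ (hasSize T hex (0 , suc zero) ∧ hasSize T hex (0 , suc (suc zero)))

pick : ∀ {A : Set} → A → List A → ℕ → A
pick a []       k       = a
pick a (x ∷ xs) zero    = x
pick a (x ∷ xs) (suc k) = pick a xs k

below : ℕ → (ℕ → Bool) → Bool
below zero    p = true
below (suc k) p = p k ∧ below k p

below-sound : ∀ k p → below k p ≡ true → ∀ {j} → j < k → p j ≡ true
below-sound (suc k) p e {j} j<k with both e | m≤n⇒m<n∨m≡n j<k
... | q , r | inj₁ (s≤s l) = below-sound k p r l
... | q , r | inj₂ refl    = q

refutes : Facts → Hyp → Cert ⊥ → Table → Bool
refutes F h = Check.run F (just h) (λ _ _ → false)

-- A bootstrap: with `facts₀` the tubes of circumference two are excluded, with `facts₁` two faces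
-- get at most one common edge, with `facts₂` the tubes of circumference three are excluded, with
-- `facts₃` the cuts by three edges. The main exploration has `facts₄`.
facts₀ facts₁ facts₂ facts₃ facts₄ : Facts
facts₀ = facts false false []
facts₁ = facts false false (tube₂₀ ∷ tube₁₁ ∷ [])
facts₂ = facts true false []
facts₃ = facts true false (tube₃₀ ∷ tube₁₂ ∷ tube₂₁ ∷ [])
facts₄ = facts true true []

edgeCert : Len → Len → ℕ → ℕ → Cert ⊥
edgeCert L K j p = pick none (pick [] (edgeCerts L K) j) p

cutCert : Len → ℕ → Len → Len → ℕ → ℕ → Cert ⊥
cutCert L j K M p q = pick none (pick [] (cutCerts L j K M) p) q

edgeCheck : Len → Len → Bool
edgeCheck L K = below (length5or6 L ∸ 1) (λ j → below (length5or6 K ∸ 1) (λ p →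
  refutes facts₁ (hyp p (suc j) nothing) (edgeCert L K j p) (path L (just K ∷ []))))

edgesChecked : ∀ L K → edgeCheck L K ≡ true
edgesChecked pent pent = refl
edgesChecked pent hex  = refl
edgesChecked hex  pent = refl
edgesChecked hex  hex  = refl

cutMarks : ℕ → Len → Len → List (Maybe Len)
cutMarks 2 K M = just K ∷ nothing ∷ just M ∷ []
cutMarks _ K M = just K ∷ nothing ∷ nothing ∷ just M ∷ []

cutCheck : Len → ℕ → Len → Len → Bool
cutCheck L j K M = below (length5or6 K) (λ p → below (length5or6 M) (λ q →
  refutes facts₃ (hyp p j (just q)) (cutCert L j K M p q) (path L (cutMarks j K M))))

cuts₅₂ : ∀ K M → cutCheck pent 2 K M ≡ true
cuts₅₂ pent pent = refl
cuts₅₂ pent hex  = refl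
cuts₅₂ hex  pent = refl
cuts₅₂ hex  hex  = refl

cuts₆₂ : ∀ K M → cutCheck hex 2 K M ≡ true
cuts₆₂ pent pent = refl
cuts₆₂ pent hex  = refl
cuts₆₂ hex  pent = refl
cuts₆₂ hex  hex  = refl

cuts₆₃ : ∀ K M → cutCheck hex 3 K M ≡ true
cuts₆₃ pent pent = refl
cuts₆₃ pent hex  = refl
cuts₆₃ hex  pent = refl
cuts₆₃ hex  hex  = refl

module Local (F : Fullerene) where
  G : PlaneCubicGraph
  G = Fullerene.graph F

  open PlaneCubicGraph G using (n; nb; face; face-surj; connected)
  open Darts G
  open Models G
  open Reading G
  open CheckSoundness G

  lens : ∀ d → HasLen pent d ⊎ HasLen hex d
  lens d = Sum.map hasLen hasLen (Fullerene.pentOrHex F (face d))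

  someLen : ∀ d → ∃[ L ] HasLen L d
  someLen d with lens d
  ... | inj₁ p = pent , p
  ... | inj₂ h = hex , h

  refutes-sound : ∀ K → FactsHold K → ∀ h c {t β x} → β ⊨ t → β 0 ≡ x → Supposed h x → refutes K h c t ≢ true
  refutes-sound K known h c m root s =
    CheckSound.run-sound lens K known (just h) (λ _ _ → false) _ ⊥ (λ { _ refl → s }) (λ _ _ _ ()) c m root

  MarkHolds : Maybe Len → D → Set
  MarkHolds nothing  d = ⊤
  MarkHolds (just L) d = HasLen L d

  MarksHold : List (Maybe Len) → D → Set
  MarksHold []       d = ⊤
  MarksHold (m ∷ ms) d = MarkHolds m (flip d) × MarksHold ms (next d)

  attach-sound : ∀ ms x {t β} → β ⊨ t → proj₁ x < length t → MarksHold ms (at β x) →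
    ∃[ γ ] γ ⊨ attach ms x t × γ 0 ≡ β 0
  attach-sound [] x {β = β} m x< h = β , m , refl
  attach-sound (k ∷ ms) x {t} {β} m x< (h , hs) with follow x t | follow-sound x m x<
  ... | y , t′ | g , y< , y≡ with attach-sound ms (rotate y)
        (mark-sound k y (Grows.models g) (λ { refl → subst (HasLen _) (sym y≡) h }))
        (subst (proj₁ y <_) (sym (length-mark k y t′)) y<)
        (subst (MarksHold ms) (sym (trans (at-rotate (Grows.β′ g) y) (cong turn y≡))) hs)
  ... | γ , m′ , root = γ , m′ , trans root (Grows.agree g (positive x<))
    where
    positive : ∀ {i j} → i < j → 0 < j
    positive (s≤s _) = z<s

  path-sound : ∀ L ms d → HasLen L d → MarksHold ms d → ∃[ γ ] γ ⊨ path L ms × γ 0 ≡ d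
  path-sound L ms d h hs = attach-sound ms (0 , zero)
    (mark-sound {β = λ _ → d} (just L) (0 , zero) start (λ { refl → h }))
    (subst (0 <_) (sym (length-mark (just L) (0 , zero) (blankRow ∷ []))) z<s) hs
    where
    noLink : ∀ x {y} → link (lookup (blankRow ∷ []) x) ≢ just y
    noLink (zero , zero) ()
    noLink (zero , suc zero) ()
    noLink (zero , suc (suc zero)) ()
    noLink (suc v , i) ()
    noSize : ∀ x {L} → size (lookup (blankRow ∷ []) x) ≢ just L
    noSize (zero , zero) ()
    noSize (zero , suc zero) ()
    noSize (zero , suc (suc zero)) ()
    noSize (suc v , i) ()
    start : (λ _ → d) ⊨ (blankRow ∷ [])
    start = record
      { links = λ x e → ⊥-elim (noLink x e)
      ; sizes = λ x e → ⊥-elim (noSize x e)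
      ; bound = λ x e → ⊥-elim (noLink x e)
      }

  -- `Lives v` says that the pattern occurs with its root at the vertex `v`. It passes to all
  -- neighbours of `v`, hence to every vertex of the connected graph. A vertex of a pentagon would
  -- then be surrounded by three hexagons.
  module Tube (K : Facts) (known : FactsHold K) (T : Table) (c : Cert (List (List ℕ)))
    (hexagons : hexRoot T ≡ true) (checked : Check.run K nothing (neighbours T) c T ≡ true) where

    Lives : Fin n → Set
    Lives v = ∃[ β ] β ⊨ T × proj₁ (β 0) ≡ v

    embedsAt-sound : ∀ k xs {t β} → β ⊨ t → embedsAt T t k xs ≡ true → Lives (proj₁ (flip (spin k (β 0))))
    embedsAt-sound k xs {t} {β} m e with both e
    ... | p , q with onLink-sound t (zero , k) p
    ... | (v , i) , l , r with nth xs 0 in eq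
    ... | w , j with ≡ᵇ-sound {v} {w} r
    ... | refl = _ , embeds-sound m T xs q ,
      trans (cong (λ x → proj₁ (at β x)) eq) (trans (spin-vertex j (β v))
        (trans (sym (spin-vertex i (β v))) (cong proj₁ (sym (links m (zero , k) l)))))

    neighbours-sound : ∀ xss {t β} → β ⊨ t → neighbours T xss t ≡ true →
      ∀ k → Lives (proj₁ (flip (spin k (β 0))))
    neighbours-sound (xs ∷ ys ∷ zs ∷ []) {t} m e k with both {embedsAt T t zero xs} e
    ... | p , e₁ with both {embedsAt T t (suc zero) ys} e₁
    neighbours-sound (xs ∷ ys ∷ zs ∷ []) m e zero | p , e₁ | q , r = embedsAt-sound zero xs m p
    neighbours-sound (xs ∷ ys ∷ zs ∷ []) m e (suc zero) | p , e₁ | q , r = embedsAt-sound (suc zero) ys m q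
    neighbours-sound (xs ∷ ys ∷ zs ∷ []) m e (suc (suc zero)) | p , e₁ | q , r =
      embedsAt-sound (suc (suc zero)) zs m r

    spread : ∀ v → Lives v → ∀ i → Lives (nb v i)
    spread v (β , m , refl) i with spin-covers (β 0) (v , i) refl
    ... | k , eq = subst (λ d → Lives (proj₁ (flip d))) eq
      (CheckSound.run-sound lens K known nothing (neighbours T) (β 0) _ (λ _ ())
        (λ xss m′ root e k → subst (λ d → Lives (proj₁ (flip (spin k d)))) root (neighbours-sound xss m′ e k))
        c m refl checked k)

    everywhere : ∀ {ok u v} → Reach nb ok u v → Lives u → Lives v
    everywhere here         l = l
    everywhere (step i _ r) l = everywhere r (spread _ l i)

    allHex : ∀ {β} → β ⊨ T → ∀ k → HasLen hex (spin k (β 0))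
    allHex m k with both {hasSize T hex (0 , zero)} hexagons
    ... | p , e₁ with both {hasSize T hex (0 , suc zero)} e₁
    allHex m zero             | p , e₁ | q , r = size-sound m hex (0 , zero) p
    allHex m (suc zero)       | p , e₁ | q , r = size-sound m hex (0 , suc zero) q
    allHex m (suc (suc zero)) | p , e₁ | q , r = size-sound m hex (0 , suc (suc zero)) r

    impossible : ∀ β → ¬ β ⊨ T
    impossible β m with face-surj (Fullerene.pentagons F zero)
    ... | d , fd with everywhere (connected (proj₁ (β 0)) (proj₁ d)) (β , m , refl)
    ... | γ , m′ , root with spin-covers (γ 0) d root
    ... | k , refl = pent≢hex
      (hasLen (subst (λ f → FaceLength G f 5) (sym fd) (Fullerene.pentagons-pent F zero))) (allHex m′ k)

  known₀ : FactsHold facts₀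
  known₀ = record { edgeHolds = λ () ; apartHolds = λ () ; deadHolds = [] }

  known₁ : FactsHold facts₁
  known₁ = record { edgeHolds = λ () ; apartHolds = λ () ; deadHolds =
    Tube.impossible facts₀ known₀ tube₂₀ tube₂₀-cert refl refl ∷
    Tube.impossible facts₀ known₀ tube₁₁ tube₁₁-cert refl refl ∷ [] }

  edgeUnique : EdgeUnique
  edgeUnique x y fx fy with someLen x | someLen (flip x)
  ... | L , hL | K , hK with on-face hL fx | on-face hK fy
  ... | zero , _ , eq | _ = eq
  ... | suc j , _ , _ | zero , _ , eq = trans (sym (flip² x)) (trans (cong flip eq) (flip² y))
  ... | suc j , j< , eq | suc p , p< , eq′ = ⊥-elim (bad (path-sound L (just K ∷ []) x hL (hK , tt)))
    where
    pred< : ∀ L {j} → suc j < length5or6 L → j < length5or6 L ∸ 1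
    pred< pent (s≤s l) = l
    pred< hex  (s≤s l) = l
    -- The equation for `flip y` ends in a `turn` from the last `next`; two further turns cancel it
    -- and leave the form in which the exploration glues.
    glued : Supposed (hyp p (suc j) nothing) x
    glued = trans (sym (turn³ _)) (cong (λ d → turn (turn d)) (trans eq′ (cong flip (sym eq))))
    bad : (∃[ γ ] γ ⊨ path L (just K ∷ []) × γ 0 ≡ x) → ⊥
    bad (γ , m , root) = refutes-sound facts₁ known₁ (hyp p (suc j) nothing) (edgeCert L K j p) m root glued
      (below-sound (length5or6 K ∸ 1) _ (below-sound (length5or6 L ∸ 1) _ (edgesChecked L K) (pred< L j<)) (pred< K p<))

  known₂ : FactsHold facts₂
  known₂ = record { edgeHolds = λ _ → edgeUnique ; apartHolds = λ () ; deadHolds = [] }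

  known₃ : FactsHold facts₃
  known₃ = record { edgeHolds = λ _ → edgeUnique ; apartHolds = λ () ; deadHolds =
    Tube.impossible facts₂ known₂ tube₃₀ tube₃₀-cert refl refl ∷
    Tube.impossible facts₂ known₂ tube₁₂ tube₁₂-cert refl refl ∷
    Tube.impossible facts₂ known₂ tube₂₁ tube₂₁-cert refl refl ∷ [] }

  -- Such a `c` would be an edge between the faces across two edges of a third face. Crossing these
  -- three edges gives a closed dual curve of length three.
  NoCut : D → ℕ → Set
  NoCut x j = ∀ c → face c ≡ face (flip x) → face (flip c) ≡ face (flip (iter next j x)) → ⊥

  cut-checked : ∀ L j → j ≡ 2 ⊎ j ≡ 3 → (∀ K M → cutCheck L j K M ≡ true) → ∀ x → HasLen L x → NoCut x j
  cut-checked L j j∈ checks x hL c fc fc′ with someLen (flip x) | someLen (flip (iter next j x))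
  ... | K , hK | M , hM with on-face hK (sym fc) | on-face hM (sym fc′)
  ... | p , p< , eq | q , q< , eq′ = bad (path-sound L (cutMarks j K M) x hL (marks j j∈ hM))
    where
    marks : ∀ j → j ≡ 2 ⊎ j ≡ 3 → HasLen M (flip (iter next j x)) → MarksHold (cutMarks j K M) x
    marks _ (inj₁ refl) h = hK , tt , h , tt
    marks _ (inj₂ refl) h = hK , tt , tt , h , tt
    bad : (∃[ γ ] γ ⊨ path L (cutMarks j K M) × γ 0 ≡ x) → ⊥
    bad (γ , m , root) = refutes-sound facts₃ known₃ (hyp p j (just q)) (cutCert L j K M p q) m root
      (trans (cong flip eq) (sym eq′))
      (below-sound (length5or6 M) _ (below-sound (length5or6 K) _ (checks K M) p<) q<)

  noCut : ∀ x j → j ≡ 2 ⊎ j ≡ 3 → NoCut x j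
  noCut x j j∈ with lens x
  noCut x _ (inj₁ refl) | inj₁ h = cut-checked pent 2 (inj₁ refl) cuts₅₂ x h
  noCut x _ (inj₁ refl) | inj₂ h = cut-checked hex 2 (inj₁ refl) cuts₆₂ x h
  noCut x _ (inj₂ refl) | inj₂ h = cut-checked hex 3 (inj₂ refl) cuts₆₃ x h
  -- Three steps forward on a pentagon are two steps back, so the two edges change roles and `c` is
  -- reversed.
  noCut x _ (inj₂ refl) | inj₁ h = λ c fc fc′ →
    cut-checked pent 2 (inj₁ refl) cuts₅₂ (iter next 3 x) (HasLen-face (sym (face-iter 3 x)) h) (flip c) fc′
      (trans (cong face (flip² c)) (trans fc (cong (λ d → face (flip d)) (sym (period h)))))

  -- At a cubic vertex any two of the three faces share an edge. Hence a common vertex of the two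
  -- faces gives an edge between them, against `noCut`, unless they are the same face; that face
  -- would have two edges in common with the face of `x`, against `edgeUnique`.
  apartFaces : ApartFaces
  apartFaces x j j∈ d e v fd fe with spin-covers d e v
  ... | suc zero , refl = noCut x j j∈ d fd (trans (face-flip d) fe)
  ... | suc (suc zero) , refl = noCut x j j∈ (flip e) (trans (face-flip e) (trans (cong face (turn³ d)) fd))
    (trans (cong face (flip² e)) fe)
  ... | zero , refl with someLen x
  ... | L , h = minimal h j (proj₁ (small L j∈)) (proj₂ (small L j∈))
    (sym (edgeUnique x (iter next j x) (sym (face-iter j x)) (trans (sym fd) fe)))
    where
    small : ∀ L → j ≡ 2 ⊎ j ≡ 3 → 0 < j × j < length5or6 L
    small pent (inj₁ refl) = z<s , s<s (s<s z<s)
    small hex  (inj₁ refl) = z<s , s<s (s<s z<s)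
    small pent (inj₂ refl) = z<s , s<s (s<s (s<s z<s))
    small hex  (inj₂ refl) = z<s , s<s (s<s (s<s z<s))

  known₄ : FactsHold facts₄
  known₄ = record { edgeHolds = λ _ → edgeUnique ; apartHolds = λ _ → apartFaces ; deadHolds = [] }

-- Resonant patterns

module Matchings (F : Fullerene) (resonant : KResonant (Fullerene.graph F) 3) where
  open Local F
  open PlaneCubicGraph G using (n; nb; face)
  open Darts G
  open Models G
  open Reading G

  module Fixed (M : PerfectMatching G) where

    InM-flip : ∀ d → InM G M d → InM G M (flip d)
    InM-flip (v , i) refl = proj₂ M v

    InM-unique : ∀ d e → proj₁ d ≡ proj₁ e → InM G M d → InM G M e → d ≡ e
    InM-unique (v , i) (.v , j) refl refl refl = refl

    ¬InM-turn : ∀ d → InM G M d → ¬ InM G M (turn d)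
    ¬InM-turn d p q = turn≢ d (sym (InM-unique d (turn d) refl p q))

    ¬InM-turn² : ∀ d → InM G M d → ¬ InM G M (turn (turn d))
    ¬InM-turn² d p q = ¬InM-turn (turn (turn d)) q (subst (InM G M) (sym (turn³ d)) p)

    -- The dart before `d` on the hexagon is `iter next 5 d`. By alternation, it or `d` is matched,
    -- and both edges end at the tail of `d`, so the third edge there is free.
    outward-unmatched : ∀ d → HasLen hex d → Alternating G M (face d) → ¬ InM G M (turn d)
    outward-unmatched d h alt with proj₁ (alt (iter next 5 d) (face-iter 5 d))
    ... | inj₁ p = λ q → ¬InM-turn² (turn (turn d)) (subst (InM G M) (previous h) (InM-flip _ p))
                     (subst (InM G M) (cong turn (sym (turn³ d))) q)
    ... | inj₂ p = ¬InM-turn d (subst (InM G M) (period h) p)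

    module _ {t : Table} {β : ℕ → D} (m : β ⊨ t) where
      open Match t

      Excluded : List Slot → Set
      Excluded = All (λ x → ¬ InM G M (at β x))

      member-sound : ∀ x X → Excluded X → member x X ≡ true → ¬ InM G M (at β x)
      member-sound x (y ∷ X) (p ∷ ps) e with either e
      ... | inj₂ q = member-sound x X ps q
      ... | inj₁ q with ==-sound y x q
      ... | refl = p

      exclude-sound : ∀ x {X} → ¬ InM G M (at β x) → Excluded X → Excluded (exclude x X)
      exclude-sound x p ps with link (lookup t x) in l
      ... | nothing = p ∷ ps
      ... | just y  = p ∷ (λ q → p (subst (InM G M) (trans (cong flip (sym (links m x l))) (flip² _)) (InM-flip _ q))) ∷ ps

      excludeOthers-sound : ∀ x {X} → InM G M (at β x) → Excluded X → Excluded (excludeOthers x X)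
      excludeOthers-sound x p ps =
        exclude-sound (rotate x) (λ q → ¬InM-turn _ p (subst (InM G M) (at-rotate β x) q))
          (exclude-sound (unrotate x) (λ q → ¬InM-turn² _ p (subst (InM G M) (at-unrotate β x) q)) ps)

      choose-sound : ∀ x {X} → InM G M (at β x) → Excluded X → Excluded (choose x X)
      choose-sound x p ps with link (lookup t x) in l
      ... | nothing = excludeOthers-sound x p ps
      ... | just y  = excludeOthers-sound x p (excludeOthers-sound y (subst (InM G M) (links m x l) (InM-flip _ p)) ps)

      refute-sound : ∀ X vs → Excluded X → refute X vs ≢ true
      option-sound : ∀ X vs x → Excluded X → option X vs x ≡ true → ¬ InM G M (at β x)
      option-sound X vs x ps e p with either {member x X} e
      ... | inj₁ q = member-sound x X ps q p
      ... | inj₂ q = refute-sound (choose x X) vs (choose-sound x p ps) q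
      refute-sound X (v ∷ vs) ps e with spin-covers (β v) (proj₁ (β v) , proj₁ M (proj₁ (β v))) refl
      ... | k , eq = all k (subst (InM G M) (sym eq) refl)
        where
        parts = both {option X vs (v , zero)} e
        parts′ = both {option X vs (v , suc zero)} (proj₂ parts)
        all : ∀ k → ¬ InM G M (spin k (β v))
        all zero             = option-sound X vs (v , zero) ps (proj₁ parts)
        all (suc zero)       = option-sound X vs (v , suc zero) ps (proj₁ parts′)
        all (suc (suc zero)) = option-sound X vs (v , suc (suc zero)) ps (proj₂ parts′)

      outward-sound : ∀ k x {X} → HasLen hex (at β x) → Alternating G M (face (at β x)) →
        Excluded X → Excluded (outward k x X)
      outward-sound zero    x h alt ps = ps
      outward-sound (suc k) x h alt ps with link (lookup t x) in l
      ... | nothing = ps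
      ... | just y  = exclude-sound (rotate x) (λ q → outward-unmatched _ h alt (subst (InM G M) (at-rotate β x) q))
          (outward-sound k (rotate y) (HasLen-face same h) (subst (Alternating G M) same alt) ps)
        where
        same : face (at β x) ≡ face (at β (rotate y))
        same = trans (sym (face-next _)) (cong face (sym (links-next m x l)))

      hexagons-sound : ∀ hs → hexagons hs ≡ true → All (λ h → HasLen hex (at β h)) hs
      hexagons-sound []       e = []
      hexagons-sound (h ∷ hs) e with both {hasSize t hex h} e
      ... | p , q = size-sound m hex h p ∷ hexagons-sound hs q

      outwards-sound : ∀ hs → All (λ h → HasLen hex (at β h)) hs →
        All (Alternating G M) (map (λ h → face (at β h)) hs) → Excluded (outwards hs)
      outwards-sound []       []       []         = []
      outwards-sound (h ∷ hs) (p ∷ ps) (alt ∷ as) = outward-sound 6 h p alt (outwards-sound hs ps as)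

  module _ {t : Table} {β : ℕ → D} (m : β ⊨ t) where
    open Match t

    faceOf : Slot → Fin (PlaneCubicGraph.nf G)
    faceOf h = face (at β h)

    infeasible : ∀ H → length H < 4 → hexagons H ≡ true → AllPairs (VertexDisjoint G) (map faceOf H) →
      ∀ vs → refute (outwards H) vs ≢ true
    infeasible H short hexes disjoint vs e with resonant (map faceOf H)
      (subst (_≤ 3) (sym (length-map faceOf H)) (≤-pred short)) (hexFaces H hexes) disjoint
      where
      hexFaces : ∀ H → hexagons H ≡ true → All (IsHexagon G) (map faceOf H)
      hexFaces []       e = []
      hexFaces (h ∷ hs) e with both {hasSize t hex h} e
      ... | p , q = lengthOf (size-sound m hex h p) ∷ hexFaces hs q
    ... | M , alternating = refute-sound m (outwards H) vs
            (outwards-sound m H (hexagons-sound m H hexes) alternating) e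
      where open Fixed M

    across-sound : ∀ x k a → across x k a ≡ true → faceOf a ≡ face (flip (iter next k (at β x)))
    across-sound x k a e with steps-sound m k x e
    ... | y , y≡ , p with onLink-sound t y p
    ... | z , l , q = trans (sym (onFace-sound m a z q)) (trans (cong face (sym (links m y l))) (cong (λ d → face (flip d)) y≡))

    disjoint-sym : ∀ {f g} → VertexDisjoint G f g → VertexDisjoint G g f
    disjoint-sym d v p q = d v q p

    sepAt-sound : ∀ j → j ≡ 2 ⊎ j ≡ 3 → ∀ x a b → sepAt j x a b ≡ true → VertexDisjoint G (faceOf a) (faceOf b)
    sepAt-sound j j∈ x a b e = rest (either {across x 0 a ∧ across x j b} e)
      where
      across-disjoint : ∀ a b → across x 0 a ≡ true × across x j b ≡ true → VertexDisjoint G (faceOf a) (faceOf b)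
      across-disjoint a b (p , q) v (i , fi) (k , fk) = apartFaces (at β x) j j∈ (v , i) (v , k) refl
        (trans fi (across-sound x 0 a p)) (trans fk (across-sound x j b q))
      rest : _ → VertexDisjoint G (faceOf a) (faceOf b)
      rest (inj₁ p) = across-disjoint a b (both {across x 0 a} p)
      rest (inj₂ p) = disjoint-sym (across-disjoint b a (both {across x 0 b} p))

    sep-sound : ∀ c a b → sep c a b ≡ true → VertexDisjoint G (faceOf a) (faceOf b)
    sep-sound c a b e with c % 2 ≡ᵇ 0
    ... | true  = sepAt-sound 2 (inj₁ refl) (slot (c / 2)) a b e
    ... | false = sepAt-sound 3 (inj₂ refl) (slot (c / 2)) a b e

    separate-sound : ∀ hs cs → separate hs cs ≡ true → AllPairs (VertexDisjoint G) (map faceOf hs)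
    against-sound  : ∀ h hs rest cs → against h hs rest cs ≡ true →
      All (VertexDisjoint G (faceOf h)) (map faceOf hs) × AllPairs (VertexDisjoint G) (map faceOf rest)
    separate-sound []       cs e = []
    separate-sound (h ∷ hs) cs e with against-sound h hs hs cs e
    ... | p , q = p ∷ q
    against-sound h []        rest cs       e = [] , separate-sound rest cs e
    against-sound h (h′ ∷ hs) rest (c ∷ cs) e with both {sep c h h′} e
    ... | p , q with against-sound h hs rest cs q
    ... | r , s = sep-sound c h h′ p ∷ r , s

    matchOK-sound : ∀ H vs cs → matchOK H vs cs ≢ true
    matchOK-sound H vs cs e with both {length H <ᵇ 4} e
    ... | p , e₁ with both {hexagons H} e₁
    ... | q , e₂ with both {separate H cs} e₂
    ... | r , s = infeasible H (<ᵇ-sound p) q (separate-sound H cs r) vs s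

    module _ (clash : List Bool → Slot → Slot → Bool) (edge : Fin 6 → Fin 6 → Bool) where
      open LeafCheck t clash edge

      spoke-sound : ∀ x {p} → spoke x p ≡ true → ∃[ a ] ∃[ y ] p a y ≡ true
      spoke-sound x e with onLink-sound t x e
      ... | y , _ , q with onLink-sound t (unrotate y) q
      ... | z , _ , r = unrotate y , z , r

      starOK-sound : ∀ v → starOK v ≢ true
      starOK-sound v e with spoke-sound (v , zero) e
      ... | a , x , e₁ with spoke-sound (v , suc zero) e₁
      ... | b , y , e₂ with spoke-sound (v , suc (suc zero)) e₂
      ... | c , z , e₃ with both {hexagons (a ∷ b ∷ c ∷ [])} e₃
      ... | h , e₄ with both {sepAt 3 x a b} e₄
      ... | p , e₅ with both {sepAt 3 y b c} e₅
      ... | q , e₆ with both {sepAt 3 z c a} e₆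
      ... | r , s = infeasible (a ∷ b ∷ c ∷ []) (s<s (s<s (s<s z<s))) h
        ((sepAt-sound 3 (inj₂ refl) x a b p ∷ disjoint-sym (sepAt-sound 3 (inj₂ refl) z c a r) ∷ []) ∷
         (sepAt-sound 3 (inj₂ refl) y b c q ∷ []) ∷ [] ∷ []) (v ∷ []) s

-- The boundary of a region

-- `IsFragment` speaks of consecutive indices through remainders. Here they become a permutation
-- `succ` with inverse `pred`, because the cycle may run either way with respect to the rotation.
module Cyclic (N-1 : ℕ) where
  N : ℕ
  N = suc N-1

  succ : Fin N → Fin N
  succ j = fromℕ< (m%n<n (suc (toℕ j)) N)

  toℕ-succ : ∀ j → toℕ (succ j) ≡ suc (toℕ j) % N
  toℕ-succ j = toℕ-fromℕ< _

  succ-unique : ∀ {j k} → suc (toℕ j) % N ≡ toℕ k → succ j ≡ k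
  succ-unique {j} e = toℕ-injective (trans (toℕ-succ j) e)

  suc-% : ∀ a → suc (a % N) % N ≡ suc a % N
  suc-% a = trans (%-distribˡ-+ 1 (a % N) N)
    (trans (cong (λ b → (1 % N + b) % N) (m%n%n≡m%n a N)) (sym (%-distribˡ-+ 1 a N)))

  toℕ-iter : ∀ k j → toℕ (iter succ k j) ≡ (k + toℕ j) % N
  toℕ-iter zero    j = sym (m<n⇒m%n≡m (toℕ<n j))
  toℕ-iter (suc k) j = trans (toℕ-succ _) (trans (cong (λ a → suc a % N) (toℕ-iter k j)) (suc-% (k + toℕ j)))

  iter-N : ∀ j → iter succ N j ≡ j
  iter-N j = toℕ-injective (trans (toℕ-iter N j)
    (trans (cong (_% N) (ℕₚ.+-comm N (toℕ j))) (trans ([m+n]%n≡m%n (toℕ j) N) (m<n⇒m%n≡m (toℕ<n j)))))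

  succ-transitive : ∀ i j → ∃[ k ] iter succ k i ≡ j
  -- `N ∸ toℕ i` steps bring `i` round to index zero, and `toℕ j` more lead to `j`.
  succ-transitive i j = toℕ j + (N ∸ toℕ i) , toℕ-injective (trans (toℕ-iter (toℕ j + (N ∸ toℕ i)) i) (begin
    (toℕ j + (N ∸ toℕ i) + toℕ i) % N   ≡⟨ cong (_% N) (ℕₚ.+-assoc (toℕ j) _ _) ⟩
    (toℕ j + (N ∸ toℕ i + toℕ i)) % N   ≡⟨ cong (λ a → (toℕ j + a) % N) (ℕₚ.m∸n+n≡m (ℕₚ.<⇒≤ (toℕ<n i))) ⟩
    (toℕ j + N) % N                     ≡⟨ [m+n]%n≡m%n (toℕ j) N ⟩
    toℕ j % N                           ≡⟨ m<n⇒m%n≡m (toℕ<n j) ⟩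
    toℕ j                               ∎))
    where open ≡-Reasoning

  abstract
    pred : Fin N → Fin N
    pred = iter succ N-1

    succ-pred : ∀ j → succ (pred j) ≡ j
    succ-pred = iter-N

    pred-succ : ∀ j → pred (succ j) ≡ j
    pred-succ j = trans (sym (iter-suc succ N-1 j)) (iter-N j)

    pred-iter : ∀ k j → iter pred k (iter succ k j) ≡ j
    pred-iter zero    j = refl
    pred-iter (suc k) j = trans (iter-suc pred k _) (trans (cong (iter pred k) (pred-succ _)) (pred-iter k j))

    pred-transitive : ∀ i j → ∃[ k ] iter pred k i ≡ j
    pred-transitive i j with succ-transitive j i
    ... | k , refl = k , pred-iter k j

module Region (F : Fullerene) (S : Fin (PlaneCubicGraph.nf (Fullerene.graph F)) → Set)
  (maximal : IsMaximalPentagonalFragment (Fullerene.graph F) S) where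
  open Local F
  open PlaneCubicGraph G using (n; nb; nf; face; face-surj; connected)
  open Darts G

  -- Maximality shows only that a pentagon next to a face of `S` cannot fail to lie in `S`. As `S`
  -- is an arbitrary predicate, the exploration carries this double negation.
  Inside : D → Set
  Inside d = ¬ ¬ S (face d)

  inside-face : ∀ {d e} → face d ≡ face e → Inside d → Inside e
  inside-face p i ¬s = i (λ s → ¬s (subst S p s))

  hex-outside : ∀ {d} → HasLen hex d → ¬ S (face d)
  hex-outside h s = pent≢hex (hasLen (proj₂ (proj₁ maximal) _ s)) h

  inside-pent : ∀ {d} → Inside d → HasLen pent d
  inside-pent {d} i with lens d
  ... | inj₁ p = p
  ... | inj₂ h = ⊥-elim (i (hex-outside h))

  inside-flip : ∀ {d} → Inside d → HasLen pent (flip d) → Inside (flip d)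
  inside-flip {d} i p ¬s = i (λ s → pent≢hex p (hasLen (proj₂ maximal _ _ s ¬s (d , refl , refl))))

  Boundary : D → Set
  Boundary d = Inside d × HasLen hex (flip d)

  abstract
    -- Three faces meet at the head of a boundary dart `d`: its own, the hexagon across `d`, and the
    -- face across `next d`. If the last is a pentagon it belongs to the region, and `turn (next d)`
    -- separates it from the same hexagon; so a single turn is always enough.
    along-boundary : D → D
    along-boundary d = Sum.[ (λ _ → turn (next d)) , (λ _ → next d) ] (lens (flip (next d)))

    along-cases : ∀ d → HasLen hex (flip (next d)) × along-boundary d ≡ next d ⊎
                        HasLen pent (flip (next d)) × along-boundary d ≡ turn (next d)
    along-cases d with lens (flip (next d))
    ... | inj₁ p = inj₂ (p , refl)
    ... | inj₂ h = inj₁ (h , refl)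

  along-hex : ∀ {d} → HasLen hex (flip (next d)) → along-boundary d ≡ next d
  along-hex {d} h with along-cases d
  ... | inj₁ (_ , e) = e
  ... | inj₂ (p , _) = ⊥-elim (pent≢hex p h)

  along-pent : ∀ {d} → HasLen pent (flip (next d)) → along-boundary d ≡ turn (next d)
  along-pent {d} p with along-cases d
  ... | inj₁ (h , _) = ⊥-elim (pent≢hex p h)
  ... | inj₂ (_ , e) = e

  along-turns : ∀ d → along-boundary d ≢ flip d
  along-turns d e′ with along-cases d
  ... | inj₁ (_ , e) = turn≢ (flip d) (trans (sym e) e′)
  ... | inj₂ (_ , e) = turn≢ (flip d) (trans (cong turn (trans (sym e′) e)) (turn³ (flip d)))

  along-tail : ∀ d → proj₁ (along-boundary d) ≡ proj₁ (flip d)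
  along-tail d with along-cases d
  ... | inj₁ (_ , e) = cong proj₁ e
  ... | inj₂ (_ , e) = cong proj₁ e

  boundary-along : ∀ {d} → Boundary d → Boundary (along-boundary d)
  boundary-along {d} (i , h) with along-cases d
  ... | inj₁ (q , e) = subst Boundary (sym e) (inside-face (sym (face-next d)) i , q)
  ... | inj₂ (p , e) = subst Boundary (sym e)
    (inside-face (face-flip (next d)) (inside-flip (inside-face (sym (face-next d)) i) p) ,
     HasLen-face (sym (trans (face-flip (turn (next d))) (cong face (turn³ (flip d))))) h)

  boundary-iter : ∀ k {d} → Boundary d → Boundary (iter along-boundary k d)
  boundary-iter zero    b = b
  boundary-iter (suc k) b = boundary-along (boundary-iter k b)

  fragment : IsFragment G S
  fragment = proj₁ (proj₁ maximal)

  open Cyclic (2 + proj₁ fragment)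

  cycle : Fin N → Fin n
  cycle = proj₁ (proj₂ fragment)

  cycle-injective : ∀ i j → cycle i ≡ cycle j → i ≡ j
  cycle-injective = proj₁ (proj₂ (proj₂ fragment))

  OnCycle : D → Set
  OnCycle d = ∃ λ j → ∃ λ j′ → (suc (toℕ j) % N ≡ toℕ j′) ×
    (((cycle j ≡ proj₁ d) × (cycle j′ ≡ proj₁ (flip d))) ⊎ ((cycle j′ ≡ proj₁ d) × (cycle j ≡ proj₁ (flip d))))

  abstract
    onCycle? : ∀ d → Dec (OnCycle d)
    onCycle? d = any? λ j → any? λ j′ → (suc (toℕ j) % N ℕₚ.≟ toℕ j′) ×-dec
      (((cycle j ≟ proj₁ d) ×-dec (cycle j′ ≟ proj₁ (flip d))) ⊎-dec ((cycle j′ ≟ proj₁ d) ×-dec (cycle j ≟ proj₁ (flip d))))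

    -- Lying on the cycle is decidable, hence stable under double negation. Going through the cycle
    -- and back, `boundary-inside` turns `Inside` into membership in `S`.
    boundary-onCycle : ∀ {d} → Boundary d → OnCycle d
    boundary-onCycle {d} (i , h) = decidable-stable (onCycle? d) (λ ¬c → i (λ s →
      ¬c (Equivalence.from (proj₂ (proj₂ (proj₂ (proj₂ fragment))) d) (inj₁ (s , hex-outside h)))))

    boundary-inside : ∀ {d} → Boundary d → S (face d)
    boundary-inside {d} b@(i , h) with Equivalence.to (proj₂ (proj₂ (proj₂ (proj₂ fragment))) d) (boundary-onCycle b)
    ... | inj₁ (s , _) = s
    ... | inj₂ (_ , s) = ⊥-elim (hex-outside h s)

  -- `ν` is the direction, `succ` or `pred`, in which the cycle passes along a chosen boundary dart.
  -- The boundary walk from this dart then keeps step with `ν`, so the transitivity of `ν` becomes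
  -- that of the walk.
  module Oriented (ν : Fin N → Fin N) (ν-injective : ∀ {i j} → ν i ≡ ν j → i ≡ j)
    (ν-transitive : ∀ i j → ∃[ k ] iter ν k i ≡ j)
    (edges : ∀ {d} → Boundary d → ∃[ j ] ((cycle j ≡ proj₁ d × cycle (ν j) ≡ proj₁ (flip d)) ⊎
                                           (cycle (ν j) ≡ proj₁ d × cycle j ≡ proj₁ (flip d)))) where

    Forward : D → Fin N → Set
    Forward d j = cycle j ≡ proj₁ d × cycle (ν j) ≡ proj₁ (flip d)

    forward-along : ∀ {d j} → Boundary d → Forward d j → Forward (along-boundary d) (ν j)
    forward-along {d} {j} b (t , h) with edges (boundary-along b)
    ... | k , inj₁ (t′ , h′) with cycle-injective k (ν j) (trans t′ (trans (along-tail d) (sym h)))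
    ... | refl = t′ , h′
    -- A backward edge would end where `d` begins and thus be `flip d`, but the walk never turns
    -- back on its own edge.
    forward-along {d} {j} b (t , h) | k , inj₂ (t′ , h′)
      with ν-injective (cycle-injective (ν k) (ν j) (trans t′ (trans (along-tail d) (sym h))))
    ... | refl = ⊥-elim (along-turns d (same-ends _ _ (along-tail d)
          (trans (sym h′) (trans t (cong proj₁ (sym (flip² d)))))))

    forward-iter : ∀ k {d j} → Boundary d → Forward d j → Forward (iter along-boundary k d) (iter ν k j)
    forward-iter zero    b f = f
    forward-iter (suc k) b f = forward-along (boundary-iter k b) (forward-iter k b f)

    orbit : ∀ {d e j} → Boundary d → Forward d j → Boundary e → ∃[ k ] iter along-boundary k d ≡ e
    orbit {d} {e} {j} b f b′ with edges b′
    ... | i , inj₁ (t , h) with ν-transitive j i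
    ... | k , refl with forward-iter k b f
    ... | t′ , h′ = k , same-ends _ _ (trans (sym t′) t) (trans (sym h′) h)
    -- If `e` ran backward, the walk would arrive at `flip e` and so put the hexagon across `e` into
    -- the region.
    orbit {d} {e} {j} b f b′ | i , inj₂ (t , h) with ν-transitive j i
    ... | k , refl with forward-iter k b f
    ... | t′ , h′ = ⊥-elim (proj₁ (boundary-iter k b)
      (λ s → hex-outside (proj₂ b′) (subst (λ x → S (face x))
        (same-ends _ (flip e) (trans (sym t′) h) (trans (sym h′) (trans t (cong proj₁ (sym (flip² e)))))) s)))

  abstract
    succ-edges : ∀ {d} → Boundary d → ∃[ j ] ((cycle j ≡ proj₁ d × cycle (succ j) ≡ proj₁ (flip d)) ⊎
                                              (cycle (succ j) ≡ proj₁ d × cycle j ≡ proj₁ (flip d)))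
    succ-edges b with boundary-onCycle b
    ... | j , j′ , e , ends with succ-unique {j} {j′} e
    ... | refl = j , ends

    pred-edges : ∀ {d} → Boundary d → ∃[ j ] ((cycle j ≡ proj₁ d × cycle (pred j) ≡ proj₁ (flip d)) ⊎
                                              (cycle (pred j) ≡ proj₁ d × cycle j ≡ proj₁ (flip d)))
    pred-edges b with succ-edges b
    ... | j , inj₁ (t , h) = succ j , inj₂ (trans (cong cycle (pred-succ j)) t , h)
    ... | j , inj₂ (t , h) = succ j , inj₁ (t , trans (cong cycle (pred-succ j)) h)

    -- This exploits that a fragment is bounded by one cycle: two boundary components would give two
    -- orbits on it. The direction is chosen to suit `d`.
    one-boundary : ∀ {d e} → Boundary d → Boundary e → ∃[ k ] iter along-boundary k d ≡ e
    one-boundary b b′ with succ-edges b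
    ... | j , inj₁ f = Oriented.orbit succ (λ {i} {k} e → trans (sym (pred-succ i)) (trans (cong pred e) (pred-succ k)))
                         succ-transitive succ-edges b f b′
    ... | j , inj₂ (t , h) = Oriented.orbit pred (λ {i} {k} e → trans (sym (succ-pred i)) (trans (cong succ e) (succ-pred k)))
                         pred-transitive pred-edges {j = succ j} b (t , trans (cong cycle (pred-succ j)) h) b′

    some-boundary : ∃[ d ] Boundary d
    some-boundary with proj₁ (proj₂ (proj₂ (proj₂ fragment))) zero (succ zero) (sym (toℕ-succ zero))
    ... | i , eq with Equivalence.to (proj₂ (proj₂ (proj₂ (proj₂ fragment))) (cycle zero , i))
                        (zero , succ zero , sym (toℕ-succ zero) , inj₁ (refl , sym eq))
    ... | inj₁ (s , ¬s) = (cycle zero , i) , (λ ¬t → ¬t s) , hasLen (proj₂ maximal _ _ s ¬s (_ , refl , refl))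
    ... | inj₂ (¬s , s) = flip d , (λ ¬t → ¬t s) ,
        hasLen (proj₂ maximal _ _ s (λ t → ¬s (subst (λ x → S (face x)) (flip² d) t)) (flip d , refl , refl))
      where
      d : D
      d = cycle zero , i

  -- A family of faces that can be left only into hexagons and meets the boundary exhausts the
  -- region. A missed face cannot border a hexagon, since that edge would be on the boundary walk
  -- from the root, and the walk stays in the family. Its neighbours are therefore pentagons of the
  -- region, and they are missed too, as `T` is closed. By connectedness of `G` the missed faces
  -- would reach the root.
  module Component {k : ℕ} (T : Fin k → Fin nf)
    (closed : ∀ i d → face d ≡ T i → HasLen hex (flip d) ⊎ ∃[ j ] face (flip d) ≡ T j)
    (root : ∃[ d ] Boundary d × ∃[ i ] face d ≡ T i) where

    In : D → Set
    In d = ∃[ i ] face d ≡ T i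

    in-along : ∀ {d} → In d → In (along-boundary d)
    in-along {d} (i , e) with along-cases d
    ... | inj₁ (_ , eq) = i , trans (cong face eq) (trans (face-next d) e)
    ... | inj₂ (p , eq) with closed i (next d) (trans (face-next d) e)
    ... | inj₁ h       = ⊥-elim (pent≢hex p h)
    ... | inj₂ (j , q) = j , trans (cong face eq) (trans (sym (face-flip (next d))) q)

    in-iter : ∀ k {d} → In d → In (iter along-boundary k d)
    in-iter zero    p = p
    in-iter (suc k) p = in-along (in-iter k p)

    Missed : D → Set
    Missed d = Inside d × ¬ In d

    missed-face : ∀ {d e} → face d ≡ face e → Missed d → Missed e
    missed-face p (i , ¬t) = inside-face p i , λ { (j , q) → ¬t (j , trans p q) }

    missed-flip : ∀ {d} → Missed d → Missed (flip d)
    missed-flip {d} (i , ¬t) with lens (flip d)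
    ... | inj₂ h with one-boundary (proj₁ (proj₂ root)) (i , h)
    ... | m , refl = ⊥-elim (¬t (in-iter m (proj₂ (proj₂ root))))
    missed-flip {d} (i , ¬t) | inj₁ p = inside-flip i p , λ { (j , q) → back (closed j (flip d) q) }
      where
      back : HasLen hex (flip (flip d)) ⊎ ∃[ l ] face (flip (flip d)) ≡ T l → ⊥
      back (inj₁ h) = pent≢hex (inside-pent i) (subst (HasLen hex) (flip² d) h)
      back (inj₂ (l , q)) = ¬t (l , trans (cong face (sym (flip² d))) q)

    missed-turn : ∀ {d} → Missed d → Missed (turn d)
    missed-turn {d} m = missed-face (face-flip d) (missed-flip m)

    missed-spin : ∀ i {d} → Missed d → Missed (spin i d)
    missed-spin zero             m = m
    missed-spin (suc zero)       m = missed-turn m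
    missed-spin (suc (suc zero)) m = missed-turn (missed-turn m)

    missed-everywhere : ∀ {ok u v} → Reach nb ok u v → ∀ i → Missed (u , i) → ∃[ j ] Missed (v , j)
    missed-everywhere here         i m = i , m
    missed-everywhere (step {u} j _ r) i m with spin-covers (u , i) (u , j) refl
    ... | k , eq = missed-everywhere r _ (missed-flip (subst Missed eq (missed-spin k m)))

    abstract
      complete : ∀ g → S g → ∃[ i ] T i ≡ g
      complete g s with any? (λ i → T i ≟ g)
      ... | yes t = t
      ... | no ¬t with face-surj g
      ... | (v , i) , refl with missed-everywhere (connected v (proj₁ (proj₁ root))) i
            ((λ ¬s → ¬s s) , λ { (j , q) → ¬t (j , sym q) })
      ... | j , m with spin-covers (proj₁ (proj₁ root) , j) (proj₁ root) refl
      ... | k , eq = ⊥-elim (proj₂ (subst Missed eq (missed-spin k m)) (proj₂ (proj₂ root)))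
  

-- The exploration around the boundary

-- The splits at 0, 3 and 6 merely complete the root pentagon, the hexagon and the next pentagon,
-- whose lengths the initial table records; hence the `none` in their other branches. The real
-- distinctions begin at 12.
mainCert : Cert Leaf
mainCert = split 0 (split 3 none (split 6 (split 12 (split 33 (split 15 (split 42 (split 36 (split 45 (split 18
  (split 60 (split 21 (apart 1) (apart 1)) (leaf (match (1 ∷ 50 ∷ []) (9 ∷ 2 ∷ 4 ∷ 15 ∷ []) (37 ∷ [])))) (split 60
  (split 63 (apart 12) (split 20 (apart 1) (contra 20))) (leaf (match (1 ∷ 50 ∷ []) (9 ∷ 2 ∷ 4 ∷ 15 ∷ []) (37 ∷
  []))))) (leaf (match (1 ∷ 38 ∷ []) (4 ∷ 2 ∷ 9 ∷ 11 ∷ 17 ∷ []) (31 ∷ [])))) (split 18 (split 48 (split 66 (leaf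
  (loops 68 (5 ∷ 4 ∷ 4 ∷ 20 ∷ 18 ∷ 5 ∷ []))) (split 60 (split 54 (leaf (match (20 ∷ 35 ∷ []) (16 ∷ 10 ∷ 3 ∷ 13 ∷
  20 ∷ []) (136 ∷ []))) (leaf (match (20 ∷ 35 ∷ []) (16 ∷ 10 ∷ 3 ∷ 13 ∷ 20 ∷ []) (137 ∷ [])))) (split 54 (split 75
  (split 62 (apart 1) (apart 1)) (leaf (star 21))) (leaf (match (1 ∷ 38 ∷ 50 ∷ []) (4 ∷ 2 ∷ 9 ∷ []) (31 ∷ 146 ∷
  106 ∷ [])))))) (split 60 (split 63 (split 72 (leaf (match (23 ∷ 35 ∷ []) (10 ∷ 3 ∷ 13 ∷ 20 ∷ 24 ∷ []) (58 ∷
  []))) (leaf (match (1 ∷ 50 ∷ []) (9 ∷ 2 ∷ 4 ∷ 15 ∷ 21 ∷ []) (49 ∷ [])))) (split 66 (split 72 (split 68 (apart 1)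
  (apart 1)) (leaf (star 22))) (split 72 (leaf (star 24)) (split 81 (leaf (match (23 ∷ 56 ∷ []) (26 ∷ 27 ∷ [])
  (133 ∷ []))) (leaf (star 24)))))) (split 54 (split 66 (split 75 (leaf (loops 144 (3 ∷ 3 ∷ 4 ∷ 20 ∷ 18 ∷ 18 ∷ 5 ∷
  3 ∷ 1 ∷ 1 ∷ []))) (leaf (star 21))) (split 72 (split 78 (leaf (match (20 ∷ 38 ∷ []) (5 ∷ 4 ∷ 11 ∷ 28 ∷ 23 ∷ 1 ∷
  8 ∷ 10 ∷ 2 ∷ 9 ∷ []) (129 ∷ []))) (leaf (star 25))) (split 78 (split 84 (split 80 (apart 1) (apart 1)) (leaf
  (star 29))) (split 84 (leaf (star 27)) (split 93 (leaf (match (20 ∷ 56 ∷ []) (30 ∷ 31 ∷ []) (157 ∷ []))) (leaf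
  (star 21))))))) (leaf (match (1 ∷ 38 ∷ 50 ∷ []) (4 ∷ 2 ∷ 9 ∷ []) (31 ∷ 49 ∷ 106 ∷ [])))))) (split 60 (split 48
  (split 54 (split 63 (leaf (match (17 ∷ 35 ∷ []) (13 ∷ 3 ∷ 10 ∷ 16 ∷ 24 ∷ []) (121 ∷ []))) (leaf (match (1 ∷ 56 ∷
  []) (15 ∷ 4 ∷ 2 ∷ 9 ∷ 23 ∷ []) (37 ∷ [])))) (split 72 (split 63 (split 65 (apart 1) (apart 1)) (leaf (star 22)))
  (split 63 (leaf (star 25)) (split 78 (leaf (match (17 ∷ 50 ∷ []) (26 ∷ 27 ∷ []) (41 ∷ []))) (leaf (star 25))))))
  (leaf (match (17 ∷ 23 ∷ 35 ∷ []) (10 ∷ 3 ∷ 13 ∷ []) (32 ∷ 121 ∷ 58 ∷ [])))) (split 48 (split 54 (split 75 (leaf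
  (match (17 ∷ 35 ∷ []) (13 ∷ 3 ∷ 10 ∷ 16 ∷ 25 ∷ []) (121 ∷ []))) (split 69 (leaf (star 23)) (split 63 (leaf
  (match (20 ∷ 38 ∷ []) (21 ∷ 27 ∷ []) (135 ∷ []))) (leaf (star 22))))) (leaf (match (1 ∷ 38 ∷ 50 ∷ []) (4 ∷ 2 ∷ 9
  ∷ []) (31 ∷ 48 ∷ 106 ∷ [])))) (leaf (match (17 ∷ 23 ∷ 35 ∷ []) (10 ∷ 3 ∷ 13 ∷ []) (32 ∷ 121 ∷ 58 ∷ [])))))))
  (split 36 (split 45 (leaf (match (1 ∷ 29 ∷ []) (2 ∷ 4 ∷ 11 ∷ 15 ∷ 19 ∷ []) (10 ∷ []))) (leaf (match (1 ∷ 29 ∷ 38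
  ∷ []) (2 ∷ 4 ∷ []) (10 ∷ 31 ∷ 88 ∷ [])))) (split 45 (split 18 (split 66 (split 21 (split 48 (leaf (match (1 ∷ 29
  ∷ []) (2 ∷ 4 ∷ 15 ∷ 22 ∷ 24 ∷ []) (10 ∷ []))) (leaf (match (23 ∷ 35 ∷ []) (10 ∷ 3 ∷ 13 ∷ 21 ∷ 23 ∷ []) (59 ∷
  [])))) (split 48 (split 72 (split 50 (apart 1) (apart 1)) (leaf (star 25))) (split 72 (leaf (star 17)) (split 81
  (leaf (match (20 ∷ 29 ∷ []) (26 ∷ 27 ∷ []) (47 ∷ []))) (leaf (star 25)))))) (leaf (match (1 ∷ 29 ∷ 59 ∷ []) (2 ∷
  4 ∷ 15 ∷ []) (10 ∷ 37 ∷ 88 ∷ [])))) (split 48 (split 66 (split 72 (split 78 (leaf (loops 34 (2 ∷ 1 ∷ 1 ∷ 1 ∷ 4 ∷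
  20 ∷ 18 ∷ 37 ∷ 9 ∷ 2 ∷ []))) (leaf (star 24))) (split 75 (split 84 (leaf (match (20 ∷ 29 ∷ []) (8 ∷ 2 ∷ 11 ∷ 28
  ∷ 22 ∷ 0 ∷ 4 ∷ 15 ∷ 5 ∷ 13 ∷ []) (46 ∷ []))) (leaf (star 25))) (split 84 (split 78 (split 80 (apart 1) (apart
  1)) (leaf (star 28))) (split 78 (leaf (star 26)) (split 90 (leaf (match (20 ∷ 53 ∷ []) (30 ∷ 31 ∷ []) (149 ∷
  []))) (leaf (star 24))))))) (leaf (match (1 ∷ 29 ∷ 59 ∷ []) (2 ∷ 4 ∷ 15 ∷ []) (10 ∷ 37 ∷ 88 ∷ [])))) (leaf
  (match (17 ∷ 23 ∷ 35 ∷ []) (10 ∷ 3 ∷ 13 ∷ []) (32 ∷ 129 ∷ 59 ∷ []))))) (leaf (match (1 ∷ 29 ∷ 38 ∷ []) (2 ∷ 4 ∷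
  []) (10 ∷ 31 ∷ 89 ∷ [])))))) (split 42 (split 51 (split 36 (split 45 (split 63 (split 48 (apart 12) (split 17
  (apart 1) (contra 17))) (leaf (match (1 ∷ 53 ∷ []) (9 ∷ 2 ∷ 4 ∷ 12 ∷ 14 ∷ []) (48 ∷ [])))) (leaf (match (1 ∷ 38
  ∷ []) (4 ∷ 2 ∷ 9 ∷ 11 ∷ 18 ∷ []) (31 ∷ [])))) (split 57 (split 60 (split 63 (split 45 (leaf (match (2 ∷ 35 ∷ [])
  (3 ∷ 10 ∷ 17 ∷ 23 ∷ 24 ∷ []) (81 ∷ []))) (leaf (match (1 ∷ 38 ∷ []) (4 ∷ 2 ∷ 9 ∷ 19 ∷ 22 ∷ []) (31 ∷ []))))
  (split 72 (split 45 (split 47 (apart 1) (apart 1)) (leaf (star 16))) (split 45 (leaf (star 25)) (split 78 (leaf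
  (match (2 ∷ 62 ∷ []) (26 ∷ 27 ∷ []) (35 ∷ []))) (leaf (star 25)))))) (split 45 (split 66 (split 78 (leaf (loops
  68 (4 ∷ 4 ∷ 4 ∷ 20 ∷ 9 ∷ 4 ∷ 9 ∷ 1 ∷ 1 ∷ 4 ∷ []))) (leaf (star 22))) (split 75 (split 84 (leaf (match (17 ∷ 53 ∷
  []) (7 ∷ 9 ∷ 14 ∷ 28 ∷ 15 ∷ 0 ∷ 2 ∷ 4 ∷ 1 ∷ 3 ∷ []) (40 ∷ []))) (leaf (star 25))) (split 78 (split 84 (split 80
  (apart 1) (apart 1)) (leaf (star 26))) (split 84 (leaf (star 28)) (split 93 (leaf (match (17 ∷ 62 ∷ []) (30 ∷ 31
  ∷ []) (157 ∷ []))) (leaf (star 22))))))) (leaf (match (1 ∷ 38 ∷ 53 ∷ []) (4 ∷ 2 ∷ 9 ∷ []) (31 ∷ 43 ∷ 112 ∷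
  []))))) (split 60 (leaf (match (2 ∷ 20 ∷ 35 ∷ []) (3 ∷ 10 ∷ 17 ∷ []) (2 ∷ 81 ∷ 118 ∷ []))) (leaf (match (2 ∷ 20
  ∷ 35 ∷ []) (3 ∷ 10 ∷ 17 ∷ []) (2 ∷ 81 ∷ 119 ∷ [])))))) (split 36 (leaf (match (2 ∷ 23 ∷ []) (1 ∷ 3 ∷ 10 ∷ 12 ∷
  18 ∷ []) (3 ∷ []))) (leaf (match (2 ∷ 23 ∷ 35 ∷ []) (1 ∷ 3 ∷ []) (3 ∷ 81 ∷ 58 ∷ []))))) (split 36 (split 45
  (split 48 (split 66 (split 69 (split 72 (leaf (match (1 ∷ 29 ∷ []) (2 ∷ 11 ∷ 20 ∷ 22 ∷ 24 ∷ []) (10 ∷ [])))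
  (leaf (match (2 ∷ 23 ∷ []) (1 ∷ 3 ∷ 12 ∷ 21 ∷ 23 ∷ []) (3 ∷ [])))) (split 18 (split 72 (split 20 (apart 1)
  (apart 1)) (leaf (star 6))) (split 72 (leaf (star 24)) (split 81 (leaf (match (1 ∷ 53 ∷ []) (26 ∷ 27 ∷ []) (37 ∷
  []))) (leaf (star 24)))))) (split 51 (split 18 (split 75 (leaf (loops 34 (2 ∷ 1 ∷ 1 ∷ 1 ∷ 2 ∷ 4 ∷ 20 ∷ 41 ∷ 5 ∷
  5 ∷ []))) (leaf (star 23))) (split 72 (split 78 (leaf (match (17 ∷ 56 ∷ []) (15 ∷ 12 ∷ 14 ∷ 28 ∷ 7 ∷ 0 ∷ 2 ∷ 4 ∷
  1 ∷ 3 ∷ []) (141 ∷ []))) (leaf (star 25))) (split 84 (split 78 (split 80 (apart 1) (apart 1)) (leaf (star 27)))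
  (split 78 (leaf (star 29)) (split 90 (leaf (match (17 ∷ 53 ∷ []) (30 ∷ 31 ∷ []) (41 ∷ []))) (leaf (star
  23))))))) (leaf (match (2 ∷ 23 ∷ 56 ∷ []) (1 ∷ 3 ∷ 12 ∷ []) (3 ∷ 91 ∷ 58 ∷ []))))) (split 66 (leaf (match (1 ∷
  29 ∷ 47 ∷ []) (2 ∷ 11 ∷ 20 ∷ []) (10 ∷ 92 ∷ 114 ∷ []))) (leaf (match (1 ∷ 29 ∷ 47 ∷ []) (2 ∷ 11 ∷ 20 ∷ []) (10 ∷
  92 ∷ 115 ∷ []))))) (leaf (match (1 ∷ 29 ∷ 38 ∷ []) (2 ∷ 4 ∷ []) (10 ∷ 31 ∷ 88 ∷ [])))) (split 51 (split 66
  (split 72 (split 45 (split 75 (split 78 (leaf (loops 34 (2 ∷ 1 ∷ 1 ∷ 1 ∷ 2 ∷ 4 ∷ 20 ∷ 41 ∷ 5 ∷ 5 ∷ []))) (split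
  54 (split 60 (apart 12) (leaf (star 28))) (leaf (star 23)))) (split 87 (split 78 (leaf (loops 34 (2 ∷ 1 ∷ 1 ∷ 1
  ∷ 4 ∷ 20 ∷ 18 ∷ 9 ∷ 4 ∷ 41 ∷ 5 ∷ 5 ∷ []))) (leaf (star 28))) (split 78 (split 90 (split 96 (leaf (loops 34 (2 ∷
  1 ∷ 1 ∷ 1 ∷ 4 ∷ 20 ∷ 9 ∷ 4 ∷ 41 ∷ 41 ∷ 9 ∷ 4 ∷ 5 ∷ 5 ∷ []))) (leaf (star 28))) (split 54 (leaf (match (17 ∷ 62 ∷
  []) (15 ∷ 12 ∷ 31 ∷ 26 ∷ 24 ∷ 7 ∷ 0 ∷ 4 ∷ 2 ∷ 9 ∷ 14 ∷ 18 ∷ 1 ∷ 3 ∷ []) (175 ∷ []))) (split 99 (leaf (match (17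
  ∷ 53 ∷ 62 ∷ []) (26 ∷ 31 ∷ []) (40 ∷ 175 ∷ 112 ∷ []))) (leaf (match (17 ∷ 53 ∷ 62 ∷ []) (26 ∷ 31 ∷ []) (40 ∷ 175
  ∷ 113 ∷ [])))))) (split 54 (split 60 (apart 100) (leaf (match (1 ∷ 29 ∷ 77 ∷ []) (22 ∷ 23 ∷ []) (10 ∷ 37 ∷ 115 ∷
  [])))) (leaf (star 23)))))) (leaf (match (1 ∷ 29 ∷ 38 ∷ []) (2 ∷ 4 ∷ []) (10 ∷ 31 ∷ 89 ∷ [])))) (leaf (star
  22))) (split 45 (split 48 (split 84 (split 54 (split 87 (split 90 (apart 3220) (split 69 (apart 52) (leaf (match
  (20 ∷ 56 ∷ []) (17 ∷ 8 ∷ 31 ∷ 27 ∷ 21 ∷ 0 ∷ 16 ∷ 13 ∷ 2 ∷ 10 ∷ 11 ∷ 3 ∷ 14 ∷ []) (136 ∷ []))))) (split 99 (leaf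
  (star 32)) (split 102 (split 69 (apart 420) (split 105 (leaf (loops 34 (2 ∷ 1 ∷ 1 ∷ 1 ∷ 1 ∷ 2 ∷ 2 ∷ 4 ∷ 18 ∷ 9 ∷
  4 ∷ 18 ∷ 5 ∷ 5 ∷ []))) (leaf (star 28)))) (leaf (star 22))))) (split 87 (split 72 (split 96 (split 90 (apart
  1172) (split 102 (apart 148) (apart 148))) (leaf (star 22))) (split 96 (split 90 (apart 107668) (split 102
  (apart 4) (apart 212))) (leaf (star 22)))) (split 102 (split 90 (split 69 (apart 52) (leaf (star 30))) (split 69
  (apart 404) (leaf (match (17 ∷ 53 ∷ 62 ∷ []) (7 ∷ 9 ∷ 15 ∷ 12 ∷ 0 ∷ 2 ∷ 4 ∷ 1 ∷ 3 ∷ []) (41 ∷ 171 ∷ 112 ∷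
  []))))) (split 90 (split 69 (apart 1684) (leaf (match (17 ∷ 53 ∷ 62 ∷ []) (30 ∷ 35 ∷ []) (41 ∷ 171 ∷ 113 ∷
  [])))) (split 69 (apart 52) (leaf (match (17 ∷ 53 ∷ 62 ∷ []) (7 ∷ 9 ∷ 15 ∷ 12 ∷ 0 ∷ 2 ∷ 4 ∷ 1 ∷ 3 ∷ []) (41 ∷
  171 ∷ 113 ∷ [])))))))) (leaf (star 26))) (split 54 (split 81 (split 90 (split 69 (split 93 (apart 420) (leaf
  (match (20 ∷ 47 ∷ 56 ∷ []) (17 ∷ 8 ∷ 21 ∷ 13 ∷ 2 ∷ 10 ∷ 11 ∷ 3 ∷ 14 ∷ []) (139 ∷ 136 ∷ 163 ∷ [])))) (split 93
  (apart 420) (leaf (match (20 ∷ 47 ∷ 56 ∷ []) (17 ∷ 8 ∷ 21 ∷ 13 ∷ 2 ∷ 10 ∷ 11 ∷ 3 ∷ 14 ∷ []) (139 ∷ 136 ∷ 163 ∷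
  []))))) (leaf (star 22))) (split 93 (leaf (star 30)) (split 69 (leaf (match (20 ∷ 47 ∷ 56 ∷ []) (17 ∷ 8 ∷ 21 ∷
  13 ∷ 2 ∷ 10 ∷ 11 ∷ 3 ∷ 14 ∷ []) (139 ∷ 136 ∷ 163 ∷ []))) (leaf (match (20 ∷ 47 ∷ 56 ∷ []) (17 ∷ 8 ∷ 21 ∷ 13 ∷ 2
  ∷ 10 ∷ 11 ∷ 3 ∷ 14 ∷ []) (139 ∷ 136 ∷ 163 ∷ [])))))) (split 81 (split 96 (leaf (star 32)) (split 69 (leaf (match
  (20 ∷ 47 ∷ 56 ∷ []) (17 ∷ 8 ∷ 21 ∷ 13 ∷ 2 ∷ 10 ∷ 11 ∷ 3 ∷ 14 ∷ []) (139 ∷ 137 ∷ 163 ∷ []))) (leaf (match (20 ∷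
  47 ∷ 56 ∷ []) (17 ∷ 8 ∷ 21 ∷ 13 ∷ 2 ∷ 10 ∷ 11 ∷ 3 ∷ 14 ∷ []) (139 ∷ 137 ∷ 163 ∷ []))))) (leaf (turtle (23 ∷ 5 ∷
  0 ∷ 8 ∷ 11 ∷ 38 ∷ []) ((1 ∷ 1 ∷ 1 ∷ 2 ∷ 2 ∷ []) ∷ (1 ∷ 1 ∷ 2 ∷ 2 ∷ 4 ∷ []) ∷ (1 ∷ 1 ∷ 12 ∷ 2 ∷ 2 ∷ []) ∷ (2 ∷ 4
  ∷ 2 ∷ 4 ∷ 2 ∷ []) ∷ (4 ∷ 148 ∷ 36 ∷ 6 ∷ 2 ∷ []) ∷ (1 ∷ 1 ∷ 1 ∷ 2 ∷ 1 ∷ []) ∷ (1 ∷ 1 ∷ 4 ∷ 2 ∷ 1 ∷ []) ∷ (1 ∷ 4 ∷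
  2 ∷ 4 ∷ 1 ∷ []) ∷ (9 ∷ 4 ∷ 4 ∷ 4 ∷ 2 ∷ []) ∷ (1 ∷ 2 ∷ 5 ∷ 1 ∷ 1 ∷ []) ∷ (1 ∷ 4 ∷ 2 ∷ 1 ∷ 1 ∷ []) ∷ (4 ∷ 4 ∷ 4 ∷
  1 ∷ 1 ∷ []) ∷ (1 ∷ 1 ∷ 4 ∷ 2 ∷ 1 ∷ []) ∷ (1 ∷ 2 ∷ 2 ∷ 2 ∷ 1 ∷ []) ∷ (1 ∷ 2 ∷ 2 ∷ 1 ∷ 1 ∷ []) ∷ [])))))) (leaf
  (match (1 ∷ 29 ∷ 38 ∷ []) (2 ∷ 4 ∷ []) (10 ∷ 31 ∷ 89 ∷ []))))) (leaf (match (2 ∷ 23 ∷ 35 ∷ []) (1 ∷ 3 ∷ []) (3 ∷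
  81 ∷ 59 ∷ []))))))) (split 15 (split 42 (split 48 (split 57 (split 63 (leaf (match (1 ∷ 8 ∷ []) (4 ∷ 9 ∷ 12 ∷ 18
  ∷ 21 ∷ []) (0 ∷ []))) (split 18 (split 72 (leaf (match (1 ∷ 8 ∷ []) (4 ∷ 12 ∷ 16 ∷ 21 ∷ 24 ∷ []) (0 ∷ [])))
  (leaf (match (1 ∷ 8 ∷ 59 ∷ []) (4 ∷ 12 ∷ []) (0 ∷ 37 ∷ 70 ∷ [])))) (split 72 (split 75 (split 21 (split 51 (leaf
  (loops 4 (1 ∷ 1 ∷ 1 ∷ 2 ∷ 4 ∷ 20 ∷ 41 ∷ 5 ∷ 5 ∷ 2 ∷ []))) (leaf (star 26))) (split 81 (leaf (match (20 ∷ 44 ∷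
  []) (17 ∷ 8 ∷ 24 ∷ 19 ∷ 11 ∷ 0 ∷ 4 ∷ 16 ∷ 5 ∷ 13 ∷ []) (162 ∷ []))) (leaf (star 9)))) (leaf (match (1 ∷ 8 ∷ 68 ∷
  []) (9 ∷ 18 ∷ []) (0 ∷ 146 ∷ 91 ∷ [])))) (leaf (match (1 ∷ 8 ∷ 59 ∷ []) (4 ∷ 12 ∷ []) (0 ∷ 37 ∷ 70 ∷ []))))))
  (split 54 (split 18 (split 78 (split 69 (split 72 (apart 404) (split 75 (leaf (loops 4 (1 ∷ 1 ∷ 1 ∷ 4 ∷ 20 ∷ 18
  ∷ 37 ∷ 9 ∷ 2 ∷ 2 ∷ []))) (leaf (match (1 ∷ 8 ∷ 65 ∷ []) (9 ∷ 18 ∷ []) (0 ∷ 43 ∷ 70 ∷ []))))) (split 84 (split 72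
  (apart 52) (leaf (match (1 ∷ 8 ∷ 65 ∷ []) (4 ∷ 16 ∷ 26 ∷ []) (0 ∷ 43 ∷ 70 ∷ [])))) (split 87 (split 90 (apart
  100) (split 72 (apart 1) (apart 1))) (leaf (match (1 ∷ 8 ∷ 65 ∷ []) (4 ∷ 16 ∷ 26 ∷ []) (0 ∷ 43 ∷ 70 ∷ []))))))
  (leaf (match (1 ∷ 8 ∷ 59 ∷ []) (4 ∷ 12 ∷ []) (0 ∷ 37 ∷ 71 ∷ [])))) (split 78 (split 69 (split 72 (split 75 (leaf
  (match (17 ∷ 35 ∷ []) (13 ∷ 3 ∷ 28 ∷ 24 ∷ 7 ∷ 9 ∷ 14 ∷ 17 ∷ 10 ∷ 18 ∷ []) (123 ∷ []))) (split 63 (apart 12)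
  (leaf (star 28)))) (split 63 (split 84 (apart 12) (leaf (star 28))) (split 90 (split 93 (leaf (loops 4 (1 ∷ 1 ∷
  1 ∷ 4 ∷ 20 ∷ 18 ∷ 9 ∷ 4 ∷ 18 ∷ 5 ∷ 5 ∷ 2 ∷ []))) (leaf (match (35 ∷ 80 ∷ []) (20 ∷ 13 ∷ 3 ∷ 30 ∷ 24 ∷ 5 ∷ 7 ∷ 9
  ∷ 14 ∷ 17 ∷ 10 ∷ 18 ∷ 1 ∷ []) (118 ∷ [])))) (leaf (match (1 ∷ 8 ∷ 74 ∷ []) (9 ∷ 18 ∷ []) (0 ∷ 43 ∷ 91 ∷ []))))))
  (split 63 (split 84 (split 81 (apart 12) (leaf (loops 4 (1 ∷ 1 ∷ 1 ∷ 1 ∷ 2 ∷ 4 ∷ 18 ∷ 9 ∷ 4 ∷ 5 ∷ 5 ∷ 2 ∷ []))))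
  (leaf (star 18))) (split 90 (split 84 (split 81 (leaf (match (23 ∷ 44 ∷ []) (10 ∷ 1 ∷ 24 ∷ 32 ∷ 22 ∷ 3 ∷ 11 ∷ 13
  ∷ 5 ∷ 20 ∷ 27 ∷ 4 ∷ 12 ∷ []) (58 ∷ []))) (leaf (star 24))) (split 81 (split 87 (leaf (star 34)) (split 93 (split
  95 (leaf (loops 4 (1 ∷ 1 ∷ 1 ∷ 1 ∷ 2 ∷ 2 ∷ 4 ∷ 18 ∷ 9 ∷ 4 ∷ 18 ∷ 5 ∷ 5 ∷ 2 ∷ []))) (apart 1)) (leaf (star 34))))
  (split 87 (leaf (match (23 ∷ 44 ∷ 80 ∷ []) (24 ∷ 32 ∷ []) (58 ∷ 175 ∷ 131 ∷ []))) (leaf (match (23 ∷ 44 ∷ 80 ∷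
  []) (24 ∷ 32 ∷ []) (58 ∷ 175 ∷ 131 ∷ [])))))) (leaf (star 18))))) (leaf (match (1 ∷ 8 ∷ 59 ∷ []) (4 ∷ 12 ∷ [])
  (0 ∷ 37 ∷ 71 ∷ []))))) (leaf (star 9)))) (leaf (star 4))) (split 48 (split 63 (split 18 (split 66 (leaf (match
  (1 ∷ 8 ∷ []) (4 ∷ 12 ∷ 16 ∷ 22 ∷ 24 ∷ []) (0 ∷ []))) (split 69 (split 21 (split 51 (apart 212) (split 54 (apart
  1) (apart 1))) (split 78 (leaf (star 26)) (split 54 (split 90 (apart 1620) (split 93 (apart 52) (leaf (match (23
  ∷ 44 ∷ []) (18 ∷ 31 ∷ []) (59 ∷ []))))) (leaf (star 9))))) (split 21 (leaf (match (1 ∷ 8 ∷ 68 ∷ []) (4 ∷ 16 ∷ 24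
  ∷ []) (0 ∷ 43 ∷ 70 ∷ []))) (leaf (match (1 ∷ 8 ∷ 68 ∷ []) (4 ∷ 16 ∷ 24 ∷ []) (0 ∷ 43 ∷ 70 ∷ [])))))) (split 51
  (split 78 (split 81 (leaf (loops 4 (1 ∷ 1 ∷ 1 ∷ 2 ∷ 4 ∷ 20 ∷ 18 ∷ 5 ∷ 5 ∷ 2 ∷ []))) (leaf (star 26))) (split 54
  (split 81 (split 87 (leaf (loops 4 (1 ∷ 1 ∷ 1 ∷ 4 ∷ 20 ∷ 18 ∷ 9 ∷ 4 ∷ 82 ∷ 5 ∷ 5 ∷ 2 ∷ []))) (leaf (star 26)))
  (split 87 (split 96 (split 99 (leaf (loops 4 (1 ∷ 1 ∷ 1 ∷ 4 ∷ 20 ∷ 9 ∷ 4 ∷ 82 ∷ 18 ∷ 9 ∷ 4 ∷ 5 ∷ 5 ∷ 2 ∷ [])))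
  (split 57 (leaf (match (20 ∷ 68 ∷ []) (24 ∷ 20 ∷ 31 ∷ 29 ∷ 17 ∷ 8 ∷ 34 ∷ 0 ∷ 16 ∷ 4 ∷ 2 ∷ 11 ∷ 14 ∷ 5 ∷ 13 ∷ [])
  (163 ∷ []))) (leaf (star 31)))) (leaf (star 29))) (leaf (star 26)))) (leaf (star 9)))) (split 66 (split 54
  (split 69 (split 75 (apart 100) (leaf (match (1 ∷ 8 ∷ 56 ∷ []) (4 ∷ 12 ∷ 22 ∷ []) (0 ∷ 148 ∷ 110 ∷ [])))) (split
  75 (split 78 (leaf (star 31)) (split 96 (apart 100) (leaf (match (20 ∷ 29 ∷ []) (27 ∷ 29 ∷ []) (47 ∷ [])))))
  (leaf (match (1 ∷ 8 ∷ 71 ∷ []) (4 ∷ 12 ∷ 22 ∷ []) (0 ∷ 148 ∷ 91 ∷ []))))) (leaf (star 9))) (split 69 (split 75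
  (split 78 (split 81 (split 54 (apart 26) (apart 1)) (leaf (star 23))) (split 96 (split 99 (apart 100) (leaf
  (match (20 ∷ 29 ∷ []) (8 ∷ 2 ∷ 33 ∷ 30 ∷ 24 ∷ 0 ∷ 4 ∷ 16 ∷ 5 ∷ 13 ∷ 11 ∷ 20 ∷ 28 ∷ []) (47 ∷ [])))) (leaf (star
  23)))) (split 87 (leaf (star 29)) (split 78 (leaf (match (23 ∷ 44 ∷ 71 ∷ []) (10 ∷ 1 ∷ 22 ∷ 21 ∷ 3 ∷ 11 ∷ 13 ∷ 4
  ∷ 12 ∷ []) (59 ∷ 157 ∷ 172 ∷ []))) (leaf (match (23 ∷ 44 ∷ 71 ∷ []) (10 ∷ 1 ∷ 22 ∷ 21 ∷ 3 ∷ 11 ∷ 13 ∷ 4 ∷ 12 ∷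
  []) (59 ∷ 157 ∷ 172 ∷ [])))))) (split 75 (split 78 (leaf (star 32)) (split 87 (leaf (match (20 ∷ 29 ∷ 68 ∷ [])
  (8 ∷ 2 ∷ 24 ∷ 20 ∷ 0 ∷ 4 ∷ 16 ∷ 5 ∷ 13 ∷ []) (47 ∷ 195 ∷ 88 ∷ []))) (leaf (match (20 ∷ 29 ∷ 68 ∷ []) (8 ∷ 2 ∷ 24
  ∷ 20 ∷ 0 ∷ 4 ∷ 16 ∷ 5 ∷ 13 ∷ []) (47 ∷ 195 ∷ 89 ∷ []))))) (leaf (turtle (5 ∷ 0 ∷ 2 ∷ 11 ∷ 38 ∷ 62 ∷ []) ((1 ∷ 1
  ∷ 1 ∷ 2 ∷ 1 ∷ []) ∷ (1 ∷ 1 ∷ 2 ∷ 3 ∷ 1 ∷ []) ∷ (1 ∷ 4 ∷ 2 ∷ 2 ∷ 1 ∷ []) ∷ (9 ∷ 2 ∷ 9 ∷ 2 ∷ 2 ∷ []) ∷ (18 ∷ 4 ∷ 4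
  ∷ 4 ∷ 2 ∷ []) ∷ (1 ∷ 1 ∷ 2 ∷ 1 ∷ 1 ∷ []) ∷ (1 ∷ 4 ∷ 2 ∷ 1 ∷ 1 ∷ []) ∷ (4 ∷ 2 ∷ 4 ∷ 1 ∷ 1 ∷ []) ∷ (9 ∷ 4 ∷ 4 ∷ 4
  ∷ 2 ∷ []) ∷ (1 ∷ 2 ∷ 1 ∷ 3 ∷ 1 ∷ []) ∷ (2 ∷ 5 ∷ 1 ∷ 1 ∷ 1 ∷ []) ∷ (2 ∷ 2 ∷ 2 ∷ 1 ∷ 1 ∷ []) ∷ (1 ∷ 2 ∷ 5 ∷ 1 ∷ 1
  ∷ []) ∷ (1 ∷ 2 ∷ 4 ∷ 4 ∷ 1 ∷ []) ∷ (1 ∷ 1 ∷ 2 ∷ 1 ∷ 2 ∷ []) ∷ [])))))))) (split 18 (split 66 (leaf (match (1 ∷ 8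
  ∷ 62 ∷ []) (4 ∷ 12 ∷ []) (0 ∷ 37 ∷ 70 ∷ []))) (leaf (match (1 ∷ 8 ∷ 62 ∷ []) (4 ∷ 12 ∷ []) (0 ∷ 37 ∷ 71 ∷ []))))
  (split 66 (leaf (match (1 ∷ 8 ∷ 62 ∷ []) (4 ∷ 12 ∷ []) (0 ∷ 37 ∷ 70 ∷ []))) (leaf (match (1 ∷ 8 ∷ 62 ∷ []) (4 ∷
  12 ∷ []) (0 ∷ 37 ∷ 71 ∷ [])))))) (leaf (star 4)))) (split 27 (split 48 (split 54 (split 66 (split 72 (leaf
  (loops 4 (1 ∷ 1 ∷ 1 ∷ 2 ∷ 2 ∷ 3 ∷ 3 ∷ 3 ∷ 1 ∷ 1 ∷ []))) (split 57 (split 42 (split 81 (leaf (match (1 ∷ 8 ∷ [])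
  (4 ∷ 9 ∷ 12 ∷ 18 ∷ 22 ∷ 17 ∷ 21 ∷ 26 ∷ 28 ∷ []) (0 ∷ []))) (split 45 (leaf (match (1 ∷ 8 ∷ 68 ∷ []) (9 ∷ 18 ∷
  []) (0 ∷ 37 ∷ 91 ∷ []))) (leaf (match (1 ∷ 8 ∷ 68 ∷ []) (9 ∷ 18 ∷ []) (0 ∷ 37 ∷ 91 ∷ []))))) (split 81 (split 87
  (leaf (match (1 ∷ 29 ∷ 50 ∷ []) (18 ∷ 22 ∷ []) (10 ∷ 98 ∷ 175 ∷ []))) (leaf (match (1 ∷ 29 ∷ 50 ∷ []) (18 ∷ 22 ∷
  []) (10 ∷ 98 ∷ 175 ∷ [])))) (leaf (star 18)))) (leaf (star 9)))) (split 57 (split 42 (split 45 (split 84 (leaf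
  (match (1 ∷ 8 ∷ []) (9 ∷ 18 ∷ 22 ∷ 27 ∷ 28 ∷ []) (0 ∷ []))) (leaf (match (1 ∷ 8 ∷ 68 ∷ []) (9 ∷ 18 ∷ []) (0 ∷
  152 ∷ 91 ∷ [])))) (split 84 (split 63 (split 90 (apart 1620) (split 93 (apart 52) (leaf (match (1 ∷ 8 ∷ 74 ∷ [])
  (9 ∷ 18 ∷ 22 ∷ []) (0 ∷ 37 ∷ 70 ∷ []))))) (leaf (star 12))) (leaf (match (1 ∷ 8 ∷ 68 ∷ []) (9 ∷ 18 ∷ []) (0 ∷
  152 ∷ 91 ∷ []))))) (split 78 (split 87 (split 90 (leaf (loops 4 (1 ∷ 1 ∷ 1 ∷ 2 ∷ 4 ∷ 20 ∷ 18 ∷ 9 ∷ 3 ∷ 3 ∷ 1 ∷ 1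
  ∷ []))) (split 96 (split 93 (leaf (loops 4 (1 ∷ 1 ∷ 1 ∷ 2 ∷ 4 ∷ 20 ∷ 9 ∷ 4 ∷ 105 ∷ 18 ∷ 5 ∷ 3 ∷ 1 ∷ 1 ∷ [])))
  (split 99 (leaf (match (2 ∷ 92 ∷ []) (21 ∷ 12 ∷ 3 ∷ 1 ∷ 24 ∷ 29 ∷ 33 ∷ 6 ∷ 22 ∷ 18 ∷ 9 ∷ 14 ∷ 27 ∷ 7 ∷ 23 ∷ [])
  (103 ∷ []))) (leaf (star 21)))) (leaf (star 12)))) (split 84 (leaf (match (1 ∷ 29 ∷ 74 ∷ []) (18 ∷ 22 ∷ []) (10
  ∷ 37 ∷ 169 ∷ []))) (leaf (match (1 ∷ 29 ∷ 74 ∷ []) (18 ∷ 22 ∷ []) (10 ∷ 37 ∷ 169 ∷ []))))) (leaf (star 18))))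
  (leaf (star 9)))) (split 57 (split 63 (split 42 (split 45 (split 81 (apart 53844) (split 51 (split 84 (apart
  420) (leaf (match (1 ∷ 8 ∷ 71 ∷ []) (9 ∷ 18 ∷ []) (0 ∷ 43 ∷ 70 ∷ [])))) (split 84 (apart 1700) (leaf (star
  28))))) (split 90 (split 51 (split 81 (apart 12948) (split 66 (split 96 (apart 12) (leaf (star 21))) (split 96
  (split 105 (leaf (loops 4 (1 ∷ 1 ∷ 1 ∷ 4 ∷ 20 ∷ 18 ∷ 9 ∷ 4 ∷ 18 ∷ 9 ∷ 3 ∷ 3 ∷ 1 ∷ 1 ∷ []))) (leaf (star 21)))
  (split 84 (apart 100) (leaf (match (2 ∷ 35 ∷ 68 ∷ []) (21 ∷ 28 ∷ []) (81 ∷ 35 ∷ 167 ∷ []))))))) (split 66 (split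
  81 (apart 1684) (split 96 (leaf (star 32)) (split 84 (apart 12) (leaf (star 28))))) (split 81 (apart 1684)
  (split 84 (split 99 (apart 52) (apart 12)) (split 108 (leaf (star 35)) (leaf (star 28))))))) (leaf (match (1 ∷ 8
  ∷ 71 ∷ []) (9 ∷ 18 ∷ []) (0 ∷ 43 ∷ 91 ∷ []))))) (split 75 (split 81 (split 84 (split 87 (apart 5412) (split 51
  (apart 292) (leaf (star 25)))) (split 99 (split 87 (split 51 (apart 20) (apart 12)) (leaf (star 25))) (split 87
  (split 105 (split 51 (apart 36) (leaf (star 31))) (leaf (star 25))) (split 51 (leaf (match (2 ∷ 8 ∷ 86 ∷ []) (12
  ∷ 21 ∷ []) (27 ∷ 103 ∷ 91 ∷ []))) (leaf (match (2 ∷ 8 ∷ 86 ∷ []) (12 ∷ 21 ∷ []) (27 ∷ 103 ∷ 91 ∷ [])))))))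
  (split 51 (split 66 (split 93 (apart 4756) (leaf (star 21))) (split 105 (split 93 (leaf (loops 4 (1 ∷ 1 ∷ 1 ∷ 4
  ∷ 20 ∷ 18 ∷ 9 ∷ 4 ∷ 37 ∷ 9 ∷ 3 ∷ 3 ∷ 1 ∷ 1 ∷ []))) (split 111 (leaf (match (2 ∷ 35 ∷ 68 ∷ []) (21 ∷ 28 ∷ []) (81
  ∷ 35 ∷ 166 ∷ []))) (leaf (match (2 ∷ 35 ∷ 68 ∷ []) (21 ∷ 28 ∷ []) (81 ∷ 35 ∷ 167 ∷ []))))) (leaf (star 21))))
  (split 66 (split 93 (split 96 (leaf (loops 4 (1 ∷ 1 ∷ 1 ∷ 4 ∷ 20 ∷ 18 ∷ 18 ∷ 9 ∷ 2 ∷ 3 ∷ 4 ∷ 20 ∷ 18 ∷ 18 ∷ 5 ∷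
  3 ∷ 1 ∷ 1 ∷ []))) (leaf (star 21))) (split 108 (split 96 (leaf (loops 4 (1 ∷ 1 ∷ 1 ∷ 4 ∷ 20 ∷ 9 ∷ 4 ∷ 82 ∷ 9 ∷ 4
  ∷ 41 ∷ 5 ∷ 3 ∷ 1 ∷ 1 ∷ []))) (leaf (star 25))) (leaf (star 21)))) (split 102 (split 96 (split 117 (split 90
  (split 99 (apart 148) (split 84 (apart 3) (apart 1))) (split 120 (apart 5284) (leaf (star 31)))) (split 126
  (split 120 (leaf (loops 4 (1 ∷ 1 ∷ 1 ∷ 4 ∷ 20 ∷ 9 ∷ 4 ∷ 82 ∷ 18 ∷ 9 ∷ 4 ∷ 4 ∷ 36 ∷ 18 ∷ 5 ∷ 3 ∷ 1 ∷ 1 ∷ [])))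
  (leaf (star 28))) (split 129 (split 120 (leaf (loops 4 (1 ∷ 1 ∷ 1 ∷ 4 ∷ 20 ∷ 9 ∷ 4 ∷ 82 ∷ 9 ∷ 4 ∷ 297 ∷ 9 ∷ 4 ∷
  41 ∷ 5 ∷ 3 ∷ 1 ∷ 1 ∷ []))) (leaf (star 36))) (leaf (star 28))))) (leaf (star 25))) (leaf (star 21)))))) (leaf
  (star 18)))) (leaf (star 12))) (leaf (star 9)))) (leaf (star 4))) (leaf (star 1))))) (split 30 (split 33 (split
  48 (split 54 (split 36 (leaf (match (1 ∷ 11 ∷ []) (2 ∷ 9 ∷ 17 ∷ 18 ∷ 20 ∷ []) (1 ∷ []))) (split 57 (split 63
  (split 69 (split 72 (leaf (match (1 ∷ 11 ∷ []) (2 ∷ 9 ∷ 18 ∷ 22 ∷ 24 ∷ []) (1 ∷ []))) (leaf (match (2 ∷ 35 ∷ [])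
  (3 ∷ 10 ∷ 15 ∷ 19 ∷ 23 ∷ []) (87 ∷ [])))) (split 72 (split 39 (split 41 (apart 1) (apart 1)) (leaf (star 24)))
  (split 39 (leaf (star 13)) (split 78 (leaf (match (11 ∷ 17 ∷ []) (26 ∷ 27 ∷ []) (29 ∷ []))) (leaf (star 24))))))
  (leaf (match (1 ∷ 11 ∷ 59 ∷ []) (2 ∷ 9 ∷ 18 ∷ []) (1 ∷ 42 ∷ 124 ∷ [])))) (split 15 (split 63 (split 39 (split 72
  (split 81 (split 17 (leaf (loops 8 (1 ∷ 3 ∷ 3 ∷ 4 ∷ 20 ∷ 18 ∷ 18 ∷ 5 ∷ 3 ∷ 1 ∷ []))) (apart 1)) (leaf (star
  24))) (leaf (star 25))) (split 66 (split 78 (leaf (match (20 ∷ 38 ∷ []) (20 ∷ 15 ∷ 8 ∷ 28 ∷ 14 ∷ 2 ∷ 10 ∷ 11 ∷ 3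
  ∷ 17 ∷ []) (118 ∷ []))) (leaf (star 24))) (split 84 (split 78 (split 80 (apart 1) (apart 1)) (leaf (star 27)))
  (split 78 (leaf (star 29)) (split 90 (leaf (match (17 ∷ 38 ∷ []) (30 ∷ 31 ∷ []) (169 ∷ []))) (leaf (star
  25))))))) (leaf (match (1 ∷ 11 ∷ 59 ∷ []) (2 ∷ 9 ∷ 18 ∷ []) (1 ∷ 43 ∷ 124 ∷ [])))) (leaf (match (2 ∷ 20 ∷ 35 ∷
  []) (3 ∷ 10 ∷ 15 ∷ []) (2 ∷ 87 ∷ 110 ∷ [])))))) (split 36 (split 39 (split 66 (split 42 (split 15 (leaf (match
  (1 ∷ 11 ∷ []) (2 ∷ 17 ∷ 20 ∷ 22 ∷ 24 ∷ []) (1 ∷ []))) (leaf (match (2 ∷ 23 ∷ []) (1 ∷ 10 ∷ 16 ∷ 19 ∷ 23 ∷ []) (3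
  ∷ [])))) (split 15 (split 72 (split 17 (apart 1) (apart 1)) (leaf (star 25))) (split 72 (leaf (star 6)) (split
  81 (leaf (match (1 ∷ 41 ∷ []) (26 ∷ 27 ∷ []) (31 ∷ []))) (leaf (star 25)))))) (leaf (match (1 ∷ 11 ∷ 56 ∷ []) (2
  ∷ 17 ∷ 20 ∷ []) (1 ∷ 48 ∷ 79 ∷ [])))) (split 15 (split 66 (split 75 (split 78 (leaf (loops 8 (1 ∷ 3 ∷ 4 ∷ 4 ∷ 20
  ∷ 18 ∷ 9 ∷ 3 ∷ 3 ∷ 1 ∷ []))) (leaf (star 25))) (split 72 (split 84 (leaf (match (20 ∷ 38 ∷ []) (18 ∷ 16 ∷ 11 ∷
  28 ∷ 5 ∷ 1 ∷ 8 ∷ 10 ∷ 2 ∷ 9 ∷ []) (130 ∷ []))) (leaf (star 24))) (split 78 (split 84 (split 80 (apart 1) (apart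
  1)) (leaf (star 26))) (split 84 (leaf (star 28)) (split 93 (leaf (match (20 ∷ 41 ∷ []) (30 ∷ 31 ∷ []) (157 ∷
  []))) (leaf (star 25))))))) (leaf (match (1 ∷ 11 ∷ 56 ∷ []) (2 ∷ 17 ∷ 20 ∷ []) (1 ∷ 48 ∷ 79 ∷ [])))) (leaf
  (match (2 ∷ 23 ∷ 38 ∷ []) (1 ∷ 10 ∷ 16 ∷ []) (3 ∷ 74 ∷ 94 ∷ []))))) (split 57 (split 72 (split 15 (split 75
  (split 78 (leaf (loops 8 (1 ∷ 3 ∷ 4 ∷ 4 ∷ 20 ∷ 18 ∷ 9 ∷ 3 ∷ 3 ∷ 1 ∷ []))) (split 66 (split 39 (apart 12) (leaf
  (star 28))) (leaf (star 23)))) (split 87 (split 78 (leaf (loops 8 (1 ∷ 3 ∷ 4 ∷ 4 ∷ 20 ∷ 9 ∷ 4 ∷ 82 ∷ 18 ∷ 5 ∷ 3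
  ∷ 1 ∷ []))) (leaf (star 28))) (split 78 (split 90 (split 96 (leaf (loops 8 (1 ∷ 3 ∷ 4 ∷ 4 ∷ 20 ∷ 9 ∷ 4 ∷ 82 ∷ 9
  ∷ 4 ∷ 9 ∷ 1 ∷ 1 ∷ 1 ∷ []))) (leaf (star 28))) (split 66 (leaf (match (20 ∷ 41 ∷ []) (5 ∷ 4 ∷ 31 ∷ 26 ∷ 24 ∷ 18 ∷
  1 ∷ 8 ∷ 10 ∷ 11 ∷ 16 ∷ 22 ∷ 2 ∷ 9 ∷ []) (175 ∷ []))) (split 99 (leaf (match (20 ∷ 41 ∷ 59 ∷ []) (26 ∷ 31 ∷ [])
  (175 ∷ 130 ∷ 199 ∷ []))) (leaf (match (20 ∷ 41 ∷ 59 ∷ []) (26 ∷ 31 ∷ []) (175 ∷ 130 ∷ 199 ∷ [])))))) (split 66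
  (split 39 (apart 100) (leaf (match (23 ∷ 35 ∷ 77 ∷ []) (19 ∷ 23 ∷ []) (58 ∷ 127 ∷ 77 ∷ [])))) (leaf (star
  23)))))) (leaf (match (2 ∷ 23 ∷ 35 ∷ []) (1 ∷ 3 ∷ []) (3 ∷ 87 ∷ 58 ∷ [])))) (leaf (star 19))) (split 15 (split
  18 (split 84 (split 66 (split 87 (split 90 (apart 3220) (split 69 (apart 52) (leaf (match (38 ∷ 56 ∷ []) (20 ∷
  15 ∷ 31 ∷ 27 ∷ 14 ∷ 0 ∷ 2 ∷ 10 ∷ 11 ∷ 3 ∷ 17 ∷ 6 ∷ 8 ∷ []) (195 ∷ []))))) (split 99 (leaf (star 32)) (split 102
  (split 69 (apart 420) (split 105 (leaf (loops 8 (1 ∷ 3 ∷ 4 ∷ 4 ∷ 9 ∷ 4 ∷ 36 ∷ 18 ∷ 9 ∷ 4 ∷ 41 ∷ 5 ∷ 3 ∷ 1 ∷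
  []))) (leaf (star 28)))) (leaf (star 19))))) (split 87 (split 72 (split 96 (split 90 (apart 1172) (split 102
  (apart 148) (apart 148))) (leaf (star 19))) (split 96 (split 90 (apart 107668) (split 102 (apart 4) (apart
  212))) (leaf (star 19)))) (split 102 (split 90 (split 69 (apart 52) (leaf (star 30))) (split 69 (apart 404)
  (leaf (match (20 ∷ 41 ∷ 59 ∷ []) (5 ∷ 4 ∷ 18 ∷ 16 ∷ 1 ∷ 8 ∷ 10 ∷ 2 ∷ 9 ∷ []) (171 ∷ 131 ∷ 205 ∷ []))))) (split
  90 (split 69 (apart 1684) (leaf (match (20 ∷ 41 ∷ 59 ∷ []) (30 ∷ 35 ∷ []) (171 ∷ 131 ∷ 205 ∷ [])))) (split 69
  (apart 52) (leaf (match (20 ∷ 41 ∷ 59 ∷ []) (5 ∷ 4 ∷ 18 ∷ 16 ∷ 1 ∷ 8 ∷ 10 ∷ 2 ∷ 9 ∷ []) (171 ∷ 131 ∷ 205 ∷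
  [])))))))) (leaf (star 26))) (split 81 (split 66 (split 93 (split 69 (split 90 (apart 420) (leaf (match (17 ∷ 38
  ∷ 56 ∷ []) (14 ∷ 0 ∷ 20 ∷ 15 ∷ 2 ∷ 10 ∷ 11 ∷ 3 ∷ 17 ∷ []) (163 ∷ 40 ∷ 189 ∷ [])))) (split 90 (apart 420) (leaf
  (match (17 ∷ 38 ∷ 56 ∷ []) (14 ∷ 0 ∷ 20 ∷ 15 ∷ 2 ∷ 10 ∷ 11 ∷ 3 ∷ 17 ∷ []) (163 ∷ 41 ∷ 189 ∷ []))))) (leaf (star
  19))) (split 90 (leaf (star 30)) (split 69 (leaf (match (17 ∷ 38 ∷ 56 ∷ []) (14 ∷ 0 ∷ 20 ∷ 15 ∷ 2 ∷ 10 ∷ 11 ∷ 3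
  ∷ 17 ∷ []) (163 ∷ 40 ∷ 195 ∷ []))) (leaf (match (17 ∷ 38 ∷ 56 ∷ []) (14 ∷ 0 ∷ 20 ∷ 15 ∷ 2 ∷ 10 ∷ 11 ∷ 3 ∷ 17 ∷
  []) (163 ∷ 41 ∷ 195 ∷ [])))))) (split 66 (split 90 (leaf (star 32)) (split 69 (leaf (match (17 ∷ 38 ∷ 56 ∷ [])
  (14 ∷ 0 ∷ 20 ∷ 15 ∷ 2 ∷ 10 ∷ 11 ∷ 3 ∷ 17 ∷ []) (163 ∷ 40 ∷ 195 ∷ []))) (leaf (match (17 ∷ 38 ∷ 56 ∷ []) (14 ∷ 0
  ∷ 20 ∷ 15 ∷ 2 ∷ 10 ∷ 11 ∷ 3 ∷ 17 ∷ []) (163 ∷ 41 ∷ 195 ∷ []))))) (leaf (turtle (2 ∷ 0 ∷ 5 ∷ 8 ∷ 29 ∷ 47 ∷ [])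
  ((1 ∷ 1 ∷ 1 ∷ 1 ∷ 1 ∷ []) ∷ (1 ∷ 1 ∷ 3 ∷ 3 ∷ 1 ∷ []) ∷ (3 ∷ 2 ∷ 2 ∷ 1 ∷ 1 ∷ []) ∷ (2 ∷ 20 ∷ 2 ∷ 10 ∷ 2 ∷ []) ∷
  (2 ∷ 2 ∷ 2 ∷ 2 ∷ 10 ∷ []) ∷ (1 ∷ 1 ∷ 2 ∷ 1 ∷ 2 ∷ []) ∷ (1 ∷ 2 ∷ 5 ∷ 1 ∷ 1 ∷ []) ∷ (2 ∷ 2 ∷ 5 ∷ 1 ∷ 1 ∷ []) ∷ (10
  ∷ 2 ∷ 4 ∷ 4 ∷ 2 ∷ []) ∷ (1 ∷ 1 ∷ 4 ∷ 4 ∷ 1 ∷ []) ∷ (1 ∷ 2 ∷ 5 ∷ 1 ∷ 1 ∷ []) ∷ (1 ∷ 2 ∷ 4 ∷ 4 ∷ 1 ∷ []) ∷ (1 ∷ 2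
  ∷ 1 ∷ 3 ∷ 1 ∷ []) ∷ (2 ∷ 2 ∷ 2 ∷ 1 ∷ 1 ∷ []) ∷ (1 ∷ 1 ∷ 2 ∷ 1 ∷ 2 ∷ []) ∷ [])))))) (leaf (match (2 ∷ 23 ∷ 35 ∷
  []) (1 ∷ 3 ∷ []) (3 ∷ 87 ∷ 58 ∷ []))))))) (split 54 (split 36 (leaf (match (1 ∷ 11 ∷ 47 ∷ []) (2 ∷ 9 ∷ []) (1 ∷
  48 ∷ 73 ∷ []))) (leaf (match (1 ∷ 11 ∷ 47 ∷ []) (2 ∷ 9 ∷ []) (1 ∷ 48 ∷ 73 ∷ [])))) (split 36 (leaf (match (1 ∷
  11 ∷ 47 ∷ []) (2 ∷ 9 ∷ []) (1 ∷ 49 ∷ 73 ∷ []))) (leaf (match (1 ∷ 11 ∷ 47 ∷ []) (2 ∷ 9 ∷ []) (1 ∷ 49 ∷ 73 ∷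
  [])))))) (split 48 (split 15 (split 66 (split 57 (split 60 (split 75 (leaf (match (1 ∷ 8 ∷ []) (4 ∷ 9 ∷ 19 ∷ 22
  ∷ 25 ∷ []) (0 ∷ []))) (split 63 (split 81 (leaf (loops 4 (1 ∷ 1 ∷ 1 ∷ 2 ∷ 4 ∷ 9 ∷ 9 ∷ 5 ∷ 5 ∷ 2 ∷ []))) (leaf
  (star 22))) (split 54 (leaf (match (1 ∷ 8 ∷ 62 ∷ []) (9 ∷ 16 ∷ []) (0 ∷ 158 ∷ 109 ∷ []))) (leaf (match (1 ∷ 8 ∷
  62 ∷ []) (9 ∷ 16 ∷ []) (0 ∷ 158 ∷ 109 ∷ [])))))) (split 63 (split 75 (split 81 (leaf (loops 4 (1 ∷ 1 ∷ 1 ∷ 4 ∷ 9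
  ∷ 9 ∷ 9 ∷ 13 ∷ 2 ∷ 2 ∷ []))) (leaf (star 22))) (split 87 (split 81 (leaf (loops 4 (1 ∷ 1 ∷ 1 ∷ 4 ∷ 9 ∷ 9 ∷ 82 ∷
  4 ∷ 9 ∷ 5 ∷ 5 ∷ 2 ∷ []))) (split 54 (split 36 (apart 292) (leaf (match (1 ∷ 8 ∷ 77 ∷ []) (9 ∷ 16 ∷ 28 ∷ []) (0 ∷
  176 ∷ 71 ∷ [])))) (split 99 (split 102 (leaf (loops 4 (1 ∷ 1 ∷ 1 ∷ 4 ∷ 9 ∷ 18 ∷ 4 ∷ 9 ∷ 9 ∷ 37 ∷ 4 ∷ 5 ∷ 5 ∷ 2 ∷
  []))) (leaf (star 23))) (split 36 (leaf (match (11 ∷ 17 ∷ 83 ∷ []) (23 ∷ 31 ∷ []) (28 ∷ 73 ∷ 155 ∷ []))) (leaf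
  (match (11 ∷ 17 ∷ 83 ∷ []) (23 ∷ 31 ∷ []) (28 ∷ 73 ∷ 155 ∷ []))))))) (leaf (star 22)))) (split 54 (leaf (match
  (1 ∷ 8 ∷ 62 ∷ []) (9 ∷ 16 ∷ []) (0 ∷ 43 ∷ 109 ∷ []))) (leaf (match (1 ∷ 8 ∷ 62 ∷ []) (9 ∷ 16 ∷ []) (0 ∷ 43 ∷ 109
  ∷ [])))))) (split 18 (split 75 (split 60 (leaf (loops 4 (1 ∷ 1 ∷ 1 ∷ 1 ∷ 2 ∷ 2 ∷ 2 ∷ 2 ∷ 2 ∷ 2 ∷ []))) (split 84
  (split 87 (leaf (match (1 ∷ 11 ∷ 59 ∷ []) (22 ∷ 23 ∷ []) (1 ∷ 43 ∷ 78 ∷ []))) (leaf (match (1 ∷ 11 ∷ 59 ∷ [])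
  (22 ∷ 23 ∷ []) (1 ∷ 43 ∷ 79 ∷ [])))) (leaf (star 22)))) (split 63 (split 81 (split 87 (split 90 (leaf (loops 4
  (1 ∷ 1 ∷ 1 ∷ 1 ∷ 2 ∷ 2 ∷ 4 ∷ 9 ∷ 9 ∷ 13 ∷ 2 ∷ 2 ∷ []))) (split 99 (leaf (match (1 ∷ 11 ∷ 83 ∷ []) (22 ∷ 23 ∷ [])
  (1 ∷ 43 ∷ 78 ∷ []))) (leaf (match (1 ∷ 11 ∷ 83 ∷ []) (22 ∷ 23 ∷ []) (1 ∷ 43 ∷ 79 ∷ []))))) (split 99 (split 90
  (leaf (loops 4 (1 ∷ 1 ∷ 1 ∷ 1 ∷ 2 ∷ 4 ∷ 9 ∷ 9 ∷ 74 ∷ 4 ∷ 9 ∷ 13 ∷ 2 ∷ 2 ∷ []))) (split 54 (leaf (match (23 ∷ 89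
  ∷ []) (20 ∷ 16 ∷ 10 ∷ 1 ∷ 28 ∷ 31 ∷ 32 ∷ 11 ∷ 13 ∷ 5 ∷ 22 ∷ 26 ∷ 6 ∷ 24 ∷ 4 ∷ []) (119 ∷ []))) (leaf (star
  20)))) (split 102 (leaf (match (1 ∷ 11 ∷ 83 ∷ []) (22 ∷ 23 ∷ []) (1 ∷ 43 ∷ 78 ∷ []))) (leaf (match (1 ∷ 11 ∷ 83
  ∷ []) (22 ∷ 23 ∷ []) (1 ∷ 43 ∷ 79 ∷ [])))))) (leaf (star 22))) (leaf (star 16)))) (split 63 (split 78 (split 54
  (split 36 (split 93 (apart 2708) (split 96 (apart 148) (leaf (star 23)))) (split 93 (split 96 (split 81 (apart
  20) (apart 12)) (leaf (star 23))) (split 102 (split 96 (split 108 (apart 36) (leaf (star 32))) (leaf (star 23)))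
  (split 105 (leaf (match (8 ∷ 23 ∷ 86 ∷ []) (16 ∷ 20 ∷ []) (63 ∷ 71 ∷ 118 ∷ []))) (leaf (match (8 ∷ 23 ∷ 86 ∷ [])
  (16 ∷ 20 ∷ []) (63 ∷ 71 ∷ 119 ∷ []))))))) (split 87 (split 102 (split 105 (apart 300180) (split 108 (leaf (loops
  4 (1 ∷ 1 ∷ 1 ∷ 1 ∷ 2 ∷ 2 ∷ 4 ∷ 9 ∷ 82 ∷ 4 ∷ 9 ∷ 5 ∷ 5 ∷ 2 ∷ []))) (split 99 (leaf (match (23 ∷ 50 ∷ 80 ∷ []) (20
  ∷ 29 ∷ []) (58 ∷ 151 ∷ 199 ∷ []))) (leaf (match (23 ∷ 50 ∷ 80 ∷ []) (20 ∷ 29 ∷ []) (58 ∷ 151 ∷ 199 ∷ []))))))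
  (split 111 (split 93 (split 105 (apart 4756) (split 108 (leaf (loops 4 (1 ∷ 1 ∷ 1 ∷ 1 ∷ 2 ∷ 4 ∷ 9 ∷ 82 ∷ 4 ∷ 9 ∷
  36 ∷ 4 ∷ 5 ∷ 5 ∷ 2 ∷ []))) (leaf (star 23)))) (split 105 (apart 13460) (split 108 (leaf (loops 4 (1 ∷ 1 ∷ 1 ∷ 1
  ∷ 2 ∷ 4 ∷ 9 ∷ 82 ∷ 4 ∷ 9 ∷ 37 ∷ 4 ∷ 5 ∷ 5 ∷ 2 ∷ []))) (leaf (star 23))))) (split 96 (split 117 (split 120 (apart
  5268) (split 123 (apart 1316) (split 114 (apart 4) (apart 12)))) (split 114 (split 105 (apart 4756) (leaf (star
  32))) (split 105 (split 108 (leaf (loops 4 (1 ∷ 1 ∷ 1 ∷ 1 ∷ 2 ∷ 4 ∷ 9 ∷ 9 ∷ 36 ∷ 4 ∷ 4 ∷ 9 ∷ 9 ∷ 37 ∷ 4 ∷ 5 ∷ 5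
  ∷ 2 ∷ []))) (leaf (star 29))) (split 108 (split 135 (leaf (loops 4 (1 ∷ 1 ∷ 1 ∷ 1 ∷ 2 ∷ 4 ∷ 9 ∷ 82 ∷ 4 ∷ 9 ∷ 330
  ∷ 4 ∷ 9 ∷ 37 ∷ 4 ∷ 5 ∷ 5 ∷ 2 ∷ []))) (leaf (star 32))) (leaf (star 29)))))) (leaf (star 23))))) (leaf (star
  20)))) (leaf (star 22))) (leaf (star 16))))) (leaf (star 4))) (split 57 (split 63 (split 72 (split 54 (leaf
  (match (1 ∷ 8 ∷ []) (9 ∷ 16 ∷ 19 ∷ 24 ∷ 26 ∷ []) (0 ∷ []))) (split 75 (split 81 (split 36 (apart 1) (apart 1))
  (leaf (match (1 ∷ 8 ∷ 68 ∷ []) (9 ∷ 19 ∷ 24 ∷ []) (0 ∷ 134 ∷ 160 ∷ [])))) (split 81 (split 36 (leaf (star 29))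
  (split 90 (leaf (star 22)) (split 39 (leaf (match (2 ∷ 35 ∷ []) (13 ∷ 31 ∷ []) (87 ∷ []))) (leaf (star 22)))))
  (leaf (match (1 ∷ 8 ∷ 77 ∷ []) (9 ∷ 19 ∷ 24 ∷ []) (0 ∷ 37 ∷ 160 ∷ [])))))) (split 54 (split 36 (split 39 (split
  66 (apart 1) (apart 1)) (leaf (match (1 ∷ 8 ∷ 38 ∷ []) (9 ∷ 16 ∷ 26 ∷ []) (0 ∷ 42 ∷ 22 ∷ [])))) (split 84 (split
  87 (leaf (star 29)) (split 39 (leaf (star 13)) (split 66 (leaf (match (11 ∷ 17 ∷ []) (22 ∷ 31 ∷ []) (29 ∷ [])))
  (leaf (star 4))))) (leaf (match (1 ∷ 8 ∷ 74 ∷ []) (9 ∷ 16 ∷ 26 ∷ []) (0 ∷ 42 ∷ 71 ∷ []))))) (split 75 (split 90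
  (split 96 (split 105 (split 111 (apart 4) (apart 4)) (split 84 (split 108 (split 36 (apart 4) (apart 4)) (split
  66 (split 111 (apart 18) (apart 146)) (leaf (star 4)))) (split 36 (split 66 (split 69 (split 126 (apart 1700)
  (apart 36)) (split 111 (apart 18) (apart 18))) (leaf (star 4))) (split 126 (split 66 (split 111 (apart 18)
  (apart 12882)) (leaf (star 4))) (split 129 (split 39 (leaf (star 44)) (split 111 (apart 18) (apart 1620))) (leaf
  (star 42))))))) (split 84 (split 66 (split 114 (split 120 (apart 27284) (apart 4)) (split 69 (split 102 (apart
  430674) (apart 4)) (split 105 (split 138 (apart 4) (apart 4)) (split 108 (split 111 (split 120 (apart 4) (apart
  18)) (split 129 (split 138 (apart 74) (apart 594)) (split 165 (split 120 (apart 4) (apart 84644)) (leaf (star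
  38))))) (split 138 (apart 74) (apart 146)))))) (leaf (star 4))) (leaf (star 29)))) (leaf (star 25))) (split 84
  (split 36 (leaf (star 32)) (split 87 (leaf (match (2 ∷ 35 ∷ 74 ∷ []) (3 ∷ 1 ∷ 26 ∷ 20 ∷ 9 ∷ 15 ∷ 17 ∷ 10 ∷ 16 ∷
  []) (87 ∷ 34 ∷ 195 ∷ []))) (leaf (match (2 ∷ 35 ∷ 74 ∷ []) (3 ∷ 1 ∷ 26 ∷ 20 ∷ 9 ∷ 15 ∷ 17 ∷ 10 ∷ 16 ∷ []) (87 ∷
  35 ∷ 195 ∷ []))))) (leaf (turtle (0 ∷ 5 ∷ 23 ∷ 29 ∷ 47 ∷ 62 ∷ []) ((1 ∷ 1 ∷ 2 ∷ 1 ∷ 2 ∷ []) ∷ (3 ∷ 2 ∷ 2 ∷ 1 ∷ 1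
  ∷ []) ∷ (2 ∷ 2 ∷ 4 ∷ 1 ∷ 1 ∷ []) ∷ (2 ∷ 2 ∷ 2 ∷ 4 ∷ 2 ∷ []) ∷ (4 ∷ 2 ∷ 9 ∷ 41 ∷ 2 ∷ []) ∷ (1 ∷ 2 ∷ 1 ∷ 2 ∷ 1 ∷
  []) ∷ (1 ∷ 2 ∷ 5 ∷ 1 ∷ 1 ∷ []) ∷ (1 ∷ 2 ∷ 2 ∷ 5 ∷ 1 ∷ []) ∷ (10 ∷ 2 ∷ 4 ∷ 4 ∷ 2 ∷ []) ∷ (1 ∷ 1 ∷ 2 ∷ 5 ∷ 1 ∷ [])
  ∷ (2 ∷ 1 ∷ 1 ∷ 2 ∷ 1 ∷ []) ∷ (1 ∷ 3 ∷ 2 ∷ 3 ∷ 1 ∷ []) ∷ (1 ∷ 1 ∷ 2 ∷ 1 ∷ 3 ∷ []) ∷ (2 ∷ 2 ∷ 2 ∷ 1 ∷ 1 ∷ []) ∷ (1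
  ∷ 2 ∷ 2 ∷ 1 ∷ 1 ∷ []) ∷ []))))))) (split 72 (split 54 (leaf (match (1 ∷ 8 ∷ 62 ∷ []) (9 ∷ 16 ∷ []) (0 ∷ 42 ∷ 109
  ∷ []))) (leaf (match (1 ∷ 8 ∷ 62 ∷ []) (9 ∷ 16 ∷ []) (0 ∷ 42 ∷ 109 ∷ [])))) (split 54 (leaf (match (1 ∷ 8 ∷ 62 ∷
  []) (9 ∷ 16 ∷ []) (0 ∷ 43 ∷ 109 ∷ []))) (leaf (match (1 ∷ 8 ∷ 62 ∷ []) (9 ∷ 16 ∷ []) (0 ∷ 43 ∷ 109 ∷ []))))))
  (leaf (star 1)))) (leaf (star 9)))) (leaf (star 2)))) none)) none

-- From the exploration to the classification

every-sound : ∀ {k} (p : Fin k → Bool) → every p ≡ true → ∀ i → p i ≡ true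
every-sound p e zero    = proj₁ (both {p zero} e)
every-sound p e (suc i) = every-sound (λ j → p (suc j)) (proj₂ (both {p zero} e)) i

some-sound : ∀ {k} {p : Fin k → Bool} → some p ≡ true → ∃[ i ] p i ≡ true
some-sound {suc k} {p} e with either {p zero} e
... | inj₁ q = zero , q
... | inj₂ q with some-sound {k} q
... | i , r = suc i , r

does-sound : ∀ {A : Set} (d : Dec A) → does d ≡ true → A
does-sound (yes a) _ = a

does-complete : ∀ {A : Set} (d : Dec A) → A → does d ≡ true
does-complete (yes _) _ = refl
does-complete (no ¬a) a = ⊥-elim (¬a a)

module Proof (F : Fullerene) (resonant : KResonant (Fullerene.graph F) 3)
  (S : Fin (PlaneCubicGraph.nf (Fullerene.graph F)) → Set)
  (maximal : IsMaximalPentagonalFragment (Fullerene.graph F) S) where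
  open Local F
  open PlaneCubicGraph G using (face; nf)
  open Darts G
  open Models G
  open Reading G
  open CheckSoundness G
  open Matchings F resonant
  open Region F S maximal

  module LeafSound {t : Table} {β : ℕ → D} (m : β ⊨ t) (start : Boundary (β 0))
    (clash : List Bool → Slot → Slot → Bool) (clash-sound : ∀ w a b → clash w a b ≡ true → at β a ≢ at β b)
    (edge : Fin 6 → Fin 6 → Bool)
    (edge-sound : ∀ i k → edge i k ≡ true → PairIn edges (toℕ i) (toℕ k))
    (edge-complete : ∀ i k → PairIn edges (toℕ i) (toℕ k) → edge i k ≡ true) where
    open LeafCheck t clash edge

    within-sound : ∀ w x {p} → Inside (at β x) → within w x p ≡ true → ∃[ y ] Inside (at β y) × p y ≡ true
    within-sound [] x i e = x , i , e
    within-sound (false ∷ w) x i e with steps-sound m 1 x e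
    ... | y , y≡ , q = within-sound w y (inside-face (trans (sym (face-next _)) (cong face (sym y≡))) i) q
    within-sound (true ∷ w) x i e with onLink-sound t x e
    ... | y , l , q with both {hasSize t pent y} q
    ... | r , s = within-sound w y (subst Inside (links m x l)
      (inside-flip i (subst (HasLen pent) (sym (links m x l)) (size-sound m pent y r)))) s

    module Loop (w₀ : ℕ) (ws₀ : List ℕ) (y : Slot) (closed : walk (w₀ ∷ ws₀) (0 , zero) y ≡ true) where

      -- The closed walk may have to be run through several times before `k` steps are done:
      -- `avoids′` starts it again at the root when the list ends. The recursion is on `k`.
      avoids  : ∀ k w ws z → walk (w ∷ ws) z y ≡ true → iter along-boundary k (at β z) ≢ at β y
      avoids′ : ∀ k ws z → walk ws z y ≡ true → iter along-boundary k (at β z) ≢ at β y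
      avoids zero w ws z e eq = clash-sound (bits w) z y (proj₁ (both {clash (bits w) z y} e)) eq
      avoids (suc k) w ws z e eq with steps-sound m 1 z (proj₂ (both {clash (bits w) z y} e))
      ... | p , p≡ , e₁ with onLink-sound t p e₁
      ... | q , l , e₂ = rest (either {hasSize t hex q ∧ walk ws p y} e₂)
        where
        ahead : at β q ≡ flip (next (at β z))
        ahead = trans (sym (links m p l)) (cong flip p≡)
        continue : ∀ x → along-boundary (at β z) ≡ at β x → walk ws x y ≡ true → ⊥
        continue x x≡ w = avoids′ k ws x w (trans (cong (iter along-boundary k) (sym x≡))
          (trans (sym (iter-suc along-boundary k (at β z))) eq))
        rest : _ → ⊥
        rest (inj₁ r) with both {hasSize t hex q} r
        ... | h , u = continue p (trans (along-hex (subst (HasLen hex) ahead (size-sound m hex q h))) (sym p≡)) u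
        rest (inj₂ r) with both {hasSize t pent q} r
        ... | h , u = continue (rotate p) (trans (along-pent (subst (HasLen pent) ahead (size-sound m pent q h)))
          (trans (cong turn (sym p≡)) (sym (at-rotate β p)))) u
      avoids′ k (w ∷ ws) z e = avoids k w ws z e
      avoids′ k []       z e with ==-sound z (0 , zero) e
      ... | refl = avoids k w₀ ws₀ (0 , zero) closed

    -- `y` belongs to a boundary dart, so it is in the orbit of the root by `one-boundary`, yet this
    -- orbit closes up without it.
    loopsOK-sound : ∀ w ws → loopsOK w ws ≢ true
    loopsOK-sound w (w₁ ∷ ws) e with within-sound (bits w) (0 , zero) (proj₁ start) e
    ... | y , i , e₁ with both {onLink t y (hasSize t hex)} e₁
    ... | p , q with onLink-sound t y p
    ... | z , l , r with one-boundary start (i , subst (HasLen hex) (sym (links m y l)) (size-sound m hex z r))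
    ... | k , eq = Loop.avoids w₁ ws y q k w₁ ws (0 , zero) q eq

    abstract
      each-sound : ∀ k x {p} → each k x p ≡ true → ∀ {j} → j < k → ∃[ y ] at β y ≡ iter next j (at β x) × p y ≡ true
      each-sound (suc k) x {p} e {zero}  j<k       = x , refl , proj₁ (both {p x} e)
      each-sound (suc k) x {p} e {suc j} (s≤s j<k) with onLink-sound t x (proj₂ (both {p x} e))
      ... | y , l , q with each-sound k (rotate y) q j<k
      ... | z , z≡ , r = z , trans z≡ (trans (cong (iter next j) (links-next m x l)) (sym (iter-suc next j _))) , r

      distinctFrom-sound : ∀ k x y ws → distinctFrom k x y ws ≡ true → ∀ {j} → j < k → iter next j (at β y) ≢ at β x
      distinctFrom-sound (suc k) x y (w ∷ ws) e {zero} j<k eq =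
        clash-sound (bits w) x y (proj₁ (both {clash (bits w) x y} e)) (sym eq)
      distinctFrom-sound (suc k) x y (w ∷ ws) e {suc j} (s≤s j<k) eq
        with onLink-sound t y (proj₂ (both {clash (bits w) x y} e))
      ... | z , l , q = distinctFrom-sound k x (rotate z) ws q j<k
        (trans (cong (iter next j) (links-next m y l)) (trans (sym (iter-suc next j _)) eq))

    module TurtleSound (T : Fin 6 → Slot) (wss : List (List ℕ)) (ok : Turtle.turtleOK T wss ≡ true) where
      open Turtle T

      τ : Fin 6 → Fin nf
      τ i = face (at β (T i))

      abstract
        apartFrom-sound : ∀ {k} x (U : Fin k → Slot) wss {p} → (∀ i → HasLen pent (at β (U i))) →
          apartFrom x U wss p ≡ true → (∀ i → face (at β x) ≢ face (at β (U i))) × ∃[ wss′ ] p wss′ ≡ true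
        apartFrom-sound {zero}  x U wss h e = (λ ()) , wss , e
        apartFrom-sound {suc k} x U (ws ∷ wss) h e with both {distinctFrom 5 x (U zero) ws} e
        ... | p , q with apartFrom-sound x (λ i → U (suc i)) wss (λ i → h (suc i)) q
        ... | r , rest = first , rest
          where
          first : ∀ i → face (at β x) ≢ face (at β (U i))
          first zero eq with on-face (h zero) (sym eq)
          ... | j , j< , eq′ = distinctFrom-sound 5 x (U zero) ws p j< eq′
          first (suc i) eq = r i eq

        allApart-sound : ∀ {k} (U : Fin k → Slot) wss → (∀ i → HasLen pent (at β (U i))) →
          allApart U wss ≡ true → ∀ i j → face (at β (U i)) ≡ face (at β (U j)) → i ≡ j
        allApart-sound {suc k} U wss h e with apartFrom-sound (U zero) (λ i → U (suc i)) wss (λ i → h (suc i)) e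
        ... | r , wss′ , q = result
          where
          result : ∀ i j → face (at β (U i)) ≡ face (at β (U j)) → i ≡ j
          result zero    zero    eq = refl
          result zero    (suc j) eq = ⊥-elim (r j eq)
          result (suc i) zero    eq = ⊥-elim (r i (sym eq))
          result (suc i) (suc j) eq =
            cong suc (allApart-sound (λ i → U (suc i)) wss′ (λ i → h (suc i)) q i j eq)

        settled-all : ∀ i → settled i ≡ true
        settled-all = every-sound settled (proj₁ (both {every settled} ok))

        pentagonal : ∀ i → HasLen pent (at β (T i))
        pentagonal i = size-sound m pent (T i) (proj₁ (both {hasSize t pent (T i)} (settled-all i)))

        exits neighbours-ok meets-ok : Fin 6 → Bool
        exits i = along t 5 (T i) (λ x → onLink t x (hasSize t hex))
        neighbours-ok i = each 5 (T i) (λ x → onLink t x (touching i))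
        meets-ok i = every (λ k → not (edge i k) ∨ meets i k)

        rest : ∀ i → exits i ∧ (neighbours-ok i ∧ meets-ok i) ≡ true
        rest i = proj₂ (both {hasSize t pent (T i)} (settled-all i))

        τ-injective : ∀ i j → τ i ≡ τ j → i ≡ j
        τ-injective = allApart-sound T wss pentagonal
          (proj₁ (both {allApart T wss} (proj₂ (both {every settled} ok))))

        touching-sound : ∀ i z → touching i z ≡ true →
          HasLen hex (at β z) ⊎ ∃[ k ] edge i k ≡ true × face (at β z) ≡ τ k
        touching-sound i z e with either {hasSize t hex z} e
        ... | inj₁ h = inj₁ (size-sound m hex z h)
        ... | inj₂ q with some-sound q
        ... | k , r with both {edge i k} r
        ... | ik , f = inj₂ (k , ik , onFace-sound m (T k) z f)

        side : ∀ i {j} → j < 5 → ∃[ y ] at β y ≡ iter next j (at β (T i)) × onLink t y (touching i) ≡ true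
        side i j< = each-sound 5 (T i) (proj₁ (both {neighbours-ok i} (proj₂ (both {exits i} (rest i))))) j<

        across-side : ∀ i y d → at β y ≡ d → onLink t y (touching i) ≡ true →
          HasLen hex (flip d) ⊎ ∃[ k ] edge i k ≡ true × face (flip d) ≡ τ k
        across-side i y d refl p with onLink-sound t y p
        ... | z , l , q = subst (λ e → HasLen hex e ⊎ ∃[ k ] edge i k ≡ true × face e ≡ τ k) (sym (links m y l))
                            (touching-sound i z q)

        adjacent : ∀ i d → face d ≡ τ i → HasLen hex (flip d) ⊎ ∃[ k ] edge i k ≡ true × face (flip d) ≡ τ k
        adjacent i d e = from-side (on-face (pentagonal i) (sym e))
          where
          from-side : ∃[ j ] j < 5 × iter next j (at β (T i)) ≡ d →
            HasLen hex (flip d) ⊎ ∃[ k ] edge i k ≡ true × face (flip d) ≡ τ k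
          from-side (j , j< , eq) = across-side i (proj₁ (side i j<)) d (trans (proj₁ (proj₂ (side i j<))) eq)
            (proj₂ (proj₂ (side i j<)))

        shared : ∀ i k → edge i k ≡ true → ∃[ d ] face d ≡ τ i × face (flip d) ≡ τ k
        shared i k ik with either {not (edge i k)} (every-sound (λ k → not (edge i k) ∨ meets i k) (proj₂ (both {neighbours-ok i} (proj₂ (both {exits i} (rest i))))) k)
        ... | inj₁ p = ⊥-elim (not-true p ik)
        ... | inj₂ p with along-face m 5 (T i) p
        ... | x , fx , q with onLink-sound t x q
        ... | y , l , r = at β x , fx , trans (cong face (links m x l)) (onFace-sound m (T k) y r)

        exit : ∀ i → ∃[ d ] face d ≡ τ i × HasLen hex (flip d)
        exit i with along-face m 5 (T i) (proj₁ (both {exits i} (rest i)))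
        ... | x , fx , q with onLink-sound t x q
        ... | y , l , r = at β x , fx , subst (HasLen hex) (sym (links m x l)) (size-sound m hex y r)

        rooted : ∃[ i ] face (β 0) ≡ τ i
        rooted with some-sound (proj₂ (both {allApart T wss} (proj₂ (both {every settled} ok))))
        ... | i , p = i , onFace-sound m (T i) (0 , zero) p

        step-inside : ∀ i k → edge i k ≡ true → Inside (at β (T i)) → Inside (at β (T k))
        step-inside i k ik p with shared i k ik
        ... | d , fd , fe = inside-face fe (inside-flip (inside-face (sym fd) p) (HasLen-face (sym fe) (pentagonal k)))

        -- `edge` is a parameter and does not compute, but `pairIn?` does, so that the concrete
        -- adjacencies below are settled by `refl`.
        chain : ∀ i k → does (pairIn? edges (toℕ i) (toℕ k)) ≡ true → Inside (at β (T i)) → Inside (at β (T k))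
        chain i k e = step-inside i k (edge-complete i k (does-sound (pairIn? edges (toℕ i) (toℕ k)) e))

        -- The root dart may lie on any of the six pentagons. Being inside is carried from there to
        -- face 0 and then, by `from-first`, to all of them.
        to-first : ∀ i → Inside (at β (T i)) → Inside (at β (T 0F))
        to-first 0F p = p
        to-first 1F p = chain 1F 0F refl p
        to-first 2F p = chain 1F 0F refl (chain 2F 1F refl p)
        to-first 3F p = chain 1F 0F refl (chain 3F 1F refl p)
        to-first 4F p = chain 1F 0F refl (chain 2F 1F refl (chain 4F 2F refl p))
        to-first 5F p = chain 1F 0F refl (chain 2F 1F refl (chain 4F 2F refl (chain 5F 4F refl p)))

        from-first : Inside (at β (T 0F)) → ∀ i → Inside (at β (T i))
        from-first p 0F = p
        from-first p 1F = chain 0F 1F refl p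
        from-first p 2F = chain 1F 2F refl (chain 0F 1F refl p)
        from-first p 3F = chain 1F 3F refl (chain 0F 1F refl p)
        from-first p 4F = chain 2F 4F refl (chain 1F 2F refl (chain 0F 1F refl p))
        from-first p 5F = chain 4F 5F refl (chain 2F 4F refl (chain 1F 2F refl (chain 0F 1F refl p)))

        inside-all : ∀ i → Inside (at β (T i))
        inside-all = from-first (to-first (proj₁ rooted) (inside-face (proj₂ rooted) (proj₁ start)))

      member : ∀ i → S (τ i)
      member i with exit i
      ... | d , fd , h = subst S fd (boundary-inside (inside-face (sym fd) (inside-all i) , h))

      isTurtle : IsTurtle G S
      isTurtle = τ , τ-injective ,
        (λ g → mk⇔ (Component.complete τ closed (β 0 , start , rooted) g) (λ { (i , refl) → member i })) ,
        (λ i → lengthOf (pentagonal i)) ,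
        (λ i j _ → mk⇔ (λ { (d , fd , fe) → pair i j (adjacent i d fd) fe }) (λ p → shared i j (edge-complete i j p)))
        where
        closed : ∀ i d → face d ≡ τ i → HasLen hex (flip d) ⊎ ∃[ k ] face (flip d) ≡ τ k
        closed i d e = Sum.map₂ (λ { (k , _ , q) → k , q }) (adjacent i d e)
        pair : ∀ i j {d} → HasLen hex (flip d) ⊎ (∃[ k ] edge i k ≡ true × face (flip d) ≡ τ k) →
          face (flip d) ≡ τ j → PairIn edges (toℕ i) (toℕ j)
        pair i j (inj₁ h) fe = ⊥-elim (pent≢hex (HasLen-face (sym fe) (pentagonal j)) h)
        pair i j (inj₂ (k , ik , fk)) fe with τ-injective k j (trans (sym fk) fe)
        ... | refl = edge-sound i k ik

    leaf-sound : ∀ a → leafOK a ≡ true → SinglePentagon G S ⊎ IsTurtle G S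
    leaf-sound (star v)        e = ⊥-elim (starOK-sound m clash edge v e)
    leaf-sound (match H vs cs) e = ⊥-elim (matchOK-sound m (map slot H) vs cs e)
    leaf-sound (turtle xs wss) e = inj₂ (TurtleSound.isTurtle (λ i → nth xs (toℕ i)) wss e)
    leaf-sound (loops w ws)    e = ⊥-elim (loopsOK-sound w ws e)

  mainTable : Table
  mainTable = path pent (just hex ∷ just pent ∷ [])

  checkLeaf : Leaf → Table → Bool
  checkLeaf a t = LeafCheck.leafOK t (Clash.clash facts₄ t) turtleEdge a

  -- The closing `refl` evaluates the checker on all of `mainCert`; the rest supplies the model of
  -- the initial table at `d` and the meaning of the leaves.
  adjacent-pentagons : ∀ d → Boundary d → HasLen pent (flip (next d)) → SinglePentagon G S ⊎ IsTurtle G S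
  adjacent-pentagons d b p with path-sound pent (just hex ∷ just pent ∷ []) d (inside-pent (proj₁ b)) (proj₂ b , p , tt)
  ... | γ , m , root = CheckSound.run-sound lens facts₄ known₄ nothing checkLeaf d _ (λ _ ())
    (λ a m′ root′ e → LeafSound.leaf-sound m′ (subst Boundary (sym root′) b)
      _ (Clashes.clash-sound facts₄ known₄ m′) turtleEdge (λ i k → does-sound (pairIn? edges (toℕ i) (toℕ k)))
      (λ i k → does-complete (pairIn? edges (toℕ i) (toℕ k))) a e) mainCert m root refl

  onward : ∀ d → Boundary d → Boundary (next d) ⊎ HasLen pent (flip (next d))
  onward d b with lens (flip (next d))
  ... | inj₁ p = inj₂ p
  ... | inj₂ h = inj₁ (inside-face (sym (face-next d)) (proj₁ b) , h)

  -- With hexagons across all five edges, the one-face family is closed in the sense of `Component`.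
  single : ∀ d → (∀ {j} → j < 5 → Boundary (iter next j d)) → SinglePentagon G S
  single d bs = face d , lengthOf p , λ g → mk⇔ (λ s → sym (proj₂ (Component.complete τ closed (d , b , zero , refl) g s)))
      (λ { refl → boundary-inside b })
    where
    b = bs {0} z<s
    p = inside-pent (proj₁ b)
    τ : Fin 1 → Fin nf
    τ _ = face d
    closed : ∀ i e → face e ≡ τ i → HasLen hex (flip e) ⊎ ∃[ j ] face (flip e) ≡ τ j
    closed i e q with on-face p (sym q)
    ... | j , j< , refl = inj₁ (proj₂ (bs j<))

  result : SinglePentagon G S ⊎ IsTurtle G S
  result with some-boundary
  ... | d , b₀ with onward d b₀
  ... | inj₂ p = adjacent-pentagons _ b₀ p
  ... | inj₁ b₁ with onward _ b₁
  ... | inj₂ p = adjacent-pentagons _ b₁ p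
  ... | inj₁ b₂ with onward _ b₂
  ... | inj₂ p = adjacent-pentagons _ b₂ p
  ... | inj₁ b₃ with onward _ b₃
  ... | inj₂ p = adjacent-pentagons _ b₃ p
  -- Five consecutive boundary edges are the whole pentagon; in every other case some boundary edge
  -- was followed by an edge to a pentagon.
  ... | inj₁ b₄ = inj₁ (single d sides)
    where
    sides : ∀ {j} → j < 5 → Boundary (iter next j d)
    sides {0} _ = b₀
    sides {1} _ = b₁
    sides {2} _ = b₂
    sides {3} _ = b₃
    sides {4} _ = b₄
    sides {suc (suc (suc (suc (suc j))))} (s≤s (s≤s (s≤s (s≤s (s≤s ())))))

theorem4p4 : (F : Fullerene) → KResonant (Fullerene.graph F) 3 →
    ¬ IsoToDodecahedron (Fullerene.graph F) →
    (S : Fin (PlaneCubicGraph.nf (Fullerene.graph F)) → Set) →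
    IsMaximalPentagonalFragment (Fullerene.graph F) S →
    SinglePentagon (Fullerene.graph F) S ⊎ IsTurtle (Fullerene.graph F) S
theorem4p4 F resonant _ S maximal = Proof.result F resonant S maximal
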